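{- Let $\mathcal{C}$ be a $430$-cap of $\mathrm{PG}(6,4)$ having two intersection sizes with respect to hyperplanes, that is, the set $\{|\Pi\cap\mathcal{C}| : \Pi \text{ a hyperplane of } \mathrm{PG}(6,4)\}$ has exactly two elements. Then there is no hyperplane $\Pi$ of $\mathrm{PG}(6,4)$ such that $\Pi\cap\mathcal{C}$, regarded as a set of points of $\Pi\cong\mathrm{PG}(5,4)$, is projectively equivalent to the Hill $78$-cap of $\mathrm{PG}(5,4)$.
   Context: $\mathrm{PG}(n,q)$ denotes the $n$-dimensional projective space over $\mathbb{F}_q$, whose points are the one-dimensional subspaces of an $(n+1)$-dimensional vector space over $\mathbb{F}_q$ and whose hyperplanes are the $n$-dimensional vector subspaces. A $k$-cap of $\mathrm{PG}(n,q)$ is a set of $k$ points, no three of which are collinear. The Hill $78$-cap of $\mathrm{PG}(5,4)$ is the following set of points. Regard $\mathbb{F}_{4^6}$ as a $6$-dimensional vector space over $\mathbb{F}_4$, so that its one-dimensional $\mathbb{F}_4$-subspaces are the points of $\mathrm{PG}(5,4)$. Let $z$ be a primitive element of $\mathbb{F}_{4^6}$ (a generator of its multiplicative group), and let $O=\langle z^{35}\rangle\cup z^{7}\langle z^{35}\rangle$, a set of $234=3\cdot 78$ nonzero vectors that is closed under multiplication by $\mathbb{F}_4^{*}$. The Hill $78$-cap is the set of $78$ points of $\mathrm{PG}(5,4)$ spanned by the elements of $O$. Two sets of points of projective spaces isomorphic to $\mathrm{PG}(5,4)$ are projectively equivalent if some collineation (a bijection on points induced by an invertible semilinear map of the underlying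 vector spaces) maps one onto the other. -}

module Defs where

open import Algebra.Bundles using (CommutativeRing; RawRing)
import Algebra.Definitions.RawSemiring as RawSemiringDefinitions
open import Algebra.Module.Bundles using (LeftModule)
open import Algebra.Morphism.Structures
  using (IsRingHomomorphism; IsRingIsomorphism; IsGroupIsomorphism)
open import Algebra.Structures using (IsCommutativeRing)
open import Data.Fin.Base using (Fin)
open import Data.Fin.Patterns using (0F; 1F; 2F; 3F)
open import Data.Nat.Base using (ℕ; suc; _^_)
open import Data.Product.Base using (∃; ∃-syntax; Σ-syntax; _×_; _,_; proj₁; proj₂)
open import Data.Sum.Base using (_⊎_)
open import Data.Vec.Base using (Vec; []; _∷_; replicate; zipWith; map)
import Data.Vec.Properties as Vec
open import Function.Bundles using (_↔_; mk↔ₛ′; _⇔_)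
open import Level using (0ℓ)
open import Relation.Binary.Definitions using (DecidableEquality)
open import Relation.Binary.PropositionalEquality
  using (_≡_; _≢_; refl; sym; trans; cong; cong₂; isEquivalence)
open import Relation.Nullary using (Dec; yes; no; ¬_)
open import Relation.Nullary.Decidable using (True; toWitness)
open import Relation.Unary using (Pred)

------------------------------------------------------------------------
-- Finite fields

record FiniteField (q : ℕ) : Set₁ where
  infix  8 -_
  infixl 7 _*_
  infixl 6 _+_
  field
    Carrier           : Set
    _+_ _*_           : Carrier → Carrier → Carrier
    -_                : Carrier → Carrier
    0# 1#             : Carrier
    isCommutativeRing : IsCommutativeRing _≡_ _+_ _*_ -_ 0# 1#
    1≢0               : 1# ≢ 0#
    inverse           : ∀ x → x ≢ 0# → ∃[ y ] x * y ≡ 1#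
    enumeration       : Carrier ↔ Fin q

  commutativeRing : CommutativeRing 0ℓ 0ℓ
  commutativeRing = record { isCommutativeRing = isCommutativeRing }

  open CommutativeRing commutativeRing public using (ring; rawRing)
  open RawRing rawRing public using (rawSemiring)

  open RawSemiringDefinitions rawSemiring public using () renaming (_^_ to _^ᶠ_)

-- A generator of the multiplicative group.  The group is finite, so
-- exponents in ℕ suffice.
IsPrimitiveElement : ∀ {q} (K : FiniteField q) → FiniteField.Carrier K → Set
IsPrimitiveElement K z = z ≢ 0# × (∀ x → x ≢ 0# → ∃[ n ] x ≡ z ^ᶠ n)
  where open FiniteField K

-- The field of order q ^ m, as an extension of F.
record Extension {q : ℕ} (F : FiniteField q) (m : ℕ) : Set₁ where
  field
    K                  : FiniteField (q ^ m)
    ι                  : FiniteField.Carrier F → FiniteField.Carrier K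
    isRingHomomorphism :
      IsRingHomomorphism (FiniteField.rawRing F) (FiniteField.rawRing K) ι

  open FiniteField K public

------------------------------------------------------------------------
-- The field with four elements

data GF4 : Set where
  𝟎 𝟏 ω ω² : GF4

module GF4-arithmetic where

  infix  8 -_
  infixl 7 _*_
  infixl 6 _+_

  -- Characteristic 2, with 1 + ω = ω².
  _+_ : GF4 → GF4 → GF4
  𝟎  + y  = y
  𝟏  + 𝟎  = 𝟏
  𝟏  + 𝟏  = 𝟎
  𝟏  + ω  = ω²
  𝟏  + ω² = ω
  ω  + 𝟎  = ω
  ω  + 𝟏  = ω²
  ω  + ω  = 𝟎
  ω  + ω² = 𝟏
  ω² + 𝟎  = ω²
  ω² + 𝟏  = ω
  ω² + ω  = 𝟏
  ω² + ω² = 𝟎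

  _*_ : GF4 → GF4 → GF4
  𝟎  * y  = 𝟎
  𝟏  * y  = y
  ω  * 𝟎  = 𝟎
  ω  * 𝟏  = ω
  ω  * ω  = ω²
  ω  * ω² = 𝟏
  ω² * 𝟎  = 𝟎
  ω² * 𝟏  = ω²
  ω² * ω  = 𝟏
  ω² * ω² = ω

  -_ : GF4 → GF4
  - x = x

  toFin : GF4 → Fin 4
  toFin 𝟎  = 0F
  toFin 𝟏  = 1F
  toFin ω  = 2F
  toFin ω² = 3F

  fromFin : Fin 4 → GF4
  fromFin 0F = 𝟎
  fromFin 1F = 𝟏
  fromFin 2F = ω
  fromFin 3F = ω²

  toFin-fromFin : ∀ i → toFin (fromFin i) ≡ i
  toFin-fromFin 0F = refl
  toFin-fromFin 1F = refl
  toFin-fromFin 2F = refl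
  toFin-fromFin 3F = refl

  fromFin-toFin : ∀ x → fromFin (toFin x) ≡ x
  fromFin-toFin 𝟎  = refl
  fromFin-toFin 𝟏  = refl
  fromFin-toFin ω  = refl
  fromFin-toFin ω² = refl

  infix 4 _≟_
  _≟_ : DecidableEquality GF4
  𝟎  ≟ 𝟎  = yes refl
  𝟎  ≟ 𝟏  = no λ ()
  𝟎  ≟ ω  = no λ ()
  𝟎  ≟ ω² = no λ ()
  𝟏  ≟ 𝟎  = no λ ()
  𝟏  ≟ 𝟏  = yes refl
  𝟏  ≟ ω  = no λ ()
  𝟏  ≟ ω² = no λ ()
  ω  ≟ 𝟎  = no λ ()
  ω  ≟ 𝟏  = no λ ()
  ω  ≟ ω  = yes refl
  ω  ≟ ω² = no λ ()
  ω² ≟ 𝟎  = no λ ()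
  ω² ≟ 𝟏  = no λ ()
  ω² ≟ ω  = no λ ()
  ω² ≟ ω² = yes refl

  all? : {P : GF4 → Set} → (∀ x → Dec (P x)) → Dec (∀ x → P x)
  all? {P} P? with P? 𝟎 | P? 𝟏 | P? ω | P? ω²
  ... | no ¬p | _     | _     | _     = no λ f → ¬p (f 𝟎)
  ... | yes _ | no ¬p | _     | _     = no λ f → ¬p (f 𝟏)
  ... | yes _ | yes _ | no ¬p | _     = no λ f → ¬p (f ω)
  ... | yes _ | yes _ | yes _ | no ¬p = no λ f → ¬p (f ω²)
  ... | yes a | yes b | yes c | yes d = yes all
    where
    all : ∀ x → P x
    all 𝟎  = a
    all 𝟏  = b
    all ω  = c
    all ω² = d

  check₁ : {f g : GF4 → GF4} {_ : True (all? λ x → f x ≟ g x)} →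
           ∀ x → f x ≡ g x
  check₁ {_} {_} {t} = toWitness t

  check₂ : {f g : GF4 → GF4 → GF4} {_ : True (all? λ x → all? λ y → f x y ≟ g x y)} →
           ∀ x y → f x y ≡ g x y
  check₂ {_} {_} {t} = toWitness t

  check₃ : {f g : GF4 → GF4 → GF4 → GF4}
           {_ : True (all? λ x → all? λ y → all? λ z → f x y z ≟ g x y z)} →
           ∀ x y z → f x y z ≡ g x y z
  check₃ {_} {_} {t} = toWitness t

  isCommutativeRing : IsCommutativeRing _≡_ _+_ _*_ -_ 𝟎 𝟏
  isCommutativeRing = record
    { isRing = record
      { +-isAbelianGroup = record
        { isGroup = record
          { isMonoid = record
            { isSemigroup = record
              { isMagma = record
                { isEquivalence = isEquivalence
                ; ∙-cong        = cong₂ _+_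
                }
              ; assoc = check₃ {λ x y z → (x + y) + z} {λ x y z → x + (y + z)}
              }
            ; identity = check₁ {λ x → 𝟎 + x} {λ x → x}
                       , check₁ {λ x → x + 𝟎} {λ x → x}
            }
          ; inverse = check₁ {λ x → - x + x} {λ _ → 𝟎}
                    , check₁ {λ x → x + - x} {λ _ → 𝟎}
          ; ⁻¹-cong = cong -_
          }
        ; comm = check₂ {λ x y → x + y} {λ x y → y + x}
        }
      ; *-cong     = cong₂ _*_
      ; *-assoc    = check₃ {λ x y z → (x * y) * z} {λ x y z → x * (y * z)}
      ; *-identity = check₁ {λ x → 𝟏 * x} {λ x → x}
                   , check₁ {λ x → x * 𝟏} {λ x → x}
      ; distrib    = check₃ {λ x y z → x * (y + z)} {λ x y z → x * y + x * z}
                   , check₃ {λ x y z → (y + z) * x} {λ x y z → y * x + z * x}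
      }
    ; *-comm = check₂ {λ x y → x * y} {λ x y → y * x}
    }

  inverse : ∀ x → x ≢ 𝟎 → ∃[ y ] x * y ≡ 𝟏
  inverse 𝟎  x≢0 with () ← x≢0 refl
  inverse 𝟏  _   = 𝟏 , refl
  inverse ω  _   = ω² , refl
  inverse ω² _   = ω , refl

𝔽₄ : FiniteField 4
𝔽₄ = record
  { Carrier           = GF4
  ; _+_               = _+_
  ; _*_               = _*_
  ; -_                = -_
  ; 0#                = 𝟎
  ; 1#                = 𝟏
  ; isCommutativeRing = isCommutativeRing
  ; 1≢0               = λ ()
  ; inverse           = inverse
  ; enumeration       = mk↔ₛ′ toFin fromFin toFin-fromFin fromFin-toFin
  }
  where open GF4-arithmetic

------------------------------------------------------------------------
-- Vector spaces over a finite field and their projective geometry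

module Geometry {q : ℕ} (F : FiniteField q) where

  private
    module F = FiniteField F
    module FR = CommutativeRing F.commutativeRing

  VectorSpace : Set₁
  VectorSpace = LeftModule F.ring 0ℓ 0ℓ

  infix 9 F^_
  F^_ : ℕ → VectorSpace
  F^ n = record
    { Carrierᴹ = Vec F.Carrier n
    ; _≈ᴹ_     = _≡_
    ; _+ᴹ_     = zipWith F._+_
    ; _*ₗ_     = λ c → map (c F.*_)
    ; 0ᴹ       = replicate n F.0#
    ; -ᴹ_      = map F.-_
    ; isLeftModule = record
      { isLeftSemimodule = record
        { +ᴹ-isCommutativeMonoid = record
          { isMonoid = record
            { isSemigroup = record
              { isMagma = record
                { isEquivalence = isEquivalence
                ; ∙-cong        = cong₂ (zipWith F._+_)
                }
              ; assoc = Vec.zipWith-assoc FR.+-assoc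
              }
            ; identity = Vec.zipWith-identityˡ FR.+-identityˡ
                       , Vec.zipWith-identityʳ FR.+-identityʳ
            }
          ; comm = Vec.zipWith-comm FR.+-comm
          }
        ; isPreleftSemimodule = record
          { *ₗ-cong      = λ { refl refl → refl }
          ; *ₗ-zeroˡ     = zeroˡ
          ; *ₗ-distribʳ  = distribʳ
          ; *ₗ-identityˡ = λ u → trans (Vec.map-cong FR.*-identityˡ u) (Vec.map-id u)
          ; *ₗ-assoc     = λ c d u → trans (Vec.map-cong (FR.*-assoc c d) u) (Vec.map-∘ _ _ u)
          ; *ₗ-zeroʳ     = λ c → trans (Vec.map-replicate (c F.*_) F.0# n)
                                       (cong (replicate n) (FR.zeroʳ c))
          ; *ₗ-distribˡ  = distribˡ
          }
        }
      ; -ᴹ‿cong    = cong (map F.-_)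
      ; -ᴹ‿inverse = Vec.zipWith-inverseˡ FR.-‿inverseˡ
                   , Vec.zipWith-inverseʳ FR.-‿inverseʳ
      }
    }
    where
    zeroˡ : ∀ {n} (u : Vec F.Carrier n) → map (F.0# F.*_) u ≡ replicate n F.0#
    zeroˡ []      = refl
    zeroˡ (x ∷ u) = cong₂ _∷_ (FR.zeroˡ x) (zeroˡ u)

    distribʳ : ∀ {n} (u : Vec F.Carrier n) c d →
               map ((c F.+ d) F.*_) u ≡ zipWith F._+_ (map (c F.*_) u) (map (d F.*_) u)
    distribʳ []      c d = refl
    distribʳ (x ∷ u) c d = cong₂ _∷_ (FR.distribʳ x c d) (distribʳ u c d)

    distribˡ : ∀ {n} c (u v : Vec F.Carrier n) →
               map (c F.*_) (zipWith F._+_ u v) ≡ zipWith F._+_ (map (c F.*_) u) (map (c F.*_) v)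
    distribˡ c []      []      = refl
    distribˡ c (x ∷ u) (y ∷ v) = cong₂ _∷_ (FR.distribˡ c x y) (distribˡ c u v)

  -- The points of PG n are the one-dimensional subspaces of F^(n+1).
  PG : ℕ → VectorSpace
  PG n = F^ (suc n)

  module _ (V : VectorSpace) where
    open LeftModule V

    -- A point is given by a nonzero vector spanning it; two such
    -- representatives are identified by _∼_ below.
    Point : Set
    Point = ∃[ v ] ¬ v ≈ᴹ 0ᴹ

    _∈⟨_⟩ : Carrierᴹ → Carrierᴹ → Set
    v ∈⟨ u ⟩ = ∃[ c ] v ≈ᴹ c *ₗ u

    -- Equality of points: as both representatives are nonzero, containment
    -- of one in the span of the other means that the two spans are equal.
    _∼_ : Point → Point → Set
    p ∼ r = proj₁ r ∈⟨ proj₁ p ⟩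

    record PointSet : Set₁ where
      infix 4 _∋_
      field
        _∋_      : Pred Point 0ℓ
        respects : ∀ {p r} → p ∼ r → _∋_ p → _∋_ r

    HasSize : PointSet → ℕ → Set
    HasSize S k = Σ[ pt ∈ (Fin k → Point) ]
      (∀ i → S ∋ pt i) ×
      (∀ i j → pt i ∼ pt j → i ≡ j) ×
      (∀ r → S ∋ r → ∃[ i ] pt i ∼ r)
      where open PointSet

    lincomb : ∀ {d} → Vec F.Carrier d → Vec Carrierᴹ d → Carrierᴹ
    lincomb []       []       = 0ᴹ
    lincomb (c ∷ cs) (v ∷ vs) = c *ₗ v +ᴹ lincomb cs vs

    -- A d-dimensional vector subspace, given by a basis.
    record Subspace (d : ℕ) : Set where
      field
        basis       : Vec Carrierᴹ d
        independent : ∀ cs → lincomb cs basis ≈ᴹ 0ᴹ → cs ≡ replicate d F.0#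

      Contains : Carrierᴹ → Set
      Contains v = ∃[ cs ] v ≈ᴹ lincomb cs basis

    Collinear : Point → Point → Point → Set
    Collinear p r s = Σ[ L ∈ Subspace 2 ]
      let open Subspace L in
      Contains (proj₁ p) × Contains (proj₁ r) × Contains (proj₁ s)

    IsCap : ℕ → PointSet → Set
    IsCap k S = HasSize S k ×
      (∀ p r s → S ∋ p → S ∋ r → S ∋ s →
       ¬ p ∼ r → ¬ p ∼ s → ¬ r ∼ s → ¬ Collinear p r s)
      where open PointSet

  Hyperplane : ℕ → Set
  Hyperplane n = Subspace (PG n) n

  module _ {V : VectorSpace} {d : ℕ} (W : Subspace V d) where
    open LeftModule V
    open Subspace W

    private
      lincomb-0 : ∀ {d} (vs : Vec Carrierᴹ d) → 0ᴹ ≈ᴹ lincomb V (replicate d F.0#) vs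
      lincomb-0 []       = ≈ᴹ-refl
      lincomb-0 (v ∷ vs) = ≈ᴹ-trans (≈ᴹ-sym (+ᴹ-identityˡ 0ᴹ))
        (+ᴹ-cong (≈ᴹ-sym (*ₗ-zeroˡ v)) (lincomb-0 vs))

      +ᴹ-interchange : ∀ a b c e → (a +ᴹ b) +ᴹ (c +ᴹ e) ≈ᴹ (a +ᴹ c) +ᴹ (b +ᴹ e)
      +ᴹ-interchange a b c e = ≈ᴹ-trans (+ᴹ-assoc a b (c +ᴹ e))
        (≈ᴹ-trans (+ᴹ-congˡ (≈ᴹ-trans (≈ᴹ-sym (+ᴹ-assoc b c e))
          (≈ᴹ-trans (+ᴹ-congʳ (+ᴹ-comm b c)) (+ᴹ-assoc c b e))))
        (≈ᴹ-sym (+ᴹ-assoc a c (b +ᴹ e))))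

      lincomb-+ : ∀ {d} (as bs : Vec F.Carrier d) vs →
        lincomb V as vs +ᴹ lincomb V bs vs ≈ᴹ lincomb V (zipWith F._+_ as bs) vs
      lincomb-+ []       []       []       = +ᴹ-identityˡ 0ᴹ
      lincomb-+ (a ∷ as) (b ∷ bs) (v ∷ vs) = ≈ᴹ-trans
        (+ᴹ-interchange (a *ₗ v) (lincomb V as vs) (b *ₗ v) (lincomb V bs vs))
        (+ᴹ-cong (≈ᴹ-sym (*ₗ-distribʳ v a b)) (lincomb-+ as bs vs))

      lincomb-* : ∀ {d} c (as : Vec F.Carrier d) vs →
        c *ₗ lincomb V as vs ≈ᴹ lincomb V (map (c F.*_) as) vs
      lincomb-* c []       []       = *ₗ-zeroʳ c
      lincomb-* c (a ∷ as) (v ∷ vs) = ≈ᴹ-trans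
        (*ₗ-distribˡ c (a *ₗ v) (lincomb V as vs))
        (+ᴹ-cong (≈ᴹ-sym (*ₗ-assoc c a v)) (lincomb-* c as vs))

      lincomb-neg : ∀ {d} (as : Vec F.Carrier d) vs →
        -ᴹ lincomb V as vs ≈ᴹ lincomb V (map (F.- F.1# F.*_) as) vs
      lincomb-neg as vs = ≈ᴹ-trans (-ᴹ≈-1*ₗ (lincomb V as vs)) (lincomb-* (F.- F.1#) as vs)
        where
        -ᴹ≈-1*ₗ : ∀ v → -ᴹ v ≈ᴹ (F.- F.1#) *ₗ v
        -ᴹ≈-1*ₗ v = ≈ᴹ-trans (≈ᴹ-sym (+ᴹ-identityˡ (-ᴹ v)))
          (≈ᴹ-trans (+ᴹ-congʳ (≈ᴹ-sym sum≈0))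
          (≈ᴹ-trans (+ᴹ-assoc ((F.- F.1#) *ₗ v) v (-ᴹ v))
          (≈ᴹ-trans (+ᴹ-congˡ (proj₂ -ᴹ‿inverse v)) (+ᴹ-identityʳ _))))
          where
          sum≈0 : (F.- F.1#) *ₗ v +ᴹ v ≈ᴹ 0ᴹ
          sum≈0 = ≈ᴹ-trans (+ᴹ-congˡ (≈ᴹ-sym (*ₗ-identityˡ v)))
            (≈ᴹ-trans (≈ᴹ-sym (*ₗ-distribʳ v (F.- F.1#) F.1#))
            (≈ᴹ-trans (*ₗ-congʳ (FR.-‿inverseˡ F.1#)) (*ₗ-zeroˡ v)))

    Contains-0 : Contains 0ᴹ
    Contains-0 = replicate d F.0# , lincomb-0 basis

    Contains-+ : ∀ {u v} → Contains u → Contains v → Contains (u +ᴹ v)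
    Contains-+ (as , p) (bs , r) = zipWith F._+_ as bs , ≈ᴹ-trans (+ᴹ-cong p r) (lincomb-+ as bs basis)

    Contains-* : ∀ c {v} → Contains v → Contains (c *ₗ v)
    Contains-* c (as , p) = map (c F.*_) as , ≈ᴹ-trans (*ₗ-congˡ p) (lincomb-* c as basis)

    Contains-neg : ∀ {v} → Contains v → Contains (-ᴹ v)
    Contains-neg (as , p) = map (F.- F.1# F.*_) as , ≈ᴹ-trans (-ᴹ‿cong p) (lincomb-neg as basis)

    -- The subspace as a vector space in its own right.
    asVectorSpace : VectorSpace
    asVectorSpace = record
      { Carrierᴹ = ∃ Contains
      ; _≈ᴹ_     = λ u v → proj₁ u ≈ᴹ proj₁ v
      ; _+ᴹ_     = λ (u , p) (v , r) → u +ᴹ v , Contains-+ p r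
      ; _*ₗ_     = λ c (v , p) → c *ₗ v , Contains-* c p
      ; 0ᴹ       = 0ᴹ , Contains-0
      ; -ᴹ_      = λ (v , p) → -ᴹ v , Contains-neg p
      ; isLeftModule = record
        { isLeftSemimodule = record
          { +ᴹ-isCommutativeMonoid = record
            { isMonoid = record
              { isSemigroup = record
                { isMagma = record
                  { isEquivalence = record
                    { refl = ≈ᴹ-refl ; sym = ≈ᴹ-sym ; trans = ≈ᴹ-trans }
                  ; ∙-cong        = +ᴹ-cong
                  }
                ; assoc = λ u v w → +ᴹ-assoc (proj₁ u) (proj₁ v) (proj₁ w)
                }
              ; identity = (λ v → +ᴹ-identityˡ (proj₁ v)) , (λ v → +ᴹ-identityʳ (proj₁ v))
              }
            ; comm = λ u v → +ᴹ-comm (proj₁ u) (proj₁ v)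
            }
          ; isPreleftSemimodule = record
            { *ₗ-cong      = *ₗ-cong
            ; *ₗ-zeroˡ     = λ v → *ₗ-zeroˡ (proj₁ v)
            ; *ₗ-distribʳ  = λ v → *ₗ-distribʳ (proj₁ v)
            ; *ₗ-identityˡ = λ v → *ₗ-identityˡ (proj₁ v)
            ; *ₗ-assoc     = λ c d v → *ₗ-assoc c d (proj₁ v)
            ; *ₗ-zeroʳ     = *ₗ-zeroʳ
            ; *ₗ-distribˡ  = λ c u v → *ₗ-distribˡ c (proj₁ u) (proj₁ v)
            }
          }
        ; -ᴹ‿cong    = -ᴹ‿cong
        ; -ᴹ‿inverse = (λ v → proj₁ -ᴹ‿inverse (proj₁ v)) , (λ v → proj₂ -ᴹ‿inverse (proj₁ v))
        }
      }

    intersection : PointSet V → PointSet V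
    intersection S = record
      { _∋_      = λ p → Contains (proj₁ p) × S ∋ p
      ; respects = λ (c , e) (w , m) →
          (proj₁ (Contains-* c w) , ≈ᴹ-trans e (proj₂ (Contains-* c w))) ,
          respects S (c , e) m
      }
      where open PointSet

    -- The same intersection, regarded as a set of points of the subspace.
    restriction : PointSet V → PointSet asVectorSpace
    restriction S = record
      { _∋_      = λ ((v , _) , v≉0) → S ∋ (v , v≉0)
      ; respects = respects S
      }
      where open PointSet

  IsIntersectionSize : ∀ {n} → PointSet (PG n) → ℕ → Set
  IsIntersectionSize {n} S m =
    Σ[ Π ∈ Hyperplane n ] HasSize (PG n) (intersection Π S) m

  -- The set of intersection sizes is { h₁ , h₂ } with h₁ ≢ h₂.
  HasTwoIntersectionSizes : ∀ {n} → PointSet (PG n) → Set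
  HasTwoIntersectionSizes S = ∃[ h₁ ] ∃[ h₂ ] h₁ ≢ h₂ ×
    (∀ m → IsIntersectionSize S m ⇔ (m ≡ h₁ ⊎ m ≡ h₂))

  record SemilinearIsomorphism (U V : VectorSpace) : Set where
    private
      module U = LeftModule U
      module V = LeftModule V
    field
      σ                    : F.Carrier → F.Carrier
      σ-isRingIsomorphism  : IsRingIsomorphism F.rawRing F.rawRing σ
      f                    : U.Carrierᴹ → V.Carrierᴹ
      f-isGroupIsomorphism : IsGroupIsomorphism U.+ᴹ-rawGroup V.+ᴹ-rawGroup f
      f-semilinear         : ∀ c u → f (c U.*ₗ u) V.≈ᴹ σ c V.*ₗ f u

    open IsGroupIsomorphism f-isGroupIsomorphism

    onPoints : Point U → Point V
    onPoints (u , u≉0) =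
      f u , λ fu≈0 → u≉0 (injective (V.≈ᴹ-trans fu≈0 (V.≈ᴹ-sym ε-homo)))

  -- As the collineation is bijective on points, the condition says that the
  -- image of S is exactly T.
  ProjectivelyEquivalent : ∀ {U V} → PointSet U → PointSet V → Set
  ProjectivelyEquivalent {U} {V} S T = Σ[ φ ∈ SemilinearIsomorphism U V ]
    (∀ p → S ∋ p ⇔ T ∋ SemilinearIsomorphism.onPoints φ p)
    where open PointSet

  extensionSpace : ∀ {m} → Extension F m → VectorSpace
  extensionSpace E = record
    { Carrierᴹ = E.Carrier
    ; _≈ᴹ_     = _≡_
    ; _+ᴹ_     = E._+_
    ; _*ₗ_     = λ c x → ι c E.* x
    ; 0ᴹ       = E.0#
    ; -ᴹ_      = E.-_
    ; isLeftModule = record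
      { isLeftSemimodule = record
        { +ᴹ-isCommutativeMonoid = ER.+-isCommutativeMonoid
        ; isPreleftSemimodule = record
          { *ₗ-cong      = λ { refl refl → refl }
          ; *ₗ-zeroˡ     = λ x → trans (cong (E._* x) 0#-homo) (ER.zeroˡ x)
          ; *ₗ-distribʳ  = λ x c d → trans (cong (E._* x) (+-homo c d)) (ER.distribʳ x (ι c) (ι d))
          ; *ₗ-identityˡ = λ x → trans (cong (E._* x) 1#-homo) (ER.*-identityˡ x)
          ; *ₗ-assoc     = λ c d x → trans (cong (E._* x) (*-homo c d)) (ER.*-assoc (ι c) (ι d) x)
          ; *ₗ-zeroʳ     = λ c → ER.zeroʳ (ι c)
          ; *ₗ-distribˡ  = λ c → ER.distribˡ (ι c)
          }
        }
      ; -ᴹ‿cong    = cong E.-_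
      ; -ᴹ‿inverse = ER.-‿inverse
      }
    }
    where
    module E = Extension E
    module ER = CommutativeRing E.commutativeRing
    open E using (ι)
    open IsRingHomomorphism E.isRingHomomorphism

open Geometry 𝔽₄ public

------------------------------------------------------------------------
-- The Hill cap

module _ (E : Extension 𝔽₄ 6) (z : Extension.Carrier E) where
  open Extension E

  -- ⟨z³⁵⟩ ∪ z⁷⟨z³⁵⟩
  HillOrbits : Carrier → Set
  HillOrbits x = ∃[ i ] (x ≡ (z ^ᶠ 35) ^ᶠ i ⊎ x ≡ z ^ᶠ 7 * (z ^ᶠ 35) ^ᶠ i)

  -- This is the Hill cap when z is a primitive element.
  HillCap : PointSet (extensionSpace E)
  HillCap = record
    { _∋_      = λ p → ∃[ x ] HillOrbits x × _∈⟨_⟩ (extensionSpace E) (proj₁ p) x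
    ; respects = λ (c , r≡cp) (x , x∈O , d , p≡dx) → x , x∈O , c *₄ d ,
        trans r≡cp (trans (cong (ι c *_) p≡dx) (sym (*ₗ-assoc c d x)))
    }
    where
    open LeftModule (extensionSpace E) using (*ₗ-assoc)
    open FiniteField 𝔽₄ using () renaming (_*_ to _*₄_)

module Submission where

-- Let C be a 430-cap with two intersection sizes whose section by the
-- hyperplane Π is the Hill cap K, of 78 points.  In coordinates with Π at
-- infinity, C consists of K and of a set A of 430 - 78 = 352 vectors of
-- 𝔽₄⁶.  For a ≠ 0 the hyperplane  a ∙ x = b  contains s(a) + N(a, b) points
-- of C, where s(a) is the number of points of K orthogonal to a and N(a, b)
-- the number of x in A with  a ∙ x = b.  As Π has 78 points, each of these
-- sizes is 78 or one other number h.
--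
-- The sizes of the four hyperplanes  a ∙ x = b  add up to 4 s(a) + 352.
-- Comparing a vector a with s(a) = 14 and one with s(a) = 22 gives h = 110
-- (h≡110).  If s(a) = 22, then all N(a, b) are 88.  If s(a) = 14, then
-- N(a, b) = 64 for exactly one b, which is called g(a), and N(a, b) = 96 for
-- the others.  In the first case g(a) is defined to be 0.
--
-- The function g adds up to zero over every flat of 64 vectors that avoids 0
-- (flat-sum).  For fixed b, count the pairs of a vector P of the flat and an
-- x in A with  P ∙ x = b  in two ways.  As b varies, the number n(b) of those
-- P for which  P ∙ x = b  has only 78 points changes by an even number, so
-- the sum of g, which is the sum of n(b) b, is a multiple of
-- 0 + 1 + ω + ω² = 0.
--
-- These are linear equations over 𝔽₄ for the values of g.  They imply that
-- g(a₀ + c u₀) = g(a₀) + c g(u₀)  for c = ω, ω² and certain a₀, u₀ such that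
-- a₀, u₀, a₀ + ω u₀ and a₀ + ω² u₀ are orthogonal to 14 points of K and
-- a₀ + u₀ to 22; the combinations of equations are given explicitly
-- (certificate-ω, certificate-ω²).  Now put s = g(a₀) and t = g(u₀).  Every
-- x satisfies one of the five equations  a₀ ∙ x = s,  u₀ ∙ x = t  and
-- (a₀ + c u₀) ∙ x = s + c t  for c = 1, ω, ω², because
-- (a₀ ∙ x - s, u₀ ∙ x - t) is zero or spans one of the five
-- one-dimensional subspaces of 𝔽₄².  Hence
-- 352 ≤ 64 + 64 + 88 + 64 + 64 = 344, a contradiction.
--
-- The numbers s(a) refer to an explicit form of the Hill cap, so the given
-- field of order 4096 and its primitive element z must be related to a fixed
-- model 𝔽₄[X]/(p).  Here p is one of the two irreducible factors of
-- 1 + X + ... + X¹², so z³¹⁵ or its square is a root of p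
-- (thirteenth-roots).  A primitive element γ of the model corresponds to a
-- power zᵏ with k prime to 4095, and after a power of the Frobenius map
-- k ≡ 1 mod 5.  The Hill cap is spanned by the z⁷ⁱ with i ≡ 0, 1 mod 5, and
-- therefore corresponds to the span of the γ⁷ⁱ with i ≡ 0, 1 mod 5.

open import Defs
open import Data.Product.Base using (Σ-syntax)
open import Relation.Nullary using (¬_)

open import Algebra.Bundles using (CommutativeMonoid; CommutativeRing)
open import Algebra.Module.Bundles using (LeftModule)
open import Algebra.Morphism.Structures using (IsRingHomomorphism; IsRingIsomorphism; IsGroupIsomorphism)
import Algebra.Properties.CommutativeSemigroup
import Algebra.Properties.Semiring.Exp
open import Data.Bool.Base using (Bool; true; false; _∧_; _∨_; not; T)
open import Data.Bool.ListAction using (all)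
open import Data.Empty using (⊥; ⊥-elim)
open import Data.Fin.Base as Fin using (Fin; zero; suc; toℕ; fromℕ<; combine; remQuot)
open import Data.Fin.Patterns using (0F; 1F; 2F; 3F; 4F; 5F)
import Data.Fin.Properties as Fin
open import Data.List.Base as List using (List; []; _∷_; _++_; length; upTo; tabulate)
open import Data.List.Membership.Propositional using (_∈_)
open import Data.List.Membership.Propositional.Properties using (∈-++⁺ˡ; ∈-++⁺ʳ; ∈-++⁻; ∈-map⁺; ∈-map⁻; ∈-upTo⁺; ∈-tabulate⁺; ∈-tabulate⁻)
import Data.List.Properties as List
open import Data.List.Relation.Unary.All as All using (All; []; _∷_)
import Data.List.Relation.Unary.All.Properties as All
open import Data.List.Relation.Unary.AllPairs as AllPairs using (AllPairs; []; _∷_; allPairs?)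
import Data.List.Relation.Unary.AllPairs.Properties as AllPairs
open import Data.List.Relation.Unary.Any using (here; there)
open import Data.Nat.Base as ℕ using (ℕ; zero; suc; _≤_; _<_; _≡ᵇ_; z≤n; s≤s; NonZero)
open import Data.Nat.Coprimality using (Coprime; coprime-Bézout; coprime-divisor)
import Data.Nat.DivMod as ℕ
open import Data.Nat.Divisibility using (_∣_; divides; ∣-trans; m%n≡0⇒n∣m)
open import Data.Nat.GCD using (module Bézout)
open import Data.Nat.Primality using (Prime; prime?; prime⇒irreducible)
import Data.Nat.Properties as ℕ
open import Data.Nat.Tactic.RingSolver using (solve-∀)
open import Data.Product.Base using (_×_; _,_; proj₁; proj₂; ∃-syntax)
open import Data.Sum.Base using (_⊎_; inj₁; inj₂; [_,_]′)
open import Data.Unit using (tt)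
open import Data.Vec.Base as Vec using (Vec; []; _∷_; head; tail; replicate; zipWith; toList)
import Data.Vec.Properties as Vec
open import Function.Base using (_∘_; case_of_)
open import Function.Bundles using (Equivalence; Inverse)
open import Relation.Binary.Definitions using (DecidableEquality)
open import Relation.Binary.PropositionalEquality
open import Relation.Nullary using (yes; no; Dec; does; ¬?; contradiction)
open import Relation.Nullary.Decidable using (toWitness; True; map′; decidable-stable; _×-dec_; _⊎-dec_; _→-dec_)

-- Finite fields and the order of a primitive element

module FieldProperties {q : ℕ} (K : FiniteField q) where
  open FiniteField K public
  module R = CommutativeRing commutativeRing
  module Exp = Algebra.Properties.Semiring.Exp R.semiring

  to : Carrier → Fin q
  to = Inverse.to enumeration

  from : Fin q → Carrier
  from = Inverse.from enumeration

  from-to : ∀ x → from (to x) ≡ x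
  from-to = Inverse.strictlyInverseʳ enumeration

  to-from : ∀ i → to (from i) ≡ i
  to-from = Inverse.strictlyInverseˡ enumeration

  to-injective : ∀ {x y} → to x ≡ to y → x ≡ y
  to-injective {x} {y} e = trans (sym (from-to x)) (trans (cong from e) (from-to y))

  from-injective : ∀ {i j} → from i ≡ from j → i ≡ j
  from-injective {i} {j} e = trans (sym (to-from i)) (trans (cong to e) (to-from j))

  infix 4 _≟ᴷ_
  _≟ᴷ_ : DecidableEquality Carrier
  x ≟ᴷ y = map′ to-injective (cong to) (to x Fin.≟ to y)

  *-cancelˡ : ∀ x {y z} → x ≢ 0# → x * y ≡ x * z → y ≡ z
  *-cancelˡ x {y} {z} x≢0 e with x⁻¹ , xx⁻¹≡1 ← inverse x x≢0 = trans (sym (undo y)) (trans (cong (x⁻¹ *_) e) (undo z))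
    where
    undo : ∀ y → x⁻¹ * (x * y) ≡ y
    undo y = trans (sym (R.*-assoc x⁻¹ x y)) (trans (cong (_* y) (trans (R.*-comm x⁻¹ x) xx⁻¹≡1)) (R.*-identityˡ y))

  zero-product : ∀ x y → x * y ≡ 0# → x ≡ 0# ⊎ y ≡ 0#
  zero-product x y e with x ≟ᴷ 0#
  ... | yes x≡0 = inj₁ x≡0
  ... | no  x≢0 = inj₂ (*-cancelˡ x x≢0 (trans e (sym (R.zeroʳ x))))

  1^ : ∀ n → 1# ^ᶠ n ≡ 1#
  1^ zero    = refl
  1^ (suc n) = trans (R.*-identityˡ _) (1^ n)

  ^≢0 : ∀ x n → x ≢ 0# → x ^ᶠ n ≢ 0#
  ^≢0 x zero    x≢0 e = 1≢0 e
  ^≢0 x (suc n) x≢0 e = [ x≢0 , ^≢0 x n x≢0 ]′ (zero-product x (x ^ᶠ n) e)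

  ^-* : ∀ x m n → x ^ᶠ m ≡ 1# → x ^ᶠ (m ℕ.* n) ≡ 1#
  ^-* x m n e = trans (sym (Exp.^-assocʳ x m n)) (trans (cong (_^ᶠ n) e) (1^ n))

  -- Raising to a power prime to the exponent of z is invertible on the powers
  -- of z.
  coprime-power-generates : ∀ z k N → z ^ᶠ suc N ≡ 1# → Coprime k (suc N) →
    ∃[ l ] z ≡ (z ^ᶠ k) ^ᶠ l
  coprime-power-generates z k N z^N≡1 k⊥N = by-Bézout (coprime-Bézout k⊥N)
    where
    open ≡-Reasoning
    z^multiple : ∀ m n → m ≡ suc N ℕ.* n → z ^ᶠ m ≡ 1#
    z^multiple m n refl = ^-* z (suc N) n z^N≡1
    by-Bézout : Bézout.Identity 1 k (suc N) → ∃[ l ] z ≡ (z ^ᶠ k) ^ᶠ l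
    by-Bézout (Bézout.+- x y eq) = x , (begin
      z                                    ≡⟨ R.*-identityʳ z ⟨
      z * 1#                               ≡⟨ cong (z *_) (z^multiple (y ℕ.* suc N) y (ℕ.*-comm y (suc N))) ⟨
      z ^ᶠ (1 ℕ.+ y ℕ.* suc N)             ≡⟨ cong (z ^ᶠ_) (trans eq (ℕ.*-comm x k)) ⟩
      z ^ᶠ (k ℕ.* x)                       ≡⟨ Exp.^-assocʳ z k x ⟨
      (z ^ᶠ k) ^ᶠ x                        ∎)
    by-Bézout (Bézout.-+ x y eq) = x ℕ.* N , (begin
      z                                          ≡⟨ R.*-identityʳ z ⟨
      z * 1#
        ≡⟨ cong (z *_) (trans (sym (1^ N)) (cong (_^ᶠ N) (sym (z^multiple (1 ℕ.+ x ℕ.* k) y (trans eq (ℕ.*-comm y (suc N))))))) ⟩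
      z * (z ^ᶠ (1 ℕ.+ x ℕ.* k)) ^ᶠ N            ≡⟨ cong (z *_) (Exp.^-assocʳ z (1 ℕ.+ x ℕ.* k) N) ⟩
      z ^ᶠ (suc N ℕ.+ x ℕ.* k ℕ.* N)             ≡⟨ Exp.^-homo-* z (suc N) (x ℕ.* k ℕ.* N) ⟩
      z ^ᶠ suc N * z ^ᶠ (x ℕ.* k ℕ.* N)          ≡⟨ cong (_* z ^ᶠ (x ℕ.* k ℕ.* N)) z^N≡1 ⟩
      1# * z ^ᶠ (x ℕ.* k ℕ.* N)                  ≡⟨ R.*-identityˡ _ ⟩
      z ^ᶠ (x ℕ.* k ℕ.* N)
        ≡⟨ cong (z ^ᶠ_) (trans (cong (ℕ._* N) (ℕ.*-comm x k)) (ℕ.*-assoc k x N)) ⟩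
      z ^ᶠ (k ℕ.* (x ℕ.* N))                     ≡⟨ Exp.^-assocʳ z k (x ℕ.* N) ⟨
      (z ^ᶠ k) ^ᶠ (x ℕ.* N)                      ∎)

  -- A primitive element has order q - 1.
  module Primitive {z : Carrier} (isPrimitive : IsPrimitiveElement K z) where

    private
      z≢0 = proj₁ isPrimitive

      -- Zero and the first q powers of z: q + 1 elements, two of which agree.
      sequence : Fin (suc q) → Fin q
      sequence zero    = to 0#
      sequence (suc i) = to (z ^ᶠ toℕ i)

      periodic : ∀ i {j} → i < j → z ^ᶠ i ≡ z ^ᶠ j → z ^ᶠ (j ℕ.∸ i) ≡ 1#
      periodic i {j} i<j e = sym (*-cancelˡ (z ^ᶠ i) (^≢0 z i z≢0) (begin
        z ^ᶠ i * 1#              ≡⟨ R.*-identityʳ _ ⟩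
        z ^ᶠ i                   ≡⟨ e ⟩
        z ^ᶠ j                   ≡⟨ cong (z ^ᶠ_) (ℕ.m+[n∸m]≡n (ℕ.<⇒≤ i<j)) ⟨
        z ^ᶠ (i ℕ.+ (j ℕ.∸ i))   ≡⟨ Exp.^-homo-* z i (j ℕ.∸ i) ⟩
        z ^ᶠ i * z ^ᶠ (j ℕ.∸ i)  ∎))
        where open ≡-Reasoning

    period : ∃[ d ] suc (suc d) ≤ q × z ^ᶠ suc d ≡ 1#
    period with Fin.pigeonhole (ℕ.n<1+n q) sequence
    ... | zero  , zero  , () , _
    ... | zero  , suc j , _ , e = ⊥-elim (^≢0 z (toℕ j) z≢0 (sym (to-injective e)))
    ... | suc i , suc j , s≤s i<j , e with toℕ j ℕ.∸ toℕ i in eq | periodic (toℕ i) i<j (to-injective e) | ℕ.m<n⇒0<n∸m i<j | ℕ.m∸n≤m (toℕ j) (toℕ i)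
    ... | suc d | e′ | _ | le = d , ℕ.≤-trans (s≤s le) (Fin.toℕ<n j) , e′
    period | suc i , suc j , s≤s i<j , e | zero | e′ | lt | le = contradiction lt (λ ())

    -- If zᵈ = 1, then there are at most d powers of z, hence at most d + 1
    -- field elements.
    period-bound : ∀ d → .{{_ : NonZero d}} → z ^ᶠ d ≡ 1# → q ≤ suc d
    period-bound d z^d≡1 = Fin.injective⇒≤ {f = code ∘ from} (from-injective ∘ code-injective _ _)
      where
      code : Carrier → Fin (suc d)
      code x with x ≟ᴷ 0#
      ... | yes _  = zero
      ... | no x≢0 = suc (fromℕ< (ℕ.m%n<n (proj₁ (proj₂ isPrimitive x x≢0)) d))

      reduce : ∀ n → z ^ᶠ n ≡ z ^ᶠ (n ℕ.% d)
      reduce n = begin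
        z ^ᶠ n
          ≡⟨ cong (z ^ᶠ_) (trans (ℕ.m≡m%n+[m/n]*n n d) (cong (n ℕ.% d ℕ.+_) (ℕ.*-comm (n ℕ./ d) d))) ⟩
        z ^ᶠ (n ℕ.% d ℕ.+ d ℕ.* (n ℕ./ d))           ≡⟨ Exp.^-homo-* z (n ℕ.% d) _ ⟩
        z ^ᶠ (n ℕ.% d) * z ^ᶠ (d ℕ.* (n ℕ./ d))      ≡⟨ cong (z ^ᶠ (n ℕ.% d) *_) (^-* z d (n ℕ./ d) z^d≡1) ⟩
        z ^ᶠ (n ℕ.% d) * 1#                          ≡⟨ R.*-identityʳ _ ⟩
        z ^ᶠ (n ℕ.% d)                               ∎
        where open ≡-Reasoning

      code-injective : ∀ x y → code x ≡ code y → x ≡ y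
      code-injective x y e with x ≟ᴷ 0# | y ≟ᴷ 0#
      ... | yes x≡0 | yes y≡0 = trans x≡0 (sym y≡0)
      code-injective x y () | yes _ | no _
      code-injective x y () | no _ | yes _
      ... | no x≢0 | no y≢0 = begin
        x                 ≡⟨ proj₂ (proj₂ isPrimitive x x≢0) ⟩
        z ^ᶠ m            ≡⟨ reduce m ⟩
        z ^ᶠ (m ℕ.% d)    ≡⟨ cong (z ^ᶠ_) residues ⟩
        z ^ᶠ (n ℕ.% d)    ≡⟨ reduce n ⟨
        z ^ᶠ n            ≡⟨ proj₂ (proj₂ isPrimitive y y≢0) ⟨
        y                 ∎
        where
        open ≡-Reasoning
        m = proj₁ (proj₂ isPrimitive x x≢0)
        n = proj₁ (proj₂ isPrimitive y y≢0)
        residues : m ℕ.% d ≡ n ℕ.% d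
        residues = trans (sym (Fin.toℕ-fromℕ< (ℕ.m%n<n m d)))
          (trans (cong toℕ (Fin.suc-injective e)) (Fin.toℕ-fromℕ< (ℕ.m%n<n n d)))

    order : ∀ n → suc n ≡ q → z ^ᶠ n ≡ 1#
    order n refl with d , le , e ← period =
      subst (λ t → z ^ᶠ t ≡ 1#) (ℕ.suc-injective (ℕ.≤-antisym le (period-bound (suc d) e))) e

    order-minimal : ∀ n .{{_ : NonZero n}} → suc n < q → z ^ᶠ n ≢ 1#
    order-minimal n lt e = ℕ.<⇒≱ lt (period-bound n e)

coprime-* : ∀ {k m n} → Coprime k m → Coprime k n → Coprime k (m ℕ.* n)
coprime-* c c′ (d∣k , d∣mn) =
  c′ (d∣k , coprime-divisor (λ (e∣d , e∣m) → c (∣-trans e∣d d∣k , e∣m)) d∣mn)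

prime∤⇒coprime : ∀ {p k} → Prime p → ¬ p ∣ k → Coprime k p
prime∤⇒coprime {p} pp p∤k (d∣k , d∣p) with prime⇒irreducible pp d∣p
... | inj₁ d≡1  = d≡1
... | inj₂ refl = ⊥-elim (p∤k d∣k)

-- Vectors over the field with four elements

open GF4-arithmetic using (_+_; _*_; check₁; check₂; check₃; all?; _≟_)

module F = CommutativeRing (FiniteField.commutativeRing 𝔽₄)

-- 𝔽₄ⁿ, used both for vectors and for linear functionals; the pairing is _∙_.
V : ℕ → Set
V = Vec GF4

infixl 6 _⊕_
infixr 7 _⊛_
_⊕_ : ∀ {n} → V n → V n → V n
_⊕_ = zipWith _+_

_⊛_ : ∀ {n} → GF4 → V n → V n
c ⊛ v = Vec.map (c *_) v

𝟘 : ∀ {n} → V n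
𝟘 {n} = replicate n 𝟎

infix 7 _∙_
_∙_ : ∀ {n} → V n → V n → GF4
[]      ∙ []      = 𝟎
(x ∷ u) ∙ (y ∷ v) = x * y + u ∙ v

-- The inverse of a nonzero scalar, and 𝟎 for 𝟎.
inv : GF4 → GF4
inv 𝟎  = 𝟎
inv 𝟏  = 𝟏
inv ω  = ω²
inv ω² = ω

-- The Kronecker delta.
δ : GF4 → GF4 → ℕ
δ 𝟎  𝟎  = 1
δ 𝟏  𝟏  = 1
δ ω  ω  = 1
δ ω² ω² = 1
δ _  _  = 0

+-self : ∀ x → x + x ≡ 𝟎
+-self = check₁

+-interchange : ∀ a b c d → (a + b) + (c + d) ≡ (a + c) + (b + d)
+-interchange = Interchange.interchange
  where
  module Interchange =
    Algebra.Properties.CommutativeSemigroup (CommutativeMonoid.commutativeSemigroup F.+-commutativeMonoid)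

+≡0⇒≡ : ∀ x y → x + y ≡ 𝟎 → x ≡ y
+≡0⇒≡ x y e = begin
  x           ≡⟨ F.+-identityʳ x ⟨
  x + 𝟎       ≡⟨ cong (x +_) (+-self y) ⟨
  x + (y + y) ≡⟨ F.+-assoc x y y ⟨
  (x + y) + y ≡⟨ cong (_+ y) e ⟩
  y           ∎
  where open ≡-Reasoning

inv-* : ∀ c x → c ≢ 𝟎 → c * (inv c * x) ≡ x
inv-* 𝟎  x n = ⊥-elim (n refl)
inv-* 𝟏  x n = refl
inv-* ω  x n = check₁ {λ x → ω * (ω² * x)} {λ x → x} x
inv-* ω² x n = check₁ {λ x → ω² * (ω * x)} {λ x → x} x

∙-distribʳ : ∀ {n} (u v x : V n) → (u ⊕ v) ∙ x ≡ u ∙ x + v ∙ x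
∙-distribʳ []      []      []      = refl
∙-distribʳ (a ∷ u) (b ∷ v) (c ∷ x) = begin
  (a + b) * c + (u ⊕ v) ∙ x         ≡⟨ cong₂ _+_ (F.distribʳ c a b) (∙-distribʳ u v x) ⟩
  (a * c + b * c) + (u ∙ x + v ∙ x) ≡⟨ +-interchange (a * c) (b * c) (u ∙ x) (v ∙ x) ⟩
  (a * c + u ∙ x) + (b * c + v ∙ x) ∎
  where open ≡-Reasoning

∙-⊛ˡ : ∀ {n} c (u x : V n) → (c ⊛ u) ∙ x ≡ c * (u ∙ x)
∙-⊛ˡ c []      []      = sym (F.zeroʳ c)
∙-⊛ˡ c (a ∷ u) (y ∷ x) =
  trans (cong₂ _+_ (F.*-assoc c a y) (∙-⊛ˡ c u x)) (sym (F.distribˡ c (a * y) (u ∙ x)))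

-- Sums over lists, and parity

sumL : ∀ {A : Set} → (A → ℕ) → List A → ℕ
sumL f []       = 0
sumL f (x ∷ xs) = f x ℕ.+ sumL f xs

sumᶠ : ∀ {A : Set} → (A → GF4) → List A → GF4
sumᶠ f []       = 𝟎
sumᶠ f (x ∷ xs) = f x + sumᶠ f xs

module _ {A : Set} where

  private
    module ℕ-Interchange = Algebra.Properties.CommutativeSemigroup ℕ.+-commutativeSemigroup

  sumL-cong : {f g : A → ℕ} → (∀ x → f x ≡ g x) → ∀ xs → sumL f xs ≡ sumL g xs
  sumL-cong eq []       = refl
  sumL-cong eq (x ∷ xs) = cong₂ ℕ._+_ (eq x) (sumL-cong eq xs)

  sumL-congAll : {f g : A → ℕ} {P : A → Set} → (∀ x → P x → f x ≡ g x) →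
    ∀ {xs} → All P xs → sumL f xs ≡ sumL g xs
  sumL-congAll eq []         = refl
  sumL-congAll eq (px ∷ pxs) = cong₂ ℕ._+_ (eq _ px) (sumL-congAll eq pxs)

  sumL-+ : (f g : A → ℕ) → ∀ xs → sumL (λ x → f x ℕ.+ g x) xs ≡ sumL f xs ℕ.+ sumL g xs
  sumL-+ f g []       = refl
  sumL-+ f g (x ∷ xs) = trans (cong (f x ℕ.+ g x ℕ.+_) (sumL-+ f g xs))
    (ℕ-Interchange.interchange (f x) (g x) (sumL f xs) (sumL g xs))

  sumL-* : ∀ c (f : A → ℕ) → ∀ xs → sumL (λ x → c ℕ.* f x) xs ≡ c ℕ.* sumL f xs
  sumL-* c f []       = sym (ℕ.*-zeroʳ c)
  sumL-* c f (x ∷ xs) = trans (cong (c ℕ.* f x ℕ.+_) (sumL-* c f xs))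
    (sym (ℕ.*-distribˡ-+ c (f x) (sumL f xs)))

  sumL-1 : ∀ (xs : List A) → sumL (λ _ → 1) xs ≡ length xs
  sumL-1 []       = refl
  sumL-1 (x ∷ xs) = cong suc (sumL-1 xs)

  sumL-mono : {f g : A → ℕ} → (∀ x → f x ≤ g x) → ∀ xs → sumL f xs ≤ sumL g xs
  sumL-mono le []       = z≤n
  sumL-mono le (x ∷ xs) = ℕ.+-mono-≤ (le x) (sumL-mono le xs)

  sumL-map : ∀ {B : Set} (f : A → ℕ) (h : B → A) → ∀ ys →
    sumL f (List.map h ys) ≡ sumL (f ∘ h) ys
  sumL-map f h []       = refl
  sumL-map f h (y ∷ ys) = cong (f (h y) ℕ.+_) (sumL-map f h ys)

sumL-swap : ∀ {A B : Set} (f : A → B → ℕ) xs ys →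
  sumL (λ x → sumL (f x) ys) xs ≡ sumL (λ y → sumL (λ x → f x y) xs) ys
sumL-swap f []       []       = refl
sumL-swap f []       (y ∷ ys) = sumL-swap f [] ys
sumL-swap f (x ∷ xs) ys       = trans (cong (sumL (f x) ys ℕ.+_) (sumL-swap f xs ys))
  (sym (sumL-+ (f x) (λ y → sumL (λ x → f x y) xs) ys))

-- The ring homomorphism from ℕ, with values in the prime field of 𝔽₄.
parity : ℕ → GF4
parity zero    = 𝟎
parity (suc n) = 𝟏 + parity n

parity-+ : ∀ m n → parity (m ℕ.+ n) ≡ parity m + parity n
parity-+ zero    n = refl
parity-+ (suc m) n = trans (cong (𝟏 +_) (parity-+ m n)) (sym (F.+-assoc 𝟏 (parity m) (parity n)))

parity-2* : ∀ n → parity (2 ℕ.* n) ≡ 𝟎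
parity-2* n = trans (parity-+ n (n ℕ.+ 0)) (trans (cong (λ t → parity n + parity t) (ℕ.+-identityʳ n)) (+-self (parity n)))

-- A model of the field of order 4096, and the Hill cap in it

-- Multiplication by X in 𝔽₄[X]/(p), for
-- p = 1 + ω X + ω² X³ + ω X⁵ + X⁶.  The vector (a₀, ..., a₅) stands for
-- a₀ + a₁ X + ... + a₅ X⁵.
shift : V 6 → V 6
shift (a ∷ b ∷ c ∷ d ∷ e ∷ f ∷ []) =
  (𝟎 ∷ a ∷ b ∷ c ∷ d ∷ e ∷ []) ⊕ f ⊛ (𝟏 ∷ ω ∷ 𝟎 ∷ ω² ∷ 𝟎 ∷ ω ∷ [])

-- Multiplication of residue classes, by Horner's rule in the left factor.
infixl 7 _⊗_
_⊗_ : ∀ {n} → V n → V 6 → V 6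
[]      ⊗ v = 𝟘
(a ∷ u) ⊗ v = a ⊛ v ⊕ shift (u ⊗ v)

one : V 6
one = 𝟏 ∷ 𝟘

pow : V 6 → ℕ → V 6
pow v zero    = one
pow v (suc n) = v ⊗ pow v n

-- These vectors are opaque, so that field elements are computed only where
-- a numerical check calls for it.
opaque
  -- A generator of the multiplicative group.
  γ : V 6
  γ = 𝟎 ∷ 𝟎 ∷ 𝟎 ∷ 𝟏 ∷ ω ∷ ω² ∷ []

  -- γ³⁵, of order 117.
  ρ₀ : V 6
  ρ₀ = ω ∷ ω² ∷ ω ∷ ω ∷ 𝟎 ∷ 𝟎 ∷ []

  -- γ⁷.
  σ₀ : V 6
  σ₀ = ω² ∷ 𝟏 ∷ 𝟎 ∷ 𝟎 ∷ ω ∷ 𝟎 ∷ []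

coset : ℕ → V 6
coset i = σ₀ ⊗ pow ρ₀ i

-- The values f 0, ..., f (n - 1), followed by g 0, ..., g (n - 1).
twoSequences : ∀ {A : Set} → (ℕ → A) → (ℕ → A) → ℕ → List A
twoSequences f g n = List.map f (upTo n) ++ List.map g (upTo n)

-- Vectors spanning the 78 points of the Hill cap: γ³⁵ⁱ and γ⁷⁺³⁵ⁱ for
-- i < 39.  As γ³⁵ has order 117 = 3 · 39, further powers only repeat points.
opaque
  hill : List (V 6)
  hill = twoSequences (pow ρ₀) coset 39

-- The number s(a) of vectors of ks orthogonal to a.
zeros : List (V 6) → V 6 → ℕ
zeros ks a = sumL (λ k → δ (a ∙ k) 𝟎) ks

-- Formal linear combinations of vectors

-- A formal linear combination of vectors of 𝔽₄ⁿ, as a tree that branches on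
-- the successive coordinates and has the coefficients at its leaves.
data Trie : ℕ → Set where
  ∅    : ∀ {n} → Trie n
  leaf : GF4 → Trie 0
  node : ∀ {n} → (t₀ t₁ t₂ t₃ : Trie n) → Trie (suc n)

insert : ∀ {n} → GF4 → V n → Trie n → Trie n
insert c []       ∅                  = leaf c
insert c []       (leaf d)           = leaf (c + d)
insert c (𝟎  ∷ v) ∅                  = node (insert c v ∅) ∅ ∅ ∅
insert c (𝟏  ∷ v) ∅                  = node ∅ (insert c v ∅) ∅ ∅
insert c (ω  ∷ v) ∅                  = node ∅ ∅ (insert c v ∅) ∅
insert c (ω² ∷ v) ∅                  = node ∅ ∅ ∅ (insert c v ∅)
insert c (𝟎  ∷ v) (node t₀ t₁ t₂ t₃) = node (insert c v t₀) t₁ t₂ t₃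
insert c (𝟏  ∷ v) (node t₀ t₁ t₂ t₃) = node t₀ (insert c v t₁) t₂ t₃
insert c (ω  ∷ v) (node t₀ t₁ t₂ t₃) = node t₀ t₁ (insert c v t₂) t₃
insert c (ω² ∷ v) (node t₀ t₁ t₂ t₃) = node t₀ t₁ t₂ (insert c v t₃)

-- The first nonzero coordinate, and 𝟏 for the zero vector.
leading : ∀ {n} → V n → GF4
leading []       = 𝟏
leading (𝟎 ∷ v)  = leading v
leading (x ∷ v)  = x

-- Collects the terms of a combination.  Each vector is replaced by the
-- multiple with leading coordinate 𝟏, which is correct for functions that are
-- homogeneous of degree one.
collect : List (GF4 × V 6) → Trie 6
collect []            = ∅
collect ((c , v) ∷ l) = insert (c * leading v) (inv (leading v) ⊛ v) (collect l)

everyLeaf : ∀ {n} → (V n → GF4 → Bool) → Trie n → Bool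
everyLeaf P ∅                  = true
everyLeaf P (leaf c)           = P [] c
everyLeaf P (node t₀ t₁ t₂ t₃) =
  (everyLeaf (P ∘ (𝟎 ∷_)) t₀ ∧ everyLeaf (P ∘ (𝟏 ∷_)) t₁) ∧
  (everyLeaf (P ∘ (ω ∷_)) t₂ ∧ everyLeaf (P ∘ (ω² ∷_)) t₃)

isZero : GF4 → Bool
isZero 𝟎 = true
isZero _ = false

-- A term c v contributes nothing to a value of g if c = 𝟎 or s(v) = 22.
harmless : List (V 6) → V 6 → GF4 → Bool
harmless ks v c = isZero c ∨ (zeros ks v ≡ᵇ 22)

-- The value of a formal combination on a function.
eval : ∀ {n} → Trie n → (V n → GF4) → GF4
eval ∅                  f = 𝟎
eval (leaf c)           f = c * f []
eval (node t₀ t₁ t₂ t₃) f =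
  (eval t₀ (f ∘ (𝟎 ∷_)) + eval t₁ (f ∘ (𝟏 ∷_))) +
  (eval t₂ (f ∘ (ω ∷_)) + eval t₃ (f ∘ (ω² ∷_)))

private
  at₀ : ∀ x a b c d → ((x + a) + b) + (c + d) ≡ x + ((a + b) + (c + d))
  at₀ x a b c d = trans (cong (_+ (c + d)) (F.+-assoc x a b)) (F.+-assoc x (a + b) (c + d))

  at₁ : ∀ x a b c d → (a + (x + b)) + (c + d) ≡ x + ((a + b) + (c + d))
  at₁ x a b c d = trans (cong (_+ (c + d)) (trans (F.+-comm a (x + b)) (trans (F.+-assoc x b a) (cong (x +_) (F.+-comm b a)))))
    (F.+-assoc x (a + b) (c + d))

  at₂ : ∀ x a b c d → (a + b) + ((x + c) + d) ≡ x + ((a + b) + (c + d))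
  at₂ x a b c d = trans (F.+-comm (a + b) ((x + c) + d)) (trans (at₀ x c d a b) (cong (x +_) (F.+-comm (c + d) (a + b))))

  at₃ : ∀ x a b c d → (a + b) + (c + (x + d)) ≡ x + ((a + b) + (c + d))
  at₃ x a b c d = trans (F.+-comm (a + b) (c + (x + d))) (trans (at₁ x c d a b) (cong (x +_) (F.+-comm (c + d) (a + b))))

eval-insert : ∀ {n} c v (t : Trie n) f → eval (insert c v t) f ≡ c * f v + eval t f
eval-insert c []       ∅        f = sym (F.+-identityʳ _)
eval-insert c []       (leaf d) f = F.distribʳ (f []) c d
eval-insert c (𝟎  ∷ v) ∅ f = trans (cong (λ t → (t + 𝟎) + (𝟎 + 𝟎)) (eval-insert c v ∅ _)) (at₀ (c * f (𝟎 ∷ v)) 𝟎 𝟎 𝟎 𝟎)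
eval-insert c (𝟏  ∷ v) ∅ f = trans (cong (λ t → (𝟎 + t) + (𝟎 + 𝟎)) (eval-insert c v ∅ _)) (at₁ (c * f (𝟏 ∷ v)) 𝟎 𝟎 𝟎 𝟎)
eval-insert c (ω  ∷ v) ∅ f = trans (cong (λ t → (𝟎 + 𝟎) + (t + 𝟎)) (eval-insert c v ∅ _)) (at₂ (c * f (ω ∷ v)) 𝟎 𝟎 𝟎 𝟎)
eval-insert c (ω² ∷ v) ∅ f = trans (cong (λ t → (𝟎 + 𝟎) + (𝟎 + t)) (eval-insert c v ∅ _)) (at₃ (c * f (ω² ∷ v)) 𝟎 𝟎 𝟎 𝟎)
eval-insert c (𝟎  ∷ v) (node t₀ t₁ t₂ t₃) f rewrite eval-insert c v t₀ (f ∘ (𝟎 ∷_)) =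
  at₀ (c * f (𝟎 ∷ v)) (eval t₀ (f ∘ (𝟎 ∷_))) (eval t₁ (f ∘ (𝟏 ∷_))) (eval t₂ (f ∘ (ω ∷_))) (eval t₃ (f ∘ (ω² ∷_)))
eval-insert c (𝟏  ∷ v) (node t₀ t₁ t₂ t₃) f rewrite eval-insert c v t₁ (f ∘ (𝟏 ∷_)) =
  at₁ (c * f (𝟏 ∷ v)) (eval t₀ (f ∘ (𝟎 ∷_))) (eval t₁ (f ∘ (𝟏 ∷_))) (eval t₂ (f ∘ (ω ∷_))) (eval t₃ (f ∘ (ω² ∷_)))
eval-insert c (ω  ∷ v) (node t₀ t₁ t₂ t₃) f rewrite eval-insert c v t₂ (f ∘ (ω ∷_)) =
  at₂ (c * f (ω ∷ v)) (eval t₀ (f ∘ (𝟎 ∷_))) (eval t₁ (f ∘ (𝟏 ∷_))) (eval t₂ (f ∘ (ω ∷_))) (eval t₃ (f ∘ (ω² ∷_)))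
eval-insert c (ω² ∷ v) (node t₀ t₁ t₂ t₃) f rewrite eval-insert c v t₃ (f ∘ (ω² ∷_)) =
  at₃ (c * f (ω² ∷ v)) (eval t₀ (f ∘ (𝟎 ∷_))) (eval t₁ (f ∘ (𝟏 ∷_))) (eval t₂ (f ∘ (ω ∷_))) (eval t₃ (f ∘ (ω² ∷_)))

∧-split : ∀ {x y} → x ∧ y ≡ true → x ≡ true × y ≡ true
∧-split {true} {true} _ = refl , refl

eval-vanishes : ∀ {n} P (t : Trie n) f → everyLeaf P t ≡ true →
  (∀ v c → P v c ≡ true → c * f v ≡ 𝟎) → eval t f ≡ 𝟎
eval-vanishes P ∅        f ok h = refl
eval-vanishes P (leaf c) f ok h = h [] c ok
eval-vanishes P (node t₀ t₁ t₂ t₃) f ok h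
  with l , r ← ∧-split ok
  with p , q ← ∧-split l | p′ , q′ ← ∧-split r =
  cong₂ _+_
    (cong₂ _+_ (eval-vanishes _ t₀ _ p (h ∘ (𝟎 ∷_))) (eval-vanishes _ t₁ _ q (h ∘ (𝟏 ∷_))))
    (cong₂ _+_ (eval-vanishes _ t₂ _ p′ (h ∘ (ω ∷_))) (eval-vanishes _ t₃ _ q′ (h ∘ (ω² ∷_))))

-- The value of an uncollected combination.
value : (V 6 → GF4) → List (GF4 × V 6) → GF4
value f = sumᶠ (λ (c , v) → c * f v)

leading≢0 : ∀ {n} (v : V n) → leading v ≢ 𝟎
leading≢0 []       ()
leading≢0 (𝟎  ∷ v) = leading≢0 v
leading≢0 (𝟏  ∷ v) ()
leading≢0 (ω  ∷ v) ()
leading≢0 (ω² ∷ v) ()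

⊛-identity : ∀ {n} (v : V n) → 𝟏 ⊛ v ≡ v
⊛-identity v = Vec.map-id v

⊛-inv : ∀ {n} c (v : V n) → c ≢ 𝟎 → c ⊛ (inv c ⊛ v) ≡ v
⊛-inv c []      n = refl
⊛-inv c (x ∷ v) n = cong₂ _∷_ (inv-* c x n) (⊛-inv c v n)

Homogeneous : (V 6 → GF4) → Set
Homogeneous f = ∀ c v → c ≢ 𝟎 → f (c ⊛ v) ≡ c * f v

eval-collect : ∀ {f} → Homogeneous f → ∀ l → eval (collect l) f ≡ value f l
eval-collect hom []            = refl
eval-collect {f} hom ((c , v) ∷ l) = begin
  eval (insert (c * k) (inv k ⊛ v) (collect l)) f ≡⟨ eval-insert (c * k) (inv k ⊛ v) (collect l) f ⟩
  (c * k) * f (inv k ⊛ v) + eval (collect l) f    ≡⟨ cong₂ _+_ eq (eval-collect hom l) ⟩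
  c * f v + value f l                             ∎
  where
  open ≡-Reasoning
  k = leading v
  eq : (c * k) * f (inv k ⊛ v) ≡ c * f v
  eq = trans (F.*-assoc c k _) (cong (c *_) (trans (sym (hom k (inv k ⊛ v) (leading≢0 v)))
    (cong f (⊛-inv k v (leading≢0 v)))))

-- Affine flats and counting over them

-- The flat base + ⟨dir₁, dir₂, dir₃⟩.  It is parametrised by 𝔽₄³, and its
-- points are counted with multiplicity if the directions are dependent.
data Flat : Set where
  flat : (base dir₁ dir₂ dir₃ : V 6) → Flat

scalars : List GF4
scalars = 𝟎 ∷ 𝟏 ∷ ω ∷ ω² ∷ []

-- All sums of a vector of the list and a multiple of d.
sweep : ∀ {n} → V n → List (V n) → List (V n)
sweep d []       = []
sweep d (p ∷ ps) = p ∷ p ⊕ d ∷ p ⊕ ω ⊛ d ∷ p ⊕ ω² ⊛ d ∷ sweep d ps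

points : Flat → List (V 6)
points (flat p d₁ d₂ d₃) = sweep d₃ (sweep d₂ (sweep d₁ (p ∷ [])))

-- The combination of vectors given by a combination of flats.
expand : List (GF4 × Flat) → List (GF4 × V 6)
expand [] = []
expand ((𝟎 , F) ∷ l) = expand l
expand ((c , F) ∷ l) = List.map (c ,_) (points F) ++ expand l

-- The number N(a, b) of vectors x of xs with  a ∙ x = b.
count : List (V 6) → V 6 → GF4 → ℕ
count xs a b = sumL (λ x → δ (a ∙ x) b) xs

δ-scale : ∀ c x y → c ≢ 𝟎 → δ (c * x) (c * y) ≡ δ x y
δ-scale 𝟎  x y n = ⊥-elim (n refl)
δ-scale 𝟏  x y n = refl
δ-scale ω  x y n = toWitness {a? = all? λ x → all? λ y → δ (ω * x) (ω * y) ℕ.≟ δ x y} tt x y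
δ-scale ω² x y n = toWitness {a? = all? λ x → all? λ y → δ (ω² * x) (ω² * y) ℕ.≟ δ x y} tt x y

count-scale : ∀ xs c a b → c ≢ 𝟎 → count xs (c ⊛ a) (c * b) ≡ count xs a b
count-scale xs c a b n = sumL-cong
  (λ x → trans (cong (λ t → δ t (c * b)) (∙-⊛ˡ c a x)) (δ-scale c (a ∙ x) b n)) xs

zeros-scale : ∀ ks c a → c ≢ 𝟎 → zeros ks (c ⊛ a) ≡ zeros ks a
zeros-scale ks c a n =
  trans (cong (count ks (c ⊛ a)) (sym (F.zeroʳ c))) (count-scale ks c a 𝟎 n)

count-total : ∀ xs a → sumL (count xs a) scalars ≡ length xs
count-total xs a = trans (sumL-swap (λ b x → δ (a ∙ x) b) scalars xs)
  (trans (sumL-cong (λ x → one-value (a ∙ x)) xs) (sumL-1 xs))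
  where
  one-value : ∀ y → sumL (δ y) scalars ≡ 1
  one-value 𝟎  = refl
  one-value 𝟏  = refl
  one-value ω  = refl
  one-value ω² = refl

∑₄ : (GF4 → ℕ) → ℕ
∑₄ f = ((f 𝟎 ℕ.+ f 𝟏) ℕ.+ f ω) ℕ.+ f ω²

sumL-sweep : ∀ {n} (f : GF4 → ℕ) (x d : V n) ps →
  sumL (λ p → f (p ∙ x)) (sweep d ps) ≡ sumL (λ p → ∑₄ (λ a → f (p ∙ x + a * (d ∙ x)))) ps
sumL-sweep f x d []       = refl
sumL-sweep f x d (p ∷ ps)
  rewrite ∙-distribʳ p d x | ∙-distribʳ p (ω ⊛ d) x | ∙-distribʳ p (ω² ⊛ d) x
        | ∙-⊛ˡ ω d x | ∙-⊛ˡ ω² d x | F.+-identityʳ (p ∙ x) | sumL-sweep f x d ps =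
  regroup (f (p ∙ x)) (f (p ∙ x + d ∙ x)) (f (p ∙ x + ω * (d ∙ x))) (f (p ∙ x + ω² * (d ∙ x)))
    (sumL (λ p → ∑₄ (λ a → f (p ∙ x + a * (d ∙ x)))) ps)
  where
  regroup : ∀ a b c d e → a ℕ.+ (b ℕ.+ (c ℕ.+ (d ℕ.+ e))) ≡ (((a ℕ.+ b) ℕ.+ c) ℕ.+ d) ℕ.+ e
  regroup = solve-∀

-- 1 if the three values are zero, which means that a functional is constant
-- on a flat with directions on which it takes these values; 0 otherwise.
constantOn : GF4 → GF4 → GF4 → ℕ
constantOn y₁ y₂ y₃ = (δ y₁ 𝟎 ℕ.* δ y₂ 𝟎) ℕ.* δ y₃ 𝟎

-- An affine function on 𝔽₄³ either is constant or takes each value 16 times.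
distribution : ∀ y y₁ y₂ y₃ z →
  ∑₄ (λ a → ∑₄ (λ b → ∑₄ (λ c → δ (((y + a * y₁) + b * y₂) + c * y₃) z))) ≡
  64 ℕ.* (δ y z ℕ.* constantOn y₁ y₂ y₃) ℕ.+ 16 ℕ.* (1 ℕ.∸ constantOn y₁ y₂ y₃)
distribution = toWitness
  {a? = all? λ y → all? λ y₁ → all? λ y₂ → all? λ y₃ → all? λ z →
    ∑₄ (λ a → ∑₄ (λ b → ∑₄ (λ c → δ (((y + a * y₁) + b * y₂) + c * y₃) z))) ℕ.≟
    64 ℕ.* (δ y z ℕ.* constantOn y₁ y₂ y₃) ℕ.+ 16 ℕ.* (1 ℕ.∸ constantOn y₁ y₂ y₃)} tt

module _ (xs : List (V 6)) (p d₁ d₂ d₃ : V 6) where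

  private
    c : V 6 → ℕ
    c x = constantOn (d₁ ∙ x) (d₂ ∙ x) (d₃ ∙ x)

  -- The vectors of xs that are constant on the flat, with value z.
  inner : GF4 → ℕ
  inner z = sumL (λ x → δ (p ∙ x) z ℕ.* c x) xs

  -- The vectors of xs that are not constant on the flat.
  outer : ℕ
  outer = sumL (λ x → 1 ℕ.∸ c x) xs

  count-flat : ∀ z → sumL (λ P → count xs P z) (points (flat p d₁ d₂ d₃)) ≡
    64 ℕ.* inner z ℕ.+ 16 ℕ.* outer
  count-flat z = begin
    sumL (λ P → count xs P z) (points (flat p d₁ d₂ d₃))
      ≡⟨ sumL-swap (λ P x → δ (P ∙ x) z) (points (flat p d₁ d₂ d₃)) xs ⟩
    sumL (λ x → sumL (λ P → δ (P ∙ x) z) (points (flat p d₁ d₂ d₃))) xs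
      ≡⟨ sumL-cong eq xs ⟩
    sumL (λ x → 64 ℕ.* (δ (p ∙ x) z ℕ.* c x) ℕ.+ 16 ℕ.* (1 ℕ.∸ c x)) xs
      ≡⟨ sumL-+ (λ x → 64 ℕ.* (δ (p ∙ x) z ℕ.* c x)) (λ x → 16 ℕ.* (1 ℕ.∸ c x)) xs ⟩
    sumL (λ x → 64 ℕ.* (δ (p ∙ x) z ℕ.* c x)) xs ℕ.+ sumL (λ x → 16 ℕ.* (1 ℕ.∸ c x)) xs
      ≡⟨ cong₂ ℕ._+_ (sumL-* 64 (λ x → δ (p ∙ x) z ℕ.* c x) xs) (sumL-* 16 (λ x → 1 ℕ.∸ c x) xs) ⟩
    64 ℕ.* inner z ℕ.+ 16 ℕ.* outer ∎
    where
    open ≡-Reasoning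
    eq : ∀ x → sumL (λ P → δ (P ∙ x) z) (points (flat p d₁ d₂ d₃)) ≡
         64 ℕ.* (δ (p ∙ x) z ℕ.* c x) ℕ.+ 16 ℕ.* (1 ℕ.∸ c x)
    eq x = trans (sumL-sweep (λ y → δ y z) x d₃ (sweep d₂ (sweep d₁ (p ∷ []))))
      (trans (sumL-sweep (λ y → ∑₄ (λ c → δ (y + c * (d₃ ∙ x)) z)) x d₂ (sweep d₁ (p ∷ [])))
      (trans (sumL-sweep (λ y → ∑₄ (λ b → ∑₄ (λ c → δ ((y + b * (d₂ ∙ x)) + c * (d₃ ∙ x)) z))) x d₁ (p ∷ []))
      (trans (ℕ.+-identityʳ _)
      (distribution (p ∙ x) (d₁ ∙ x) (d₂ ∙ x) (d₃ ∙ x) z))))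

-- For ℕ-valued functions fᵢ the sum of f₁ + f₂ ω + f₃ ω² depends only on the
-- parities of the sums of the fᵢ.
sumᶠ-parity : ∀ {A : Set} (f₁ f₂ f₃ : A → ℕ) xs →
  sumᶠ (λ x → (parity (f₁ x) + parity (f₂ x) * ω) + parity (f₃ x) * ω²) xs ≡
  (parity (sumL f₁ xs) + parity (sumL f₂ xs) * ω) + parity (sumL f₃ xs) * ω²
sumᶠ-parity f₁ f₂ f₃ []       = refl
sumᶠ-parity f₁ f₂ f₃ (x ∷ xs)
  rewrite sumᶠ-parity f₁ f₂ f₃ xs
        | parity-+ (f₁ x) (sumL f₁ xs) | parity-+ (f₂ x) (sumL f₂ xs) | parity-+ (f₃ x) (sumL f₃ xs)
        | F.distribʳ ω (parity (f₂ x)) (parity (sumL f₂ xs))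
        | F.distribʳ ω² (parity (f₃ x)) (parity (sumL f₃ xs)) =
  trans (+-interchange (p₁ + p₂) p₃ (q₁ + q₂) q₃) (cong (_+ (p₃ + q₃)) (+-interchange p₁ p₂ q₁ q₂))
  where
  p₁ = parity (f₁ x)
  p₂ = parity (f₂ x) * ω
  p₃ = parity (f₃ x) * ω²
  q₁ = parity (sumL f₁ xs)
  q₂ = parity (sumL f₂ xs) * ω
  q₃ = parity (sumL f₃ xs) * ω²

nonzero : ∀ {n} → V n → Bool
nonzero []      = false
nonzero (x ∷ v) = not (isZero x) ∨ nonzero v

nonzero⇒≢0 : ∀ {n} (v : V n) → nonzero v ≡ true → v ≢ 𝟘
nonzero⇒≢0 (𝟎 ∷ v) ok refl = nonzero⇒≢0 v ok refl
nonzero⇒≢0 (𝟏 ∷ v) ok ()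
nonzero⇒≢0 (ω ∷ v) ok ()
nonzero⇒≢0 (ω² ∷ v) ok ()

all-true : ∀ {A : Set} (P : A → Bool) xs → all P xs ≡ true → All (λ x → P x ≡ true) xs
all-true P []       ok = []
all-true P (x ∷ xs) ok with p , q ← ∧-split {P x} ok = p ∷ all-true P xs q

≡ᵇ-sound : ∀ {m n} → (m ≡ᵇ n) ≡ true → m ≡ n
≡ᵇ-sound {m} {n} e = ℕ.≡ᵇ⇒≡ m n (subst T (sym e) tt)

-- No point of the flat is the zero vector.
avoidsZero : Flat → Bool
avoidsZero F = all nonzero (points F)

indicator : {A : Set} → Dec A → ℕ
indicator (yes _) = 1
indicator (no  _) = 0

-- With s(a) = 22 none of the four hyperplanes  a ∙ x = b  has 78 points, and
-- with s(a) = 14 exactly one has; e is the number of those that have.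
excess-22 : ∀ e → 4 ℕ.* 22 ℕ.+ (352 ℕ.+ 32 ℕ.* e) ≡ 440 → e ≡ 0
excess-22 e eq = ℕ.*-cancelˡ-≡ e 0 32 (ℕ.+-cancelˡ-≡ 440 (32 ℕ.* e) 0 (trans (ℕ.+-assoc 88 352 (32 ℕ.* e)) eq))

excess-14 : ∀ e → 4 ℕ.* 14 ℕ.+ (352 ℕ.+ 32 ℕ.* e) ≡ 440 → e ≡ 1
excess-14 e eq = ℕ.*-cancelˡ-≡ e 1 32 (ℕ.+-cancelˡ-≡ 408 (32 ℕ.* e) 32 (trans (ℕ.+-assoc 56 352 (32 ℕ.* e)) eq))

-- The situation after the size 110 has been found: ks represents the points
-- at infinity, xs is the list of the affine points.
module Core (ks xs : List (V 6))
  (size : ∀ a → a ≢ 𝟘 → ∀ b → zeros ks a ℕ.+ count xs a b ≡ 78 ⊎ zeros ks a ℕ.+ count xs a b ≡ 110)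
  (len : length xs ≡ 352) where

  small : ℕ → ℕ
  small n = indicator (n ℕ.≟ 78)

  -- 1 if the hyperplane  a ∙ x = b  has 78 points, and 0 otherwise.
  deficient : V 6 → GF4 → ℕ
  deficient a b = small (zeros ks a ℕ.+ count xs a b)

  size-deficient : ∀ a → a ≢ 𝟘 → ∀ b → (zeros ks a ℕ.+ count xs a b) ℕ.+ 32 ℕ.* deficient a b ≡ 110
  size-deficient a a≢0 b = go (size a a≢0 b)
    where
    go : ∀ {n} → n ≡ 78 ⊎ n ≡ 110 → n ℕ.+ 32 ℕ.* small n ≡ 110
    go (inj₁ refl) = refl
    go (inj₂ refl) = refl

  -- The sum of the scalars b, weighted by the parity of deficient a b.  If
  -- exactly one hyperplane  a ∙ x = b  has 78 points, this is its b.
  g : V 6 → GF4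
  g a = (parity (deficient a 𝟏) + parity (deficient a ω) * ω) + parity (deficient a ω²) * ω²

  deficient-scale : ∀ c a b → c ≢ 𝟎 → deficient (c ⊛ a) (c * b) ≡ deficient a b
  deficient-scale c a b n = cong small (cong₂ ℕ._+_ (zeros-scale ks c a n) (count-scale xs c a b n))

  g-homogeneous : Homogeneous g
  g-homogeneous 𝟎  a n = ⊥-elim (n refl)
  g-homogeneous 𝟏  a n = cong g (⊛-identity a)
  g-homogeneous ω  a n
    rewrite deficient-scale ω a ω² n | deficient-scale ω a 𝟏 n | deficient-scale ω a ω n =
    check₃ {λ x y z → (z + x * ω) + y * ω²} {λ x y z → ω * ((x + y * ω) + z * ω²)}
      (parity (deficient a 𝟏)) (parity (deficient a ω)) (parity (deficient a ω²))
  g-homogeneous ω² a n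
    rewrite deficient-scale ω² a ω² n | deficient-scale ω² a 𝟏 n | deficient-scale ω² a ω n =
    check₃ {λ x y z → (y + z * ω) + x * ω²} {λ x y z → ω² * ((x + y * ω) + z * ω²)}
      (parity (deficient a 𝟏)) (parity (deficient a ω)) (parity (deficient a ω²))

  -- For the points Ps of a flat, m b is the number of x in xs that are constant on
  -- it with value b; the other x contribute Y for every b.
  module _ (Ps : List (V 6)) (ok : all nonzero Ps ≡ true) (m : GF4 → ℕ) (Y : ℕ)
    (counts : ∀ b → sumL (λ P → count xs P b) Ps ≡ 64 ℕ.* m b ℕ.+ Y) where
    private
      -- The number of deficient hyperplanes  P ∙ x = b.
      n : GF4 → ℕ
      n b = sumL (λ P → deficient P b) Ps
      Z = sumL (zeros ks) Ps

      balance : ∀ b → (Z ℕ.+ (64 ℕ.* m b ℕ.+ Y)) ℕ.+ 32 ℕ.* n b ≡ sumL (λ _ → 110) Ps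
      balance b = begin
        (Z ℕ.+ (64 ℕ.* m b ℕ.+ Y)) ℕ.+ 32 ℕ.* n b
          ≡⟨ cong (λ t → (Z ℕ.+ t) ℕ.+ 32 ℕ.* n b) (counts b) ⟨
        (Z ℕ.+ sumL (λ P → count xs P b) Ps) ℕ.+ 32 ℕ.* n b
          ≡⟨ cong₂ ℕ._+_ (sumL-+ (zeros ks) (λ P → count xs P b) Ps) (sumL-* 32 (λ P → deficient P b) Ps) ⟨
        sumL (λ P → zeros ks P ℕ.+ count xs P b) Ps ℕ.+ sumL (λ P → 32 ℕ.* deficient P b) Ps
          ≡⟨ sumL-+ (λ P → zeros ks P ℕ.+ count xs P b) (λ P → 32 ℕ.* deficient P b) Ps ⟨
        sumL (λ P → (zeros ks P ℕ.+ count xs P b) ℕ.+ 32 ℕ.* deficient P b) Ps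
          ≡⟨ sumL-congAll (λ P nz → size-deficient P (nonzero⇒≢0 P nz) b) (all-true nonzero Ps ok) ⟩
        sumL (λ _ → 110) Ps ∎
        where open ≡-Reasoning

      rearrange : ∀ z y m n → (z ℕ.+ (64 ℕ.* m ℕ.+ y)) ℕ.+ 32 ℕ.* n ≡ (z ℕ.+ y) ℕ.+ 32 ℕ.* (n ℕ.+ 2 ℕ.* m)
      rearrange = solve-∀

      -- The double count: n b + 2 m b does not depend on b.
      agree : ∀ b c → n b ℕ.+ 2 ℕ.* m b ≡ n c ℕ.+ 2 ℕ.* m c
      agree b c = ℕ.*-cancelˡ-≡ _ _ 32 (ℕ.+-cancelˡ-≡ (Z ℕ.+ Y) _ _
        (trans (sym (rearrange Z Y (m b) (n b))) (trans (balance b)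
        (trans (sym (balance c)) (rearrange Z Y (m c) (n c))))))

      parity-n : ∀ b → parity (n b) ≡ parity (n b ℕ.+ 2 ℕ.* m b)
      parity-n b = sym (trans (parity-+ (n b) (2 ℕ.* m b))
        (trans (cong (parity (n b) +_) (parity-2* (m b))) (F.+-identityʳ _)))

      same : ∀ b c → parity (n b) ≡ parity (n c)
      same b c = trans (parity-n b) (trans (cong parity (agree b c)) (sym (parity-n c)))

    even-sum : sumᶠ g Ps ≡ 𝟎
    even-sum = trans (sumᶠ-parity (λ P → deficient P 𝟏) (λ P → deficient P ω) (λ P → deficient P ω²) Ps)
      (trans (cong₂ (λ s t → (parity (n 𝟏) + s * ω) + t * ω²) (same ω 𝟏) (same ω² 𝟏))
      (check₁ {λ x → (x + x * ω) + x * ω²} {λ _ → 𝟎} (parity (n 𝟏))))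

  -- The numbers n b have equal parities, and 𝟏 + ω + ω² = 𝟎.
  flat-sum : ∀ F → avoidsZero F ≡ true → sumᶠ g (points F) ≡ 𝟎
  flat-sum (flat p d₁ d₂ d₃) ok = even-sum (points (flat p d₁ d₂ d₃)) ok (inner xs p d₁ d₂ d₃)
    (16 ℕ.* outer xs p d₁ d₂ d₃) (count-flat xs p d₁ d₂ d₃)

  sumᶠ-scaled : ∀ c Ps rest → value g (List.map (c ,_) Ps ++ rest) ≡ c * sumᶠ g Ps + value g rest
  sumᶠ-scaled c []       rest = cong (_+ value g rest) (sym (F.zeroʳ c))
  sumᶠ-scaled c (P ∷ Ps) rest = trans (cong (c * g P +_) (sumᶠ-scaled c Ps rest))
    (trans (sym (F.+-assoc (c * g P) _ _)) (cong (_+ value g rest) (sym (F.distribˡ c (g P) (sumᶠ g Ps)))))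

  flats-step : ∀ c F l → all (λ (_ , F) → avoidsZero F) ((c , F) ∷ l) ≡ true →
    value g (List.map (c ,_) (points F) ++ expand l) ≡ 𝟎

  flats-sum : ∀ l → all (λ (_ , F) → avoidsZero F) l ≡ true → value g (expand l) ≡ 𝟎
  flats-sum [] ok = refl
  flats-sum ((𝟎 , F) ∷ l) ok = flats-sum l (proj₂ (∧-split {avoidsZero F} ok))
  flats-sum ((𝟏  , F) ∷ l) ok = flats-step 𝟏 F l ok
  flats-sum ((ω  , F) ∷ l) ok = flats-step ω F l ok
  flats-sum ((ω² , F) ∷ l) ok = flats-step ω² F l ok

  flats-step c F l ok =
    let p , q = ∧-split {avoidsZero F} ok in
    trans (sumᶠ-scaled c (points F) (expand l))
      (trans (cong₂ (λ s t → c * s + t) (flat-sum F p) (flats-sum l q))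
      (cong (_+ 𝟎) (F.zeroʳ c)))

  -- The number of deficient hyperplanes among the four with functional a.
  deficiency : V 6 → ℕ
  deficiency a = sumL (deficient a) scalars

  -- The sizes of the four hyperplanes add up to 4 s(a) + 352, and deficiency
  -- makes up the difference from 4 · 110.
  total-deficient : ∀ a → a ≢ 𝟘 → 4 ℕ.* zeros ks a ℕ.+ (352 ℕ.+ 32 ℕ.* deficiency a) ≡ 440
  total-deficient a a≢0 = begin
    4 ℕ.* s ℕ.+ (352 ℕ.+ 32 ℕ.* deficiency a)
      ≡⟨ cong (λ t → 4 ℕ.* s ℕ.+ (t ℕ.+ 32 ℕ.* deficiency a)) (trans (count-total xs a) len) ⟨
    4 ℕ.* s ℕ.+ (sumL c scalars ℕ.+ 32 ℕ.* deficiency a)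
      ≡⟨ cong (λ t → 4 ℕ.* s ℕ.+ (sumL c scalars ℕ.+ t)) (sumL-* 32 (deficient a) scalars) ⟨
    4 ℕ.* s ℕ.+ (sumL c scalars ℕ.+ sumL e scalars)
      ≡⟨ ℕ.+-assoc (4 ℕ.* s) (sumL c scalars) (sumL e scalars) ⟨
    (4 ℕ.* s ℕ.+ sumL c scalars) ℕ.+ sumL e scalars
      ≡⟨ cong (ℕ._+ sumL e scalars) (sumL-+ (λ _ → s) c scalars) ⟨
    sumL (λ b → s ℕ.+ c b) scalars ℕ.+ sumL e scalars
      ≡⟨ sumL-+ (λ b → s ℕ.+ c b) e scalars ⟨
    sumL (λ b → (s ℕ.+ c b) ℕ.+ e b) scalars
      ≡⟨ sumL-cong (size-deficient a a≢0) scalars ⟩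
    440 ∎
    where
    open ≡-Reasoning
    s = zeros ks a
    c = count xs a
    e : GF4 → ℕ
    e b = 32 ℕ.* deficient a b

  sum≡0 : ∀ (f : GF4 → ℕ) → sumL f scalars ≡ 0 → ∀ b → f b ≡ 0
  sum≡0 f z 𝟎  = ℕ.m+n≡0⇒m≡0 (f 𝟎) z
  sum≡0 f z 𝟏  = ℕ.m+n≡0⇒m≡0 (f 𝟏) (ℕ.m+n≡0⇒n≡0 (f 𝟎) z)
  sum≡0 f z ω  = ℕ.m+n≡0⇒m≡0 (f ω) (ℕ.m+n≡0⇒n≡0 (f 𝟏) (ℕ.m+n≡0⇒n≡0 (f 𝟎) z))
  sum≡0 f z ω² = ℕ.m+n≡0⇒m≡0 (f ω²) (ℕ.m+n≡0⇒n≡0 (f ω) (ℕ.m+n≡0⇒n≡0 (f 𝟏) (ℕ.m+n≡0⇒n≡0 (f 𝟎) z)))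

  no-deficient : ∀ a → a ≢ 𝟘 → zeros ks a ≡ 22 → ∀ b → deficient a b ≡ 0
  no-deficient a a≢0 s22 = sum≡0 (deficient a) (excess-22 (deficiency a)
    (subst (λ s → 4 ℕ.* s ℕ.+ (352 ℕ.+ 32 ℕ.* deficiency a) ≡ 440) s22 (total-deficient a a≢0)))

  g-vanishes : ∀ a → a ≢ 𝟘 → zeros ks a ≡ 22 → g a ≡ 𝟎
  g-vanishes a a≢0 s22 = vanish (e 𝟏) (e ω) (e ω²)
    where
    e = no-deficient a a≢0 s22
    vanish : ∀ {x y z} → x ≡ 0 → y ≡ 0 → z ≡ 0 → (parity x + parity y * ω) + parity z * ω² ≡ 𝟎
    vanish refl refl refl = refl

  count-22 : ∀ a → a ≢ 𝟘 → zeros ks a ≡ 22 → ∀ b → count xs a b ≡ 88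
  count-22 a a≢0 s22 b = cancel (zeros ks a) (count xs a b) (deficient a b) s22
    (no-deficient a a≢0 s22 b) (size-deficient a a≢0 b)
    where
    cancel : ∀ s c e → s ≡ 22 → e ≡ 0 → (s ℕ.+ c) ℕ.+ 32 ℕ.* e ≡ 110 → c ≡ 88
    cancel _ c _ refl refl eq = ℕ.+-cancelˡ-≡ 22 c 88 (trans (sym (ℕ.+-identityʳ (22 ℕ.+ c))) eq)

  -- Of four numbers with sum 1, indexed by 𝔽₄, exactly one is 1, and the
  -- weighted sum of the scalars is its index.
  single : ∀ e₀ e₁ e₂ e₃ → e₀ ℕ.+ (e₁ ℕ.+ (e₂ ℕ.+ (e₃ ℕ.+ 0))) ≡ 1 →
    (e : GF4 → ℕ) → e 𝟎 ≡ e₀ → e 𝟏 ≡ e₁ → e ω ≡ e₂ → e ω² ≡ e₃ →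
    e ((parity e₁ + parity e₂ * ω) + parity e₃ * ω²) ≡ 1
  single 1 0 0 0 _ e p₀ p₁ p₂ p₃ = p₀
  single 0 1 0 0 _ e p₀ p₁ p₂ p₃ = p₁
  single 0 0 1 0 _ e p₀ p₁ p₂ p₃ = p₂
  single 0 0 0 1 _ e p₀ p₁ p₂ p₃ = p₃

  count-14 : ∀ a → a ≢ 𝟘 → zeros ks a ≡ 14 → count xs a (g a) ≡ 64
  count-14 a a≢0 s14 = cancel (zeros ks a) (count xs a (g a)) (deficient a (g a)) s14
    one-at (size-deficient a a≢0 (g a))
    where
    cancel : ∀ s c e → s ≡ 14 → e ≡ 1 → (s ℕ.+ c) ℕ.+ 32 ℕ.* e ≡ 110 → c ≡ 64
    cancel _ c _ refl refl eq = ℕ.+-cancelˡ-≡ 14 c 64 (ℕ.+-cancelʳ-≡ 32 (14 ℕ.+ c) 78 eq)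
    sum≡1 : deficiency a ≡ 1
    sum≡1 = excess-14 (deficiency a)
      (subst (λ s → 4 ℕ.* s ℕ.+ (352 ℕ.+ 32 ℕ.* deficiency a) ≡ 440) s14 (total-deficient a a≢0))
    one-at : deficient a (g a) ≡ 1
    one-at = single (deficient a 𝟎) (deficient a 𝟏) (deficient a ω) (deficient a ω²) sum≡1 (deficient a) refl refl refl refl

  -- If the sum of a combination of vectors and a combination of flats has only
  -- harmless terms, then g satisfies the linear relation given by the former.
  relation⇒sum : ∀ target l → all (λ (_ , F) → avoidsZero F) l ≡ true →
    everyLeaf (harmless ks) (collect (target ++ expand l)) ≡ true → value g target ≡ 𝟎
  relation⇒sum target l ok cert = begin
    value g target                      ≡⟨ F.+-identityʳ _ ⟨
    value g target + 𝟎                  ≡⟨ cong (value g target +_) (flats-sum l ok) ⟨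
    value g target + value g (expand l) ≡⟨ value-++ target (expand l) ⟨
    value g (target ++ expand l)        ≡⟨ eval-collect g-homogeneous (target ++ expand l) ⟨
    eval (collect (target ++ expand l)) g
      ≡⟨ eval-vanishes (harmless ks) (collect (target ++ expand l)) g cert leaf-vanishes ⟩
    𝟎 ∎
    where
    open ≡-Reasoning
    value-++ : ∀ l m → value g (l ++ m) ≡ value g l + value g m
    value-++ []            m = refl
    value-++ ((c , v) ∷ l) m = trans (cong (c * g v +_) (value-++ l m)) (sym (F.+-assoc (c * g v) _ _))
    leaf-vanishes : ∀ v c → harmless ks v c ≡ true → c * g v ≡ 𝟎
    leaf-vanishes v c h with c ≟ 𝟎
    ... | yes refl = refl
    ... | no c≢0   = trans (cong (c *_) (vanishes (≡ᵇ-sound (not-zero c c≢0 h)))) (F.zeroʳ c)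
      where
      not-zero : ∀ c → c ≢ 𝟎 → harmless ks v c ≡ true → (zeros ks v ≡ᵇ 22) ≡ true
      not-zero 𝟎  n h = ⊥-elim (n refl)
      not-zero 𝟏  n h = h
      not-zero ω  n h = h
      not-zero ω² n h = h
      -- Homogeneity gives g 𝟘 = ω g 𝟘.
      g-𝟘 : g 𝟘 ≡ 𝟎
      g-𝟘 = fixed (g 𝟘) (g-homogeneous ω 𝟘 (λ ()))
        where
        fixed : ∀ x → x ≡ ω * x → x ≡ 𝟎
        fixed 𝟎 _ = refl
      vanishes : zeros ks v ≡ 22 → g v ≡ 𝟎
      vanishes s22 with Vec.≡-dec _≟_ v 𝟘
      ... | yes refl = g-𝟘
      ... | no v≢0   = g-vanishes v v≢0 s22

-- The linear relations for the Hill cap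

-- The transpose of multiplication by ρ₀: the functional  x ↦ a ∙ (ρ₀ x), whose
-- coordinates are its values at 1, X, ..., X⁵.  As ρ₀ permutes the points of
-- the Hill cap, rotate preserves the number s(a).
rotate : V 6 → V 6
rotate a = a ∙ ρ₀ ∷ a ∙ shift ρ₀ ∷ a ∙ shift (shift ρ₀) ∷ a ∙ shift (shift (shift ρ₀))
  ∷ a ∙ shift (shift (shift (shift ρ₀))) ∷ a ∙ shift (shift (shift (shift (shift ρ₀)))) ∷ []

rotateFlat : Flat → Flat
rotateFlat (flat p d e f) = flat (rotate p) (rotate d) (rotate e) (rotate f)

digit : ℕ → GF4
digit 0 = 𝟎
digit 1 = 𝟏
digit 2 = ω
digit _ = ω²

-- The images of a flat under the first k powers of rotateFlat, the j-th with
-- the j-th base-4 digit of n as coefficient, the least significant first.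
orbit : ℕ → ℕ → Flat → List (GF4 × Flat)
orbit zero    n F = []
orbit (suc k) n F = (digit (n ℕ.% 4) , F) ∷ orbit k (n ℕ./ 4) (rotateFlat F)

unit : ∀ {n} → Fin n → V n
unit zero    = 𝟏 ∷ 𝟘
unit (suc i) = 𝟎 ∷ unit i

coordinateFlat : Fin 6 → Fin 6 → Fin 6 → Fin 6 → Flat
coordinateFlat i j k l = flat (unit i) (unit j) (unit k) (unit l)

weightedOrbit : ℕ → Flat → List (GF4 × Flat)
weightedOrbit = orbit 39

-- Coefficients of a linear combination of the equations of flat-sum that
-- yields  g(a₀ + ω u₀) = g(a₀) + ω g(u₀).  They were found by Gaussian
-- elimination: the 429 points with s = 14 are the unknowns, and the ten orbits
-- of flats have rank 384.
flats-ω : List (GF4 × Flat)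
flats-ω =
     weightedOrbit 1416144433172362960973 (coordinateFlat 5F 0F 1F 4F)
  ++ weightedOrbit 240902110879487388223702 (coordinateFlat 4F 1F 2F 3F)
  ++ weightedOrbit 268937381609588960173531 (coordinateFlat 5F 1F 2F 4F)
  ++ weightedOrbit 9729045788481262571123 (coordinateFlat 3F 1F 4F 5F)
  ++ weightedOrbit 161418487521223425924114 (coordinateFlat 4F 2F 3F 5F)
  ++ weightedOrbit 67303186593539974254491 (coordinateFlat 5F 0F 1F 2F)
  ++ weightedOrbit 260532764434926127955147 (coordinateFlat 1F 0F 4F 5F)
  ++ weightedOrbit 237517328871730393846516 (coordinateFlat 4F 0F 2F 3F)
  ++ weightedOrbit 125537082601005545986098 (coordinateFlat 4F 0F 1F 3F)
  ++ weightedOrbit 68306522327195378710 (coordinateFlat 2F 0F 3F 5F)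

a₀ u₀ : V 6
a₀ = 𝟎 ∷ 𝟎 ∷ 𝟎 ∷ 𝟏 ∷ 𝟏 ∷ 𝟏 ∷ []
u₀ = 𝟏 ∷ 𝟏 ∷ 𝟏 ∷ 𝟎 ∷ 𝟎 ∷ 𝟎 ∷ []

-- The same for  g(a₀ + ω² u₀) = g(a₀) + ω² g(u₀).
flats-ω² : List (GF4 × Flat)
flats-ω² =
     weightedOrbit 14379390055067662099217 (coordinateFlat 5F 0F 1F 4F)
  ++ weightedOrbit 221663711579275847647029 (coordinateFlat 4F 1F 2F 3F)
  ++ weightedOrbit 215645359804569585830516 (coordinateFlat 5F 1F 2F 4F)
  ++ weightedOrbit 82350337093929109820997 (coordinateFlat 3F 1F 4F 5F)
  ++ weightedOrbit 96940676130335117740104 (coordinateFlat 4F 2F 3F 5F)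
  ++ weightedOrbit 114098878689445683888835 (coordinateFlat 5F 0F 1F 2F)
  ++ weightedOrbit 296720237479753822440530 (coordinateFlat 1F 0F 4F 5F)
  ++ weightedOrbit 45677360927456505341493 (coordinateFlat 4F 0F 2F 3F)
  ++ weightedOrbit 270321765700683428416516 (coordinateFlat 4F 0F 1F 3F)
  ++ weightedOrbit 70759305790342825746 (coordinateFlat 2F 0F 3F 5F)

-- The left-hand side of the relation  g(a) + c g(u) + g(a + c u) = 0.
additivity : V 6 → V 6 → GF4 → List (GF4 × V 6)
additivity a u c = (𝟏 , a) ∷ (c , u) ∷ (𝟏 , a ⊕ c ⊛ u) ∷ []

opaque
  unfolding ρ₀ σ₀ hill

  flats-ω-avoid-zero : all (λ (_ , F) → avoidsZero F) flats-ω ≡ true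
  flats-ω-avoid-zero = refl

  flats-ω²-avoid-zero : all (λ (_ , F) → avoidsZero F) flats-ω² ≡ true
  flats-ω²-avoid-zero = refl

  certificate-ω : everyLeaf (harmless hill) (collect (additivity a₀ u₀ ω ++ expand flats-ω)) ≡ true
  certificate-ω = refl

  certificate-ω² : everyLeaf (harmless hill) (collect (additivity a₀ u₀ ω² ++ expand flats-ω²)) ≡ true
  certificate-ω² = refl

  zeros-a : zeros hill a₀ ≡ 14
  zeros-a = ≡ᵇ-sound refl

  zeros-u : zeros hill u₀ ≡ 14
  zeros-u = ≡ᵇ-sound refl

  zeros-a+u : zeros hill (a₀ ⊕ 𝟏 ⊛ u₀) ≡ 22
  zeros-a+u = ≡ᵇ-sound refl

  zeros-a+ωu : zeros hill (a₀ ⊕ ω ⊛ u₀) ≡ 14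
  zeros-a+ωu = ≡ᵇ-sound refl

  zeros-a+ω²u : zeros hill (a₀ ⊕ ω² ⊛ u₀) ≡ 14
  zeros-a+ω²u = ≡ᵇ-sound refl

-- The second intersection size, and the contradiction

module _ (h : ℕ) where

  -- 1 if the second alternative is used.
  uses-h : ∀ {n} → n ≡ 78 ⊎ n ≡ h → ℕ
  uses-h (inj₁ _) = 0
  uses-h (inj₂ _) = 1

  uses-h≤1 : ∀ {n} (e : n ≡ 78 ⊎ n ≡ h) → uses-h e ≤ 1
  uses-h≤1 (inj₁ _) = z≤n
  uses-h≤1 (inj₂ _) = s≤s z≤n

  uses-h-eq : ∀ {n} (e : n ≡ 78 ⊎ n ≡ h) → n ℕ.+ 78 ℕ.* uses-h e ≡ 78 ℕ.+ h ℕ.* uses-h e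
  uses-h-eq (inj₁ refl) = cong (78 ℕ.+_) (sym (ℕ.*-zeroʳ h))
  uses-h-eq (inj₂ refl) = trans (ℕ.+-comm h 78) (cong (78 ℕ.+_) (sym (ℕ.*-identityʳ h)))

  -- If k of the four values are h and the others 78, then their sum is
  -- 312 + (h - 78) k.
  two-valued-sum : ∀ (f : GF4 → ℕ) → (∀ b → f b ≡ 78 ⊎ f b ≡ h) →
    ∃[ k ] toℕ {5} k ℕ.* 78 ℕ.+ sumL f scalars ≡ 312 ℕ.+ h ℕ.* toℕ k
  two-valued-sum f two = k , (begin
    toℕ k ℕ.* 78 ℕ.+ sumL f scalars
      ≡⟨ cong (λ t → t ℕ.* 78 ℕ.+ sumL f scalars) k≡ ⟩
    sumL u scalars ℕ.* 78 ℕ.+ sumL f scalars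
      ≡⟨ ℕ.+-comm (sumL u scalars ℕ.* 78) (sumL f scalars) ⟩
    sumL f scalars ℕ.+ sumL u scalars ℕ.* 78
      ≡⟨ cong (sumL f scalars ℕ.+_) (trans (sumL-* 78 u scalars) (ℕ.*-comm 78 (sumL u scalars))) ⟨
    sumL f scalars ℕ.+ sumL (λ b → 78 ℕ.* u b) scalars
      ≡⟨ sumL-+ f (λ b → 78 ℕ.* u b) scalars ⟨
    sumL (λ b → f b ℕ.+ 78 ℕ.* u b) scalars
      ≡⟨ sumL-cong (λ b → uses-h-eq (two b)) scalars ⟩
    sumL (λ b → 78 ℕ.+ h ℕ.* u b) scalars
      ≡⟨ sumL-+ (λ _ → 78) (λ b → h ℕ.* u b) scalars ⟩
    312 ℕ.+ sumL (λ b → h ℕ.* u b) scalars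
      ≡⟨ cong (312 ℕ.+_) (sumL-* h u scalars) ⟩
    312 ℕ.+ h ℕ.* sumL u scalars
      ≡⟨ cong (λ t → 312 ℕ.+ h ℕ.* t) k≡ ⟨
    312 ℕ.+ h ℕ.* toℕ k ∎)
    where
    open ≡-Reasoning
    u : GF4 → ℕ
    u b = uses-h (two b)
    k≤4 : sumL u scalars ≤ 4
    k≤4 = sumL-mono (λ b → uses-h≤1 (two b)) scalars
    k : Fin 5
    k = fromℕ< (s≤s k≤4)
    k≡ : toℕ k ≡ sumL u scalars
    k≡ = Fin.toℕ-fromℕ< (s≤s k≤4)

  -- In the application k hyperplanes with s(a) = 14 and k′ with s(a) = 22 have
  -- h points.  Eliminating h gives 3 k′ = 4 k.
  only-3 : ∀ (k k′ : Fin 5) →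
    toℕ k′ ℕ.* (toℕ k ℕ.* 78 ℕ.+ 408) ℕ.+ toℕ k ℕ.* 312 ≡
    toℕ k ℕ.* (toℕ k′ ℕ.* 78 ℕ.+ 440) ℕ.+ toℕ k′ ℕ.* 312 → toℕ k ≡ 0 ⊎ toℕ k ≡ 3
  only-3 = toWitness {a? = Fin.all? λ k → Fin.all? λ k′ →
    (toℕ k′ ℕ.* (toℕ k ℕ.* 78 ℕ.+ 408) ℕ.+ toℕ k ℕ.* 312 ℕ.≟
     toℕ k ℕ.* (toℕ k′ ℕ.* 78 ℕ.+ 440) ℕ.+ toℕ k′ ℕ.* 312)
    →-dec (toℕ k ℕ.≟ 0 ⊎-dec toℕ k ℕ.≟ 3)} tt

  zero-impossible : ∀ k → k ≡ 0 → k ℕ.* 78 ℕ.+ 408 ≡ 312 ℕ.+ h ℕ.* k → ⊥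
  zero-impossible _ refl eq = contradiction (trans eq (cong (312 ℕ.+_) (ℕ.*-zeroʳ h))) (λ ())

  solve-3 : ∀ k → k ≡ 3 → k ℕ.* 78 ℕ.+ 408 ≡ 312 ℕ.+ h ℕ.* k → h ≡ 110
  solve-3 _ refl eq = ℕ.*-cancelʳ-≡ h 110 3 (ℕ.+-cancelˡ-≡ 312 (h ℕ.* 3) 330 (sym eq))

  cross-multiply : ∀ k k′ p q m → p ≡ m ℕ.+ h ℕ.* k → q ≡ m ℕ.+ h ℕ.* k′ →
    k′ ℕ.* p ℕ.+ k ℕ.* m ≡ k ℕ.* q ℕ.+ k′ ℕ.* m
  cross-multiply k k′ _ _ m refl refl = exchange m h k k′
    where
    exchange : ∀ m h k l → l ℕ.* (m ℕ.+ h ℕ.* k) ℕ.+ k ℕ.* m ≡ k ℕ.* (m ℕ.+ h ℕ.* l) ℕ.+ l ℕ.* m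
    exchange = solve-∀

  h≡110 : ∀ (k k′ : Fin 5) → toℕ k ℕ.* 78 ℕ.+ 408 ≡ 312 ℕ.+ h ℕ.* toℕ k →
    toℕ k′ ℕ.* 78 ℕ.+ 440 ≡ 312 ℕ.+ h ℕ.* toℕ k′ → h ≡ 110
  h≡110 k k′ e e′ =
    [ (λ k≡0 → ⊥-elim (zero-impossible (toℕ k) k≡0 e)) , (λ k≡3 → solve-3 (toℕ k) k≡3 e) ]′
    (only-3 k k′ (cross-multiply (toℕ k) (toℕ k′) (toℕ k ℕ.* 78 ℕ.+ 408) (toℕ k′ ℕ.* 78 ℕ.+ 440) 312 e e′))

-- (x - s, y - t) is orthogonal to one of the vectors (1, 0), (0, 1), (1, 1),
-- (1, ω), (1, ω²), which represent the five points of a projective line.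
pencil-covers : ∀ x y s t → 1 ≤
  δ x s ℕ.+ (δ y t ℕ.+ (δ (x + 𝟏 * y) (s + 𝟏 * t) ℕ.+ (δ (x + ω * y) (s + ω * t) ℕ.+ δ (x + ω² * y) (s + ω² * t))))
pencil-covers = toWitness
  {a? = all? λ x → all? λ y → all? λ s → all? λ t → 1 ℕ.≤?
   δ x s ℕ.+ (δ y t ℕ.+ (δ (x + 𝟏 * y) (s + 𝟏 * t) ℕ.+ (δ (x + ω * y) (s + ω * t) ℕ.+ δ (x + ω² * y) (s + ω² * t))))} tt

count-combination : ∀ xs c (a u : V 6) s →
  count xs (a ⊕ c ⊛ u) s ≡ sumL (λ x → δ (a ∙ x + c * (u ∙ x)) s) xs
count-combination xs c a u s = sumL-cong (λ x → cong (λ t → δ t s)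
  (trans (∙-distribʳ a (c ⊛ u) x) (cong (a ∙ x +_) (∙-⊛ˡ c u x)))) xs

-- The five hyperplanes through a common intersection of codimension two cover
-- all vectors.
length≤pencil : ∀ xs (a u : V 6) s t → length xs ≤
  count xs a s ℕ.+ (count xs u t ℕ.+ (count xs (a ⊕ 𝟏 ⊛ u) (s + 𝟏 * t) ℕ.+
  (count xs (a ⊕ ω ⊛ u) (s + ω * t) ℕ.+ count xs (a ⊕ ω² ⊛ u) (s + ω² * t))))
length≤pencil xs a u s t = subst₂ _≤_ (sumL-1 xs) split
  (sumL-mono (λ x → pencil-covers (a ∙ x) (u ∙ x) s t) xs)
  where
  f : GF4 → V 6 → ℕ
  f c x = δ (a ∙ x + c * (u ∙ x)) (s + c * t)
  p q : V 6 → ℕ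
  p x = δ (a ∙ x) s
  q x = δ (u ∙ x) t
  split : sumL (λ x → p x ℕ.+ (q x ℕ.+ (f 𝟏 x ℕ.+ (f ω x ℕ.+ f ω² x)))) xs ≡ _
  split =
    trans (sumL-+ p (λ x → q x ℕ.+ (f 𝟏 x ℕ.+ (f ω x ℕ.+ f ω² x))) xs) (cong (count xs a s ℕ.+_)
    (trans (sumL-+ q (λ x → f 𝟏 x ℕ.+ (f ω x ℕ.+ f ω² x)) xs) (cong (count xs u t ℕ.+_)
    (trans (sumL-+ (f 𝟏) (λ x → f ω x ℕ.+ f ω² x) xs)
      (cong₂ ℕ._+_ (sym (count-combination xs 𝟏 a u (s + 𝟏 * t)))
    (trans (sumL-+ (f ω) (f ω²) xs)
      (cong₂ ℕ._+_ (sym (count-combination xs ω a u (s + ω * t)))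
                   (sym (count-combination xs ω² a u (s + ω² * t))))))))))

solve-for : ∀ x y z → x + (y + (z + 𝟎)) ≡ 𝟎 → z ≡ x + y
solve-for x y z e = +≡0⇒≡ z (x + y) (trans
  (trans (F.+-comm z (x + y)) (trans (F.+-assoc x y z) (cong (λ t → x + (y + t)) (sym (F.+-identityʳ z))))) e)

-- On the line through the points a and u, the point a + u is orthogonal to 22
-- vectors of ks and the four others to 14.  The line is a parameter here; it
-- will be the one through a₀ and u₀.
module Pencil (ks : List (V 6)) (a u : V 6)
  (a≢0 : a ≢ 𝟘) (u≢0 : u ≢ 𝟘) (a+cu≢0 : ∀ c → a ⊕ c ⊛ u ≢ 𝟘)
  (zeros-a : zeros ks a ≡ 14) (zeros-u : zeros ks u ≡ 14)
  (zeros-a+u : zeros ks (a ⊕ 𝟏 ⊛ u) ≡ 22)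
  (zeros-a+ωu : zeros ks (a ⊕ ω ⊛ u) ≡ 14) (zeros-a+ω²u : zeros ks (a ⊕ ω² ⊛ u) ≡ 14)
  (xs : List (V 6)) (len : length xs ≡ 352) where

  sum-of-sizes : ∀ {s} a → zeros ks a ≡ s → sumL (λ b → zeros ks a ℕ.+ count xs a b) scalars ≡ 4 ℕ.* s ℕ.+ 352
  sum-of-sizes a refl = trans (sumL-+ (λ _ → zeros ks a) (count xs a) scalars)
    (cong (4 ℕ.* zeros ks a ℕ.+_) (trans (count-total xs a) len))

  larger-size : ∀ h →
    (∀ a → a ≢ 𝟘 → ∀ b → zeros ks a ℕ.+ count xs a b ≡ 78 ⊎ zeros ks a ℕ.+ count xs a b ≡ h) →
    h ≡ 110
  larger-size h size =
    let k  , e  = two-valued-sum h (λ b → zeros ks a ℕ.+ count xs a b) (size a a≢0)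
        k′ , e′ = two-valued-sum h (λ b → zeros ks (a ⊕ 𝟏 ⊛ u) ℕ.+ count xs (a ⊕ 𝟏 ⊛ u) b)
                    (size (a ⊕ 𝟏 ⊛ u) (a+cu≢0 𝟏))
    in h≡110 h k k′
      (trans (cong (toℕ k ℕ.* 78 ℕ.+_) (sym (sum-of-sizes a zeros-a))) e)
      (trans (cong (toℕ k′ ℕ.* 78 ℕ.+_) (sym (sum-of-sizes (a ⊕ 𝟏 ⊛ u) zeros-a+u))) e′)

  module _ (size : ∀ a → a ≢ 𝟘 → ∀ b → zeros ks a ℕ.+ count xs a b ≡ 78 ⊎ zeros ks a ℕ.+ count xs a b ≡ 110) where

    open Core ks xs size len

    additive : ∀ {c} → value g (additivity a u c) ≡ 𝟎 → g (a ⊕ c ⊛ u) ≡ g a + c * g u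
    additive {c} = solve-for (g a) (c * g u) (g (a ⊕ c ⊛ u))

    count-combination-14 : ∀ c → zeros ks (a ⊕ c ⊛ u) ≡ 14 → value g (additivity a u c) ≡ 𝟎 →
      count xs (a ⊕ c ⊛ u) (g a + c * g u) ≡ 64
    count-combination-14 c s14 rel = trans (cong (count xs (a ⊕ c ⊛ u)) (sym (additive {c} rel)))
      (count-14 (a ⊕ c ⊛ u) (a+cu≢0 c) s14)

    -- 344 = 64 + 64 + 88 + 64 + 64 is less than 352.
    not-additive : value g (additivity a u ω) ≡ 𝟎 → value g (additivity a u ω²) ≡ 𝟎 → ⊥
    not-additive rel₁ rel₂ = ℕ.<⇒≱ {344} {352} (ℕ.≤ᵇ⇒≤ 345 352 tt)
      (subst₂ _≤_ len total-count (length≤pencil xs a u (g a) (g u)))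
      where
      total-count : _ ≡ 344
      total-count = cong₂ ℕ._+_ (count-14 a a≢0 zeros-a)
        (cong₂ ℕ._+_ (count-14 u u≢0 zeros-u)
        (cong₂ ℕ._+_ (count-22 (a ⊕ 𝟏 ⊛ u) (a+cu≢0 𝟏) zeros-a+u (g a + 𝟏 * g u))
        (cong₂ ℕ._+_ (count-combination-14 ω zeros-a+ωu rel₁)
                     (count-combination-14 ω² zeros-a+ω²u rel₂))))

  no-second-size : ∀ h →
    (∀ a → a ≢ 𝟘 → ∀ b → zeros ks a ℕ.+ count xs a b ≡ 78 ⊎ zeros ks a ℕ.+ count xs a b ≡ h) →
    ∀ l₁ → all (λ (_ , F) → avoidsZero F) l₁ ≡ true →
    everyLeaf (harmless ks) (collect (additivity a u ω ++ expand l₁)) ≡ true →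
    ∀ l₂ → all (λ (_ , F) → avoidsZero F) l₂ ≡ true →
    everyLeaf (harmless ks) (collect (additivity a u ω² ++ expand l₂)) ≡ true →
    ⊥
  no-second-size h size l₁ ok₁ cert₁ l₂ ok₂ cert₂ =
    not-additive size′
      (Core.relation⇒sum ks xs size′ len (additivity a u ω) l₁ ok₁ cert₁)
      (Core.relation⇒sum ks xs size′ len (additivity a u ω²) l₂ ok₂ cert₂)
    where
    size′ : ∀ a → a ≢ 𝟘 → ∀ b → zeros ks a ℕ.+ count xs a b ≡ 78 ⊎ zeros ks a ℕ.+ count xs a b ≡ 110
    size′ = subst (λ h → ∀ a → a ≢ 𝟘 → ∀ b → zeros ks a ℕ.+ count xs a b ≡ 78 ⊎ zeros ks a ℕ.+ count xs a b ≡ h)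
      (larger-size h size) size

a₀+cu₀≢0 : ∀ c → a₀ ⊕ c ⊛ u₀ ≢ 𝟘
a₀+cu₀≢0 𝟎 ()
a₀+cu₀≢0 𝟏 ()
a₀+cu₀≢0 ω ()
a₀+cu₀≢0 ω² ()

-- The combinatorial core: no set of 352 affine points extends the Hill cap to
-- a set with two intersection sizes, one of which is 78.
no-configuration : ∀ (xs : List (V 6)) h → length xs ≡ 352 →
  (∀ a → a ≢ 𝟘 → ∀ b → zeros hill a ℕ.+ count xs a b ≡ 78 ⊎ zeros hill a ℕ.+ count xs a b ≡ h) → ⊥
no-configuration xs h len size =
  Pencil.no-second-size hill a₀ u₀ (λ ()) (λ ()) a₀+cu₀≢0 zeros-a zeros-u zeros-a+u zeros-a+ωu zeros-a+ω²u xs len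
    h size flats-ω flats-ω-avoid-zero certificate-ω flats-ω² flats-ω²-avoid-zero certificate-ω²

-- Automorphisms of 𝔽₄, and polynomials evaluated in the extension field

record Automorphism : Set where
  field
    to from : GF4 → GF4
    to-from : ∀ c → to (from c) ≡ c
    from-to : ∀ c → from (to c) ≡ c
    to-+    : ∀ c d → to (c + d) ≡ to c + to d
    to-*    : ∀ c d → to (c * d) ≡ to c * to d

  to-𝟎 : to 𝟎 ≡ 𝟎
  to-𝟎 = fixed (to 𝟎) (to-+ 𝟎 𝟎)
    where
    fixed : ∀ x → x ≡ x + x → x ≡ 𝟎
    fixed x e = trans e (+-self x)

  to-injective : ∀ {c d} → to c ≡ to d → c ≡ d
  to-injective {c} {d} e = trans (sym (from-to c)) (trans (cong from e) (from-to d))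

  to-𝟏 : to 𝟏 ≡ 𝟏
  to-𝟏 = idempotent (to 𝟏) (λ e → 𝟏≢𝟎 (to-injective (trans e (sym to-𝟎)))) (to-* 𝟏 𝟏)
    where
    𝟏≢𝟎 : 𝟏 ≢ 𝟎
    𝟏≢𝟎 ()
    idempotent : ∀ x → x ≢ 𝟎 → x ≡ x * x → x ≡ 𝟏
    idempotent 𝟎 n e = ⊥-elim (n refl)
    idempotent 𝟏 n e = refl


open Automorphism

square : GF4 → GF4
square c = c * c

identity : Automorphism
identity = record
  { to = λ c → c ; from = λ c → c ; to-from = λ _ → refl ; from-to = λ _ → refl
  ; to-+ = λ _ _ → refl ; to-* = λ _ _ → refl }

-- The composite of an automorphism with squaring.
frobenius : Automorphism → Automorphism
frobenius τ = record
  { to = λ c → square (to τ c)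
  ; from = λ c → from τ (square c)
  ; to-from = λ c → trans (cong square (to-from τ (square c))) (check₁ {λ c → square (square c)} {λ c → c} c)
  ; from-to = λ c → trans (cong (from τ) (check₁ {λ c → square (square c)} {λ c → c} (to τ c))) (from-to τ c)
  ; to-+ = λ c d → trans (cong square (to-+ τ c d)) (check₂ {λ x y → square (x + y)} {λ x y → square x + square y} (to τ c) (to τ d))
  ; to-* = λ c d → trans (cong square (to-* τ c d)) (check₂ {λ x y → square (x * y)} {λ x y → square x * square y} (to τ c) (to τ d))
  }

-- Coefficients in order of increasing degree.
Polynomial : Set
Polynomial = List GF4

infixl 6 _⊞_
_⊞_ : Polynomial → Polynomial → Polynomial
[]      ⊞ q       = q
(a ∷ p) ⊞ []      = a ∷ p
(a ∷ p) ⊞ (b ∷ q) = (a + b) ∷ (p ⊞ q)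

infixl 7 _⊠_
_⊠_ : Polynomial → Polynomial → Polynomial
[]      ⊠ q = []
(a ∷ p) ⊠ q = List.map (a *_) q ⊞ (𝟎 ∷ (p ⊠ q))

-- X⁶ modulo p.
reduction : V 6
reduction = 𝟏 ∷ ω ∷ 𝟎 ∷ ω² ∷ 𝟎 ∷ ω ∷ []

-- The polynomial p.
minimal : Polynomial
minimal = toList reduction ++ 𝟏 ∷ []

-- The extension has characteristic two.
module Char2 (E : Extension 𝔽₄ 6) where

  module E = Extension E
  open FieldProperties E.K public using (_≟ᴷ_; *-cancelˡ; zero-product; 1^; ^≢0; ^-*; coprime-power-generates; module Primitive; module Exp; module R)
  open E using (ι)
  module ι = IsRingHomomorphism E.isRingHomomorphism

  E-interchange : ∀ a b c d → (a E.+ b) E.+ (c E.+ d) ≡ (a E.+ c) E.+ (b E.+ d)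
  E-interchange = Interchange.interchange
    where
    module Interchange =
      Algebra.Properties.CommutativeSemigroup (CommutativeMonoid.commutativeSemigroup R.+-commutativeMonoid)

  E-*-interchange : ∀ a b c d → (a E.* b) E.* (c E.* d) ≡ (a E.* c) E.* (b E.* d)
  E-*-interchange = Interchange.interchange
    where
    module Interchange =
      Algebra.Properties.CommutativeSemigroup (CommutativeMonoid.commutativeSemigroup R.*-commutativeMonoid)

  double : ∀ x → x E.+ x ≡ E.0#
  double x = begin
    x E.+ x                             ≡⟨ cong₂ E._+_ (sym (R.*-identityˡ x)) (sym (R.*-identityˡ x)) ⟩
    E.1# E.* x E.+ E.1# E.* x           ≡⟨ R.distribʳ x E.1# E.1# ⟨
    (E.1# E.+ E.1#) E.* x               ≡⟨ cong (λ t → (t E.+ t) E.* x) ι.1#-homo ⟨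
    (ι 𝟏 E.+ ι 𝟏) E.* x                 ≡⟨ cong (E._* x) (ι.+-homo 𝟏 𝟏) ⟨
    ι 𝟎 E.* x                           ≡⟨ cong (E._* x) ι.0#-homo ⟩
    E.0# E.* x                          ≡⟨ R.zeroˡ x ⟩
    E.0#                                ∎
    where open ≡-Reasoning

  sum-zero : ∀ x y → x E.+ y ≡ E.0# → x ≡ y
  sum-zero x y e = begin
    x                 ≡⟨ R.+-identityʳ x ⟨
    x E.+ E.0#        ≡⟨ cong (x E.+_) (double y) ⟨
    x E.+ (y E.+ y)   ≡⟨ R.+-assoc x y y ⟨
    (x E.+ y) E.+ y   ≡⟨ cong (E._+ y) e ⟩
    E.0# E.+ y        ≡⟨ R.+-identityˡ y ⟩
    y                 ∎
    where open ≡-Reasoning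

  square-+ : ∀ x y → (x E.+ y) E.* (x E.+ y) ≡ x E.* x E.+ y E.* y
  square-+ x y = begin
    (x E.+ y) E.* (x E.+ y)                             ≡⟨ R.distribˡ (x E.+ y) x y ⟩
    (x E.+ y) E.* x E.+ (x E.+ y) E.* y                 ≡⟨ cong₂ E._+_ (R.distribʳ x x y) (R.distribʳ y x y) ⟩
    (x E.* x E.+ y E.* x) E.+ (x E.* y E.+ y E.* y)
      ≡⟨ cong (λ t → (x E.* x E.+ t) E.+ (x E.* y E.+ y E.* y)) (R.*-comm y x) ⟩
    (x E.* x E.+ x E.* y) E.+ (x E.* y E.+ y E.* y)     ≡⟨ R.+-assoc (x E.* x) (x E.* y) _ ⟩
    x E.* x E.+ (x E.* y E.+ (x E.* y E.+ y E.* y))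
      ≡⟨ cong (x E.* x E.+_) (R.+-assoc (x E.* y) (x E.* y) (y E.* y)) ⟨
    x E.* x E.+ ((x E.* y E.+ x E.* y) E.+ y E.* y)
      ≡⟨ cong (λ t → x E.* x E.+ (t E.+ y E.* y)) (double (x E.* y)) ⟩
    x E.* x E.+ (E.0# E.+ y E.* y)                      ≡⟨ cong (x E.* x E.+_) (R.+-identityˡ (y E.* y)) ⟩
    x E.* x E.+ y E.* y                                 ∎
    where open ≡-Reasoning

  ⟦_⟧ : Polynomial → E.Carrier → E.Carrier
  ⟦ []    ⟧ x = E.0#
  ⟦ a ∷ p ⟧ x = ι a E.+ x E.* ⟦ p ⟧ x

  ⟦⟧-⊞ : ∀ p q x → ⟦ p ⊞ q ⟧ x ≡ ⟦ p ⟧ x E.+ ⟦ q ⟧ x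
  ⟦⟧-⊞ []      q       x = sym (R.+-identityˡ _)
  ⟦⟧-⊞ (a ∷ p) []      x = sym (R.+-identityʳ _)
  ⟦⟧-⊞ (a ∷ p) (b ∷ q) x = begin
    ι (a + b) E.+ x E.* ⟦ p ⊞ q ⟧ x
      ≡⟨ cong₂ E._+_ (ι.+-homo a b) (trans (cong (x E.*_) (⟦⟧-⊞ p q x)) (R.distribˡ x _ _)) ⟩
    (ι a E.+ ι b) E.+ (x E.* ⟦ p ⟧ x E.+ x E.* ⟦ q ⟧ x)
      ≡⟨ E-interchange (ι a) (ι b) _ _ ⟩
    (ι a E.+ x E.* ⟦ p ⟧ x) E.+ (ι b E.+ x E.* ⟦ q ⟧ x) ∎
    where open ≡-Reasoning

  ⟦⟧-scale : ∀ c p x → ⟦ List.map (c *_) p ⟧ x ≡ ι c E.* ⟦ p ⟧ x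
  ⟦⟧-scale c []      x = sym (R.zeroʳ (ι c))
  ⟦⟧-scale c (a ∷ p) x = begin
    ι (c * a) E.+ x E.* ⟦ List.map (c *_) p ⟧ x
      ≡⟨ cong₂ E._+_ (ι.*-homo c a) (cong (x E.*_) (⟦⟧-scale c p x)) ⟩
    ι c E.* ι a E.+ x E.* (ι c E.* ⟦ p ⟧ x)
      ≡⟨ cong (ι c E.* ι a E.+_) (trans (sym (R.*-assoc x (ι c) _)) (trans (cong (E._* ⟦ p ⟧ x) (R.*-comm x (ι c))) (R.*-assoc (ι c) x _))) ⟩
    ι c E.* ι a E.+ ι c E.* (x E.* ⟦ p ⟧ x)        ≡⟨ R.distribˡ (ι c) (ι a) _ ⟨
    ι c E.* (ι a E.+ x E.* ⟦ p ⟧ x)                ∎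
    where open ≡-Reasoning

  ⟦⟧-shift : ∀ p x → ⟦ 𝟎 ∷ p ⟧ x ≡ x E.* ⟦ p ⟧ x
  ⟦⟧-shift p x = trans (cong (E._+ x E.* ⟦ p ⟧ x) ι.0#-homo) (R.+-identityˡ _)

  ⟦⟧-⊠ : ∀ p q x → ⟦ p ⊠ q ⟧ x ≡ ⟦ p ⟧ x E.* ⟦ q ⟧ x
  ⟦⟧-⊠ []      q x = sym (R.zeroˡ _)
  ⟦⟧-⊠ (a ∷ p) q x = begin
    ⟦ List.map (a *_) q ⊞ (𝟎 ∷ (p ⊠ q)) ⟧ x                   ≡⟨ ⟦⟧-⊞ (List.map (a *_) q) (𝟎 ∷ (p ⊠ q)) x ⟩
    ⟦ List.map (a *_) q ⟧ x E.+ ⟦ 𝟎 ∷ (p ⊠ q) ⟧ x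
      ≡⟨ cong₂ E._+_ (⟦⟧-scale a q x) (trans (⟦⟧-shift (p ⊠ q) x) (cong (x E.*_) (⟦⟧-⊠ p q x))) ⟩
    ι a E.* ⟦ q ⟧ x E.+ x E.* (⟦ p ⟧ x E.* ⟦ q ⟧ x)
      ≡⟨ cong (ι a E.* ⟦ q ⟧ x E.+_) (R.*-assoc x _ _) ⟨
    ι a E.* ⟦ q ⟧ x E.+ (x E.* ⟦ p ⟧ x) E.* ⟦ q ⟧ x           ≡⟨ R.distribʳ (⟦ q ⟧ x) (ι a) _ ⟨
    (ι a E.+ x E.* ⟦ p ⟧ x) E.* ⟦ q ⟧ x                       ∎
    where open ≡-Reasoning

  -- Squaring maps roots of a polynomial to roots of its conjugate.
  ⟦⟧-square : ∀ p x → ⟦ List.map square p ⟧ (x E.* x) ≡ ⟦ p ⟧ x E.* ⟦ p ⟧ x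
  ⟦⟧-square []      x = sym (R.zeroˡ _)
  ⟦⟧-square (a ∷ p) x = begin
    ι (a * a) E.+ (x E.* x) E.* ⟦ List.map square p ⟧ (x E.* x)
      ≡⟨ cong₂ E._+_ (ι.*-homo a a) (cong ((x E.* x) E.*_) (⟦⟧-square p x)) ⟩
    ι a E.* ι a E.+ (x E.* x) E.* (⟦ p ⟧ x E.* ⟦ p ⟧ x)
      ≡⟨ cong (ι a E.* ι a E.+_) (E-*-interchange x x _ _) ⟩
    ι a E.* ι a E.+ (x E.* ⟦ p ⟧ x) E.* (x E.* ⟦ p ⟧ x)           ≡⟨ square-+ (ι a) _ ⟨
    (ι a E.+ x E.* ⟦ p ⟧ x) E.* (ι a E.+ x E.* ⟦ p ⟧ x)           ∎
    where open ≡-Reasoning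

  ⟦⟧-snoc : ∀ p b x → ⟦ p ++ b ∷ [] ⟧ x ≡ ⟦ p ⟧ x E.+ x E.^ᶠ length p E.* ι b
  ⟦⟧-snoc []      b x = begin
    ι b E.+ x E.* E.0#          ≡⟨ cong (ι b E.+_) (R.zeroʳ x) ⟩
    ι b E.+ E.0#                ≡⟨ R.+-comm (ι b) E.0# ⟩
    E.0# E.+ ι b                ≡⟨ cong (E.0# E.+_) (R.*-identityˡ (ι b)) ⟨
    E.0# E.+ E.1# E.* ι b       ∎
    where open ≡-Reasoning
  ⟦⟧-snoc (a ∷ p) b x = begin
    ι a E.+ x E.* ⟦ p ++ b ∷ [] ⟧ x
      ≡⟨ cong (λ t → ι a E.+ x E.* t) (⟦⟧-snoc p b x) ⟩
    ι a E.+ x E.* (⟦ p ⟧ x E.+ x E.^ᶠ length p E.* ι b)              ≡⟨ cong (ι a E.+_) (R.distribˡ x _ _) ⟩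
    ι a E.+ (x E.* ⟦ p ⟧ x E.+ x E.* (x E.^ᶠ length p E.* ι b))      ≡⟨ R.+-assoc (ι a) _ _ ⟨
    (ι a E.+ x E.* ⟦ p ⟧ x) E.+ x E.* (x E.^ᶠ length p E.* ι b)
      ≡⟨ cong ((ι a E.+ x E.* ⟦ p ⟧ x) E.+_) (R.*-assoc x _ _) ⟨
    (ι a E.+ x E.* ⟦ p ⟧ x) E.+ (x E.* x E.^ᶠ length p) E.* ι b      ∎
    where open ≡-Reasoning

  -- 1 + X¹³ is the product of 1 + X, p and the conjugate of p.
  thirteenth-roots : ∀ c → c E.^ᶠ 13 ≡ E.1# → c ≢ E.1# → ∃[ e ] ⟦ minimal ⟧ e ≡ E.0#
  thirteenth-roots c c¹³≡1 c≢1 =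
    [ (λ r → ⊥-elim (c≢1 (linear r)))
    , (λ r → [ (λ r → c , r) , (λ r → c E.* c , trans (⟦⟧-square conjugate c) (trans (cong (E._* ⟦ conjugate ⟧ c) r) (R.zeroˡ _))) ]′
        (zero-product _ _ (trans (sym (⟦⟧-⊠ minimal conjugate c)) r)))
    ]′ (zero-product _ _ (trans (sym (⟦⟧-⊠ (𝟏 ∷ 𝟏 ∷ []) (minimal ⊠ conjugate) c)) X¹³+1))
    where
    conjugate : Polynomial
    conjugate = List.map square minimal

    linear : ⟦ 𝟏 ∷ 𝟏 ∷ [] ⟧ c ≡ E.0# → c ≡ E.1#
    linear r = sym (sum-zero E.1# c (trans (cong₂ E._+_ (sym ι.1#-homo) eq) r))
      where
      eq : c ≡ c E.* ⟦ 𝟏 ∷ [] ⟧ c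
      eq = trans (sym (R.*-identityʳ c)) (cong (c E.*_) (sym (trans (cong₂ E._+_ ι.1#-homo (R.zeroʳ c)) (R.+-identityʳ E.1#))))

    X¹³+1 : ⟦ (𝟏 ∷ 𝟏 ∷ []) ⊠ (minimal ⊠ conjugate) ⟧ c ≡ E.0#
    X¹³+1 = begin
      ⟦ (𝟏 ∷ List.replicate 12 𝟎) ++ 𝟏 ∷ [] ⟧ c             ≡⟨ ⟦⟧-snoc (𝟏 ∷ List.replicate 12 𝟎) 𝟏 c ⟩
      ⟦ 𝟏 ∷ List.replicate 12 𝟎 ⟧ c E.+ c E.^ᶠ 13 E.* ι 𝟏
        ≡⟨ cong₂ E._+_ (cong (λ t → ι 𝟏 E.+ c E.* t) (zeroes 12)) (cong₂ E._*_ c¹³≡1 ι.1#-homo) ⟩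
      (ι 𝟏 E.+ c E.* E.0#) E.+ E.1# E.* E.1#
        ≡⟨ cong₂ E._+_ (trans (cong₂ E._+_ ι.1#-homo (R.zeroʳ c)) (R.+-identityʳ _)) (R.*-identityʳ _) ⟩
      E.1# E.+ E.1#                                         ≡⟨ double E.1# ⟩
      E.0#                                                  ∎
      where
      open ≡-Reasoning
      zeroes : ∀ n → ⟦ List.replicate n 𝟎 ⟧ c ≡ E.0#
      zeroes zero    = refl
      zeroes (suc n) = trans (⟦⟧-shift (List.replicate n 𝟎) c) (trans (cong (c E.*_) (zeroes n)) (R.zeroʳ c))

-- The model inside the extension field

infix 4 _≟ⱽ_
_≟ⱽ_ : ∀ {n} (u v : V n) → Dec (u ≡ v)
_≟ⱽ_ = Vec.≡-dec _≟_

by-computation : ∀ {n} {u v : V n} {_ : True (u ≟ⱽ v)} → u ≡ v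
by-computation {_} {_} {_} {t} = toWitness t

opaque
  unfolding γ ρ₀ σ₀

  pow-1365 : pow γ 1365 ≡ ω² ∷ 𝟎 ∷ 𝟎 ∷ 𝟎 ∷ 𝟎 ∷ 𝟎 ∷ []
  pow-1365 = by-computation
  pow-819 : pow γ 819 ≡ 𝟎 ∷ ω ∷ 𝟏 ∷ ω² ∷ 𝟎 ∷ ω² ∷ []
  pow-819 = by-computation
  pow-585 : pow γ 585 ≡ 𝟎 ∷ 𝟎 ∷ 𝟏 ∷ 𝟏 ∷ ω ∷ ω² ∷ []
  pow-585 = by-computation
  pow-315 : pow γ 315 ≡ ω ∷ 𝟏 ∷ 𝟎 ∷ ω ∷ ω² ∷ ω² ∷ []
  pow-315 = by-computation
  pow-35 : pow γ 35 ≡ ρ₀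
  pow-35 = by-computation
  pow-7 : pow γ 7 ≡ σ₀
  pow-7 = by-computation
  pow-39 : pow ρ₀ 39 ≡ ω² ⊛ one
  pow-39 = by-computation

module Hill (E : Extension 𝔽₄ 6) where

  open Char2 E public

  -- A ring homomorphism from the model to the extension field that is
  -- τ-semilinear over 𝔽₄.
  record Embedding : Set where
    field
      L     : V 6 → E.Carrier
      τ     : Automorphism
      L-⊕   : ∀ u v → L (u ⊕ v) ≡ L u E.+ L v
      L-⊛   : ∀ c u → L (c ⊛ u) ≡ E.ι (to τ c) E.* L u
      L-⊗   : ∀ u v → L (u ⊗ v) ≡ L u E.* L v
      L-one : L one ≡ E.1#

    L-pow : ∀ u n → L (pow u n) ≡ L u E.^ᶠ n
    L-pow u zero    = L-one
    L-pow u (suc n) = trans (L-⊗ u (pow u n)) (cong (L u E.*_) (L-pow u n))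

    L-𝟘 : L 𝟘 ≡ E.0#
    L-𝟘 = trans (L-⊛ 𝟎 𝟘) (trans (cong (λ c → E.ι c E.* L 𝟘) (to-𝟎 τ))
      (trans (cong (E._* L 𝟘) ι.0#-homo) (R.zeroˡ _)))

  -- Evaluation at a root c of p.
  module _ {c : E.Carrier} (root : ⟦_⟧ minimal c ≡ E.0#) where

    ev : ∀ {n} → V n → E.Carrier
    ev u = ⟦_⟧ (toList u) c

    ev-⊕ : ∀ {n} (u v : V n) → ev (u ⊕ v) ≡ ev u E.+ ev v
    ev-⊕ []      []      = sym (R.+-identityˡ _)
    ev-⊕ (a ∷ u) (b ∷ v) = trans (cong₂ E._+_ (ι.+-homo a b) (trans (cong (c E.*_) (ev-⊕ u v)) (R.distribˡ c _ _)))
      (E-interchange (E.ι a) (E.ι b) _ _)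

    ev-⊛ : ∀ {n} a (u : V n) → ev (a ⊛ u) ≡ E.ι a E.* ev u
    ev-⊛ a u = trans (cong (λ p → ⟦_⟧ p c) (Vec.toList-map (a *_) u)) (⟦⟧-scale a (toList u) c)

    sixth-power : ev reduction ≡ c E.^ᶠ 6
    sixth-power = sum-zero _ _ (trans (cong (ev reduction E.+_) (trans (sym (R.*-identityʳ _)) (cong (c E.^ᶠ 6 E.*_) (sym ι.1#-homo))))
      (trans (sym (⟦⟧-snoc (toList reduction) 𝟏 c)) root))

    ev-shift : ∀ u → ev (shift u) ≡ c E.* ev u
    ev-shift (a₀ ∷ a₁ ∷ a₂ ∷ a₃ ∷ a₄ ∷ f ∷ []) = begin
      ev ((𝟎 ∷ init) ⊕ f ⊛ reduction)                         ≡⟨ ev-⊕ (𝟎 ∷ init) (f ⊛ reduction) ⟩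
      ev (𝟎 ∷ init) E.+ ev (f ⊛ reduction)
        ≡⟨ cong₂ E._+_ (⟦⟧-shift (toList init) c) (trans (ev-⊛ f reduction) (cong (E.ι f E.*_) sixth-power)) ⟩
      c E.* ev init E.+ E.ι f E.* c E.^ᶠ 6
        ≡⟨ cong (c E.* ev init E.+_) (trans (R.*-comm (E.ι f) _) (R.*-assoc c _ _)) ⟩
      c E.* ev init E.+ c E.* (c E.^ᶠ 5 E.* E.ι f)            ≡⟨ R.distribˡ c _ _ ⟨
      c E.* (ev init E.+ c E.^ᶠ 5 E.* E.ι f)                  ≡⟨ cong (c E.*_) (⟦⟧-snoc (toList init) f c) ⟨
      c E.* ev (a₀ ∷ a₁ ∷ a₂ ∷ a₃ ∷ a₄ ∷ f ∷ [])              ∎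
      where
      open ≡-Reasoning
      init : V 5
      init = a₀ ∷ a₁ ∷ a₂ ∷ a₃ ∷ a₄ ∷ []

    ev-𝟘 : ∀ n → ev (𝟘 {n}) ≡ E.0#
    ev-𝟘 zero    = refl
    ev-𝟘 (suc n) = trans (⟦⟧-shift (toList (𝟘 {n})) c) (trans (cong (c E.*_) (ev-𝟘 n)) (R.zeroʳ c))

    ev-⊗ : ∀ {n} (u : V n) (v : V 6) → ev (u ⊗ v) ≡ ev u E.* ev v
    ev-⊗ []      v = trans (ev-𝟘 6) (sym (R.zeroˡ _))
    ev-⊗ (a ∷ u) v = begin
      ev (a ⊛ v ⊕ shift (u ⊗ v))                       ≡⟨ ev-⊕ (a ⊛ v) (shift (u ⊗ v)) ⟩
      ev (a ⊛ v) E.+ ev (shift (u ⊗ v))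
        ≡⟨ cong₂ E._+_ (ev-⊛ a v) (trans (ev-shift (u ⊗ v)) (cong (c E.*_) (ev-⊗ u v))) ⟩
      E.ι a E.* ev v E.+ c E.* (ev u E.* ev v)         ≡⟨ cong (E.ι a E.* ev v E.+_) (R.*-assoc c _ _) ⟨
      E.ι a E.* ev v E.+ (c E.* ev u) E.* ev v         ≡⟨ R.distribʳ (ev v) _ _ ⟨
      (E.ι a E.+ c E.* ev u) E.* ev v                  ∎
      where open ≡-Reasoning

    evaluation : Embedding
    evaluation = record
      { L = ev ; τ = identity ; L-⊕ = ev-⊕ ; L-⊛ = ev-⊛ ; L-⊗ = ev-⊗
      ; L-one = trans (cong₂ E._+_ ι.1#-homo (trans (cong (c E.*_) (ev-𝟘 5)) (R.zeroʳ c))) (R.+-identityʳ _)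
      }

  -- The composite with the Frobenius map.
  squared : Embedding → Embedding
  squared e = record
    { L     = λ u → L u E.* L u
    ; τ     = frobenius τ
    ; L-⊕   = λ u v → trans (cong (λ t → t E.* t) (L-⊕ u v)) (square-+ (L u) (L v))
    ; L-⊛   = λ c u → trans (cong (λ t → t E.* t) (L-⊛ c u)) (trans (E-*-interchange _ _ _ _)
                (cong (E._* (L u E.* L u)) (sym (ι.*-homo (to τ c) (to τ c)))))
    ; L-⊗   = λ u v → trans (cong (λ t → t E.* t) (L-⊗ u v)) (E-*-interchange _ _ _ _)
    ; L-one = trans (cong (λ t → t E.* t) L-one) (R.*-identityˡ _)
    }
    where open Embedding e

  module _ (e : Embedding) where
    open Embedding e

    -- If γⁿ + 1 is a unit in the model, with inverse w, then L γ does not have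
    -- order dividing n.
    ≢1 : ∀ n {v} w → pow γ n ≡ v → w ⊗ (v ⊕ one) ≡ one → L γ E.^ᶠ n ≢ E.1#
    ≢1 n {v} w γⁿ≡v w-inverse γⁿ≡1 = E.1≢0 (begin
      E.1#                      ≡⟨ L-one ⟨
      L one                     ≡⟨ cong L w-inverse ⟨
      L (w ⊗ (v ⊕ one))         ≡⟨ L-⊗ w (v ⊕ one) ⟩
      L w E.* L (v ⊕ one)       ≡⟨ cong (L w E.*_) (L-⊕ v one) ⟩
      L w E.* (L v E.+ L one)
        ≡⟨ cong (L w E.*_) (cong₂ E._+_ (trans (sym (cong L γⁿ≡v)) (trans (L-pow γ n) γⁿ≡1)) L-one) ⟩
      L w E.* (E.1# E.+ E.1#)   ≡⟨ cong (L w E.*_) (double E.1#) ⟩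
      L w E.* E.0#              ≡⟨ R.zeroʳ _ ⟩
      E.0#                      ∎)
      where open ≡-Reasoning

    γ^1365≢1 : L γ E.^ᶠ 1365 ≢ E.1#
    γ^1365≢1 = ≢1 1365 (ω² ∷ 𝟎 ∷ 𝟎 ∷ 𝟎 ∷ 𝟎 ∷ 𝟎 ∷ []) pow-1365 by-computation
    γ^819≢1 : L γ E.^ᶠ 819 ≢ E.1#
    γ^819≢1 = ≢1 819 (ω² ∷ ω² ∷ ω ∷ 𝟏 ∷ 𝟎 ∷ 𝟏 ∷ []) pow-819 by-computation
    γ^585≢1 : L γ E.^ᶠ 585 ≢ E.1#
    γ^585≢1 = ≢1 585 (𝟎 ∷ ω ∷ 𝟎 ∷ 𝟏 ∷ 𝟏 ∷ 𝟏 ∷ []) pow-585 by-computation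
    γ^315≢1 : L γ E.^ᶠ 315 ≢ E.1#
    γ^315≢1 = ≢1 315 (ω ∷ 𝟎 ∷ ω ∷ ω² ∷ ω ∷ ω² ∷ []) pow-315 by-computation

-- Coordinates in which the Hill cap is the explicit list of points

GF4-index : GF4 → Fin 4
GF4-index = GF4-arithmetic.toFin

GF4-index-injective : ∀ {x y} → GF4-index x ≡ GF4-index y → x ≡ y
GF4-index-injective {x} {y} e = trans (sym (GF4-arithmetic.fromFin-toFin x))
  (trans (cong GF4-arithmetic.fromFin e) (GF4-arithmetic.fromFin-toFin y))

index : ∀ {n} → V n → Fin (4 ℕ.^ n)
index []      = zero
index (x ∷ v) = combine (GF4-index x) (index v)

index-injective : ∀ {n} (u v : V n) → index u ≡ index v → u ≡ v
index-injective []      []      e = refl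
index-injective (x ∷ u) (y ∷ v) e with p , q ← Fin.combine-injective (GF4-index x) (index u) (GF4-index y) (index v) e =
  cong₂ _∷_ (GF4-index-injective p) (index-injective u v q)

injective⇒onto : ∀ {n} (f : Fin n → Fin n) → (∀ i j → f i ≡ f j → i ≡ j) → ∀ j → ∃[ i ] f i ≡ j
injective⇒onto {suc n} f inj j with Fin.any? (λ i → f i Fin.≟ j)
... | yes found = found
... | no  none  = contradiction (Fin.injective⇒≤ {f = λ i → Fin.punchOut (λ e → none (i , sym e))}
    (λ {i} {k} e → inj i k (Fin.punchOut-injective (λ e → none (i , sym e)) (λ e → none (k , sym e)) e)))
    ℕ.1+n≰n

-- A map from a set with at most n elements onto a set with exactly n elements
-- is injective.
onto⇒injective : ∀ {n} {A B : Set} (f : A → B) (index : A → Fin n) (index⁻¹ : Fin n → B) →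
  (∀ {a b} → index a ≡ index b → a ≡ b) → (∀ {i j} → index⁻¹ i ≡ index⁻¹ j → i ≡ j) →
  (∀ b → ∃[ i ] index⁻¹ i ≡ b) →
  (∀ b → ∃[ a ] f a ≡ b) → ∀ {a a′} → f a ≡ f a′ → a ≡ a′
onto⇒injective f index index⁻¹ index-inj index⁻¹-inj index⁻¹-onto onto {a} {a′} e =
  trans (sym (section-f a)) (trans (cong section e) (section-f a′))
  where
  section : _ → _
  section b = proj₁ (onto b)
  f-section : ∀ b → f (section b) ≡ b
  f-section b = proj₂ (onto b)
  -- A section of f is injective, hence onto by counting.
  g : Fin _ → Fin _
  g i = index (section (index⁻¹ i))
  g-injective : ∀ i j → g i ≡ g j → i ≡ j
  g-injective i j e = index⁻¹-inj (trans (sym (f-section _)) (trans (cong f (index-inj e)) (f-section _)))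
  section-f : ∀ a → section (f a) ≡ a
  section-f a with i , gi≡a ← injective⇒onto g g-injective (index a) =
    trans (cong section (trans (cong f (sym (index-inj gi≡a))) (f-section _))) (index-inj gi≡a)

module _ {A : Set} (f g : ℕ → A) (n : ℕ) where

  ∈-twoSequencesˡ : ∀ {i} → i < n → f i ∈ twoSequences f g n
  ∈-twoSequencesˡ i<n = ∈-++⁺ˡ (∈-map⁺ f (∈-upTo⁺ i<n))

  ∈-twoSequencesʳ : ∀ {i} → i < n → g i ∈ twoSequences f g n
  ∈-twoSequencesʳ i<n = ∈-++⁺ʳ (List.map f (upTo n)) (∈-map⁺ g (∈-upTo⁺ i<n))

  ∈-twoSequences⁻ : ∀ {x} → x ∈ twoSequences f g n → (∃[ i ] x ≡ f i) ⊎ (∃[ i ] x ≡ g i)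
  ∈-twoSequences⁻ x∈ = [ (λ p → let i , _ , eq = ∈-map⁻ f p in inj₁ (i , eq))
                  , (λ p → let i , _ , eq = ∈-map⁻ g p in inj₂ (i , eq)) ]′
                  (∈-++⁻ (List.map f (upTo n)) x∈)

opaque
  unfolding hill

  power-∈-hill : ∀ {i} → i < 39 → pow ρ₀ i ∈ hill
  power-∈-hill = ∈-twoSequencesˡ (pow ρ₀) coset 39

  coset-∈-hill : ∀ {i} → i < 39 → coset i ∈ hill
  coset-∈-hill = ∈-twoSequencesʳ (pow ρ₀) coset 39

  ∈-hill : ∀ {κ} → κ ∈ hill → (∃[ i ] κ ≡ pow ρ₀ i) ⊎ (∃[ i ] κ ≡ coset i)
  ∈-hill = ∈-twoSequences⁻ (pow ρ₀) coset 39

module HillCoordinates (E : Extension 𝔽₄ 6) (z : Extension.Carrier E)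
  (isPrimitive : IsPrimitiveElement (Extension.K E) z) where

  open Hill E
  open Primitive isPrimitive

  z^4095≡1 : z E.^ᶠ 4095 ≡ E.1#
  z^4095≡1 = order 4095 refl

  z^multiple : ∀ {m} n → m ≡ 4095 ℕ.* n → z E.^ᶠ m ≡ E.1#
  z^multiple n refl = ^-* z 4095 n z^4095≡1

  embedding₀ : Embedding
  embedding₀ = evaluation (proj₂ (thirteenth-roots (z E.^ᶠ 315)
    (trans (Exp.^-assocʳ z 315 13) (z^multiple 1 refl))
    (order-minimal 315 (ℕ.≤ᵇ⇒≤ 317 4096 tt))))

  module Exponent (e : Embedding) where
    open Embedding e

    -- A power of u is a unit of the model, with inverse w.
    unit⇒≢0 : ∀ u m n {v} (w : V 6) → m ≡ suc n → pow u m ≡ v → w ⊗ v ≡ one → L u ≢ E.0#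
    unit⇒≢0 u m n {v} w refl uⁿ≡v unit Lu≡0 = E.1≢0 (begin
      E.1#                          ≡⟨ L-one ⟨
      L one                         ≡⟨ cong L unit ⟨
      L (w ⊗ v)                     ≡⟨ L-⊗ w v ⟩
      L w E.* L v                   ≡⟨ cong (L w E.*_) (trans (cong L (sym uⁿ≡v)) (L-pow u (suc n))) ⟩
      L w E.* (L u E.* L u E.^ᶠ n)  ≡⟨ cong (λ t → L w E.* (t E.* L u E.^ᶠ n)) Lu≡0 ⟩
      L w E.* (E.0# E.* L u E.^ᶠ n) ≡⟨ trans (cong (L w E.*_) (R.zeroˡ _)) (R.zeroʳ _) ⟩
      E.0#                          ∎)
      where open ≡-Reasoning

    Lγ≢0 : L γ ≢ E.0#
    Lγ≢0 = unit⇒≢0 γ 1365 1364 (ω ⊛ one) refl pow-1365 by-computation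

    module _ (k : ℕ) (Lγ≡z^k : L γ ≡ z E.^ᶠ k) where

      -- If q divided k, then (zᵏ)ⁿ would be a power of z⁴⁰⁹⁵ = 1, for q n = 4095.
      ∤ : ∀ q n → q ℕ.* n ≡ 4095 → L γ E.^ᶠ n ≢ E.1# → ¬ q ∣ k
      ∤ q n qn≡4095 ≢1 (divides j refl) = ≢1 (begin
        L γ E.^ᶠ n              ≡⟨ cong (E._^ᶠ n) Lγ≡z^k ⟩
        (z E.^ᶠ (j ℕ.* q)) E.^ᶠ n ≡⟨ Exp.^-assocʳ z (j ℕ.* q) n ⟩
        z E.^ᶠ (j ℕ.* q ℕ.* n)
          ≡⟨ z^multiple j (trans (ℕ.*-assoc j q n) (trans (cong (j ℕ.*_) qn≡4095) (ℕ.*-comm j 4095))) ⟩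
        E.1#                    ∎)
        where open ≡-Reasoning

      5∤k : ¬ 5 ∣ k
      5∤k = ∤ 5 819 refl (γ^819≢1 e)

      coprime-k : Coprime k 4095
      coprime-k =
        coprime-* {k} {3} {1365} 3⊥k
        (coprime-* {k} {3} {455} 3⊥k
        (coprime-* {k} {5} {91} (prime∤⇒coprime (toWitness {a? = prime? 5} tt) 5∤k)
        (coprime-* {k} {7} {13} (prime∤⇒coprime (toWitness {a? = prime? 7} tt) (∤ 7 585 refl (γ^585≢1 e)))
                          (prime∤⇒coprime (toWitness {a? = prime? 13} tt) (∤ 13 315 refl (γ^315≢1 e))))))
        where
        3⊥k : Coprime k 3
        3⊥k = prime∤⇒coprime (toWitness {a? = prime? 3} tt) (∤ 3 1365 refl (γ^1365≢1 e))

      generates : ∃[ l ] z ≡ L γ E.^ᶠ l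
      generates = let l , z≡ = coprime-power-generates z k 4094 z^4095≡1 coprime-k in
        l , trans z≡ (cong (E._^ᶠ l) (sym Lγ≡z^k))

  squared-γ : ∀ (e : Embedding) k → Embedding.L e γ ≡ z E.^ᶠ k →
    Embedding.L (squared e) γ ≡ z E.^ᶠ (k ℕ.+ k)
  squared-γ e k eq = trans (cong₂ E._*_ eq eq) (sym (Exp.^-homo-* z k k))

  -- An embedding that maps γ to a power of z with exponent 1 modulo 5.
  record Adapted : Set where
    field
      embedding : Embedding
      t l       : ℕ
      γ-power   : Embedding.L embedding γ ≡ z E.^ᶠ (1 ℕ.+ 5 ℕ.* t)
      z-power   : z ≡ Embedding.L embedding γ E.^ᶠ l

  adapted-with : ∀ e t → Embedding.L e γ ≡ z E.^ᶠ (1 ℕ.+ 5 ℕ.* t) → Adapted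
  adapted-with e t eq = record
    { embedding = e ; t = t ; l = proj₁ generated ; γ-power = eq ; z-power = proj₂ generated }
    where
    generated = Exponent.generates e (1 ℕ.+ 5 ℕ.* t) eq

  -- Squaring doubles the exponent, and 2 generates the units modulo 5.
  adapt : ∀ (e : Embedding) r m → Embedding.L e γ ≡ z E.^ᶠ (r ℕ.+ m ℕ.* 5) → r < 5 → r ≢ 0 → Adapted
  adapt e 0 m eq _ r≢0 = ⊥-elim (r≢0 refl)
  adapt e 1 m eq _ _ = adapted-with e m (trans eq (cong (λ t → z E.^ᶠ (1 ℕ.+ t)) (ℕ.*-comm m 5)))
  adapt e 2 m eq _ _ = adapted-with (squared (squared (squared e))) (3 ℕ.+ 8 ℕ.* m)
    (trans (squared-γ (squared (squared e)) (r ℕ.+ r ℕ.+ (r ℕ.+ r)) (squared-γ (squared e) (r ℕ.+ r) (squared-γ e r eq))) (cong (z E.^ᶠ_) (arith m)))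
    where
    r = 2 ℕ.+ m ℕ.* 5
    arith : ∀ m → (((2 ℕ.+ m ℕ.* 5) ℕ.+ (2 ℕ.+ m ℕ.* 5)) ℕ.+ ((2 ℕ.+ m ℕ.* 5) ℕ.+ (2 ℕ.+ m ℕ.* 5))) ℕ.+
      (((2 ℕ.+ m ℕ.* 5) ℕ.+ (2 ℕ.+ m ℕ.* 5)) ℕ.+ ((2 ℕ.+ m ℕ.* 5) ℕ.+ (2 ℕ.+ m ℕ.* 5))) ≡ 1 ℕ.+ 5 ℕ.* (3 ℕ.+ 8 ℕ.* m)
    arith = solve-∀
  adapt e 3 m eq _ _ = adapted-with (squared e) (1 ℕ.+ 2 ℕ.* m) (trans (squared-γ e r eq) (cong (z E.^ᶠ_) (arith m)))
    where
    r = 3 ℕ.+ m ℕ.* 5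
    arith : ∀ m → (3 ℕ.+ m ℕ.* 5) ℕ.+ (3 ℕ.+ m ℕ.* 5) ≡ 1 ℕ.+ 5 ℕ.* (1 ℕ.+ 2 ℕ.* m)
    arith = solve-∀
  adapt e 4 m eq _ _ = adapted-with (squared (squared e)) (3 ℕ.+ 4 ℕ.* m)
    (trans (squared-γ (squared e) (r ℕ.+ r) (squared-γ e r eq)) (cong (z E.^ᶠ_) (arith m)))
    where
    r = 4 ℕ.+ m ℕ.* 5
    arith : ∀ m → ((4 ℕ.+ m ℕ.* 5) ℕ.+ (4 ℕ.+ m ℕ.* 5)) ℕ.+ ((4 ℕ.+ m ℕ.* 5) ℕ.+ (4 ℕ.+ m ℕ.* 5)) ≡ 1 ℕ.+ 5 ℕ.* (3 ℕ.+ 4 ℕ.* m)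
    arith = solve-∀
  adapt e (suc (suc (suc (suc (suc r))))) m eq (s≤s (s≤s (s≤s (s≤s (s≤s ()))))) _

  adapted : Adapted
  adapted = adapt embedding₀ (k ℕ.% 5) (k ℕ./ 5) (trans Lγ≡z^k (cong (z E.^ᶠ_) (ℕ.m≡m%n+[m/n]*n k 5)))
    (ℕ.m%n<n k 5) (λ k%5≡0 → 5∤k k Lγ≡z^k (m%n≡0⇒n∣m k 5 k%5≡0))
    where
    open Exponent embedding₀
    k = proj₁ (proj₂ isPrimitive (Embedding.L embedding₀ γ) Lγ≢0)
    Lγ≡z^k = proj₂ (proj₂ isPrimitive (Embedding.L embedding₀ γ) Lγ≢0)

  module Coordinates (a : Adapted) where
    open Adapted a
    open Embedding embedding public

    L-onto : ∀ x → ∃[ u ] L u ≡ x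
    L-onto x = onto (x ≟ᴷ E.0#)
      where
      open ≡-Reasoning
      onto : Dec (x ≡ E.0#) → ∃[ u ] L u ≡ x
      onto (yes x≡0) = 𝟘 , trans L-𝟘 (sym x≡0)
      onto (no  x≢0) = pow γ (l ℕ.* n) , (begin
        L (pow γ (l ℕ.* n))         ≡⟨ L-pow γ (l ℕ.* n) ⟩
        L γ E.^ᶠ (l ℕ.* n)          ≡⟨ Exp.^-assocʳ (L γ) l n ⟨
        (L γ E.^ᶠ l) E.^ᶠ n         ≡⟨ cong (E._^ᶠ n) z-power ⟨
        z E.^ᶠ n                     ≡⟨ proj₂ (proj₂ isPrimitive x x≢0) ⟨
        x                            ∎)
        where
        n = proj₁ (proj₂ isPrimitive x x≢0)

    L-injective : ∀ {u v} → L u ≡ L v → u ≡ v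
    L-injective = onto⇒injective L index (FieldProperties.from E.K) (index-injective _ _)
      (FieldProperties.from-injective E.K) (λ x → FieldProperties.to E.K x , FieldProperties.from-to E.K x) L-onto

    private
      W = L γ
      Z = z E.^ᶠ 35

    Lρ₀ : L ρ₀ ≡ W E.^ᶠ 35
    Lρ₀ = trans (cong L (sym pow-35)) (L-pow γ 35)

    Lσ₀ : L σ₀ ≡ W E.^ᶠ 7
    Lσ₀ = trans (cong L (sym pow-7)) (L-pow γ 7)

    -- W = z z⁵ᵗ.
    power-W : ∀ n → W E.^ᶠ n ≡ z E.^ᶠ n E.* (z E.^ᶠ (5 ℕ.* n)) E.^ᶠ t
    power-W n = begin
      W E.^ᶠ n                                      ≡⟨ cong (E._^ᶠ n) γ-power ⟩
      (z E.^ᶠ (1 ℕ.+ 5 ℕ.* t)) E.^ᶠ n               ≡⟨ Exp.^-assocʳ z (1 ℕ.+ 5 ℕ.* t) n ⟩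
      z E.^ᶠ ((1 ℕ.+ 5 ℕ.* t) ℕ.* n)                ≡⟨ cong (z E.^ᶠ_) (arith t n) ⟩
      z E.^ᶠ (n ℕ.+ 5 ℕ.* n ℕ.* t)                  ≡⟨ Exp.^-homo-* z n (5 ℕ.* n ℕ.* t) ⟩
      z E.^ᶠ n E.* z E.^ᶠ (5 ℕ.* n ℕ.* t)           ≡⟨ cong (z E.^ᶠ n E.*_) (Exp.^-assocʳ z (5 ℕ.* n) t) ⟨
      z E.^ᶠ n E.* (z E.^ᶠ (5 ℕ.* n)) E.^ᶠ t        ∎
      where
      open ≡-Reasoning
      arith : ∀ t n → (1 ℕ.+ 5 ℕ.* t) ℕ.* n ≡ n ℕ.+ 5 ℕ.* n ℕ.* t
      arith = solve-∀

    Lσ₀-z : L σ₀ ≡ z E.^ᶠ 7 E.* Z E.^ᶠ t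
    Lσ₀-z = trans Lσ₀ (power-W 7)

    Lρ₀-z : L ρ₀ ≡ Z E.^ᶠ (1 ℕ.+ 5 ℕ.* t)
    Lρ₀-z = trans Lρ₀ (trans (cong (E._^ᶠ 35) γ-power) (swap-powers z (1 ℕ.+ 5 ℕ.* t) 35))
      where
      swap-powers : ∀ x m n → (x E.^ᶠ m) E.^ᶠ n ≡ (x E.^ᶠ n) E.^ᶠ m
      swap-powers x m n = trans (Exp.^-assocʳ x m n) (trans (cong (x E.^ᶠ_) (ℕ.*-comm m n)) (sym (Exp.^-assocʳ x n m)))

    Z-ρ₀ : Z ≡ L ρ₀ E.^ᶠ l
    Z-ρ₀ = begin
      z E.^ᶠ 35                ≡⟨ cong (E._^ᶠ 35) z-power ⟩
      (W E.^ᶠ l) E.^ᶠ 35       ≡⟨ Exp.^-assocʳ W l 35 ⟩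
      W E.^ᶠ (l ℕ.* 35)        ≡⟨ cong (W E.^ᶠ_) (ℕ.*-comm l 35) ⟩
      W E.^ᶠ (35 ℕ.* l)        ≡⟨ Exp.^-assocʳ W 35 l ⟨
      (W E.^ᶠ 35) E.^ᶠ l       ≡⟨ cong (E._^ᶠ l) Lρ₀ ⟨
      L ρ₀ E.^ᶠ l              ∎
      where open ≡-Reasoning

    -- z⁷ is the product of L σ₀ and Z⁻ᵗ, and Z¹¹⁷ = 1.
    z⁷ : z E.^ᶠ 7 ≡ L σ₀ E.* Z E.^ᶠ (116 ℕ.* t)
    z⁷ = begin
      z E.^ᶠ 7                                             ≡⟨ R.*-identityʳ _ ⟨
      z E.^ᶠ 7 E.* E.1#                                    ≡⟨ cong (z E.^ᶠ 7 E.*_) Z^117t ⟨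
      z E.^ᶠ 7 E.* Z E.^ᶠ (t ℕ.+ 116 ℕ.* t)
        ≡⟨ cong (z E.^ᶠ 7 E.*_) (Exp.^-homo-* Z t (116 ℕ.* t)) ⟩
      z E.^ᶠ 7 E.* (Z E.^ᶠ t E.* Z E.^ᶠ (116 ℕ.* t))       ≡⟨ R.*-assoc _ _ _ ⟨
      (z E.^ᶠ 7 E.* Z E.^ᶠ t) E.* Z E.^ᶠ (116 ℕ.* t)       ≡⟨ cong (E._* Z E.^ᶠ (116 ℕ.* t)) Lσ₀-z ⟨
      L σ₀ E.* Z E.^ᶠ (116 ℕ.* t)                          ∎
      where
      open ≡-Reasoning
      Z^117t : Z E.^ᶠ (117 ℕ.* t) ≡ E.1#
      Z^117t = ^-* Z 117 t (trans (Exp.^-assocʳ z 35 117) z^4095≡1)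

    -- Elements of 𝔽₄, in the form in which the semilinear map L produces them.
    Scalar : E.Carrier → Set
    Scalar x = ∃[ c ] x ≡ E.ι (to τ c)

    scalar-* : ∀ {x y} → Scalar x → Scalar y → Scalar (x E.* y)
    scalar-* (c , p) (d , q) = c * d , trans (cong₂ E._*_ p q) (trans (sym (ι.*-homo _ _)) (cong E.ι (sym (to-* τ c d))))

    scalar-^ : ∀ {x} n → Scalar x → Scalar (x E.^ᶠ n)
    scalar-^ zero    s = 𝟏 , sym (trans (cong E.ι (to-𝟏 τ)) ι.1#-homo)
    scalar-^ (suc n) s = scalar-* s (scalar-^ n s)

    scalar-ρ₀^39 : Scalar (L ρ₀ E.^ᶠ 39)
    scalar-ρ₀^39 = ω² , trans (sym (L-pow ρ₀ 39)) (trans (cong L pow-39) (trans (L-⊛ ω² one)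
      (trans (cong (E.ι (to τ ω²) E.*_) L-one) (R.*-identityʳ _))))

    -- As ρ₀³⁹ is a scalar, every power of ρ₀ is a multiple of one of the first 39.
    reduce-power : ∀ n → ∃[ c ] L ρ₀ E.^ᶠ n ≡ E.ι (to τ c) E.* L (pow ρ₀ (n ℕ.% 39))
    reduce-power n = let c , eq = scalar-^ (n ℕ./ 39) scalar-ρ₀^39 in c , (begin
      L ρ₀ E.^ᶠ n
        ≡⟨ cong (L ρ₀ E.^ᶠ_) (trans (ℕ.m≡m%n+[m/n]*n n 39) (trans (ℕ.+-comm (n ℕ.% 39) _) (cong (ℕ._+ n ℕ.% 39) (ℕ.*-comm (n ℕ./ 39) 39)))) ⟩
      L ρ₀ E.^ᶠ (39 ℕ.* (n ℕ./ 39) ℕ.+ n ℕ.% 39)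
        ≡⟨ Exp.^-homo-* (L ρ₀) (39 ℕ.* (n ℕ./ 39)) (n ℕ.% 39) ⟩
      L ρ₀ E.^ᶠ (39 ℕ.* (n ℕ./ 39)) E.* L ρ₀ E.^ᶠ (n ℕ.% 39)
        ≡⟨ cong₂ E._*_ (trans (sym (Exp.^-assocʳ (L ρ₀) 39 (n ℕ./ 39))) eq) (sym (L-pow ρ₀ (n ℕ.% 39))) ⟩
      E.ι (to τ c) E.* L (pow ρ₀ (n ℕ.% 39))                         ∎)
      where open ≡-Reasoning

    -- x is a multiple of the image of a vector of hill.
    Spanned : E.Carrier → Set
    Spanned x = ∃[ κ ] κ ∈ hill × ∃[ c ] x ≡ E.ι (to τ c) E.* L κ

    first-half : ∀ n → Spanned (L ρ₀ E.^ᶠ n)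
    first-half n = pow ρ₀ (n ℕ.% 39) , power-∈-hill (ℕ.m%n<n n 39) , reduce-power n

    second-half : ∀ n → Spanned (L σ₀ E.* L ρ₀ E.^ᶠ n)
    second-half n = let c , eq = reduce-power n in
      coset (n ℕ.% 39) ,
      coset-∈-hill (ℕ.m%n<n n 39) ,
      c , (begin
      L σ₀ E.* L ρ₀ E.^ᶠ n                                       ≡⟨ cong (L σ₀ E.*_) eq ⟩
      L σ₀ E.* (E.ι (to τ c) E.* L (pow ρ₀ (n ℕ.% 39)))          ≡⟨ R.*-assoc _ _ _ ⟨
      (L σ₀ E.* E.ι (to τ c)) E.* L (pow ρ₀ (n ℕ.% 39))
        ≡⟨ cong (E._* L (pow ρ₀ (n ℕ.% 39))) (R.*-comm _ _) ⟩
      (E.ι (to τ c) E.* L σ₀) E.* L (pow ρ₀ (n ℕ.% 39))          ≡⟨ R.*-assoc _ _ _ ⟩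
      E.ι (to τ c) E.* (L σ₀ E.* L (pow ρ₀ (n ℕ.% 39)))
        ≡⟨ cong (E.ι (to τ c) E.*_) (L-⊗ σ₀ (pow ρ₀ (n ℕ.% 39))) ⟨
      E.ι (to τ c) E.* L (coset (n ℕ.% 39))                ∎)
      where open ≡-Reasoning

    -- The points of the Hill cap of E and z are the images of those of hill; the
    -- other inclusion is hill-in-orbits.
    orbits-spanned : ∀ {x} → HillOrbits E z x → Spanned x
    orbits-spanned (i , inj₁ eq) = subst Spanned
      (sym (trans eq (trans (cong (E._^ᶠ i) Z-ρ₀) (Exp.^-assocʳ (L ρ₀) l i)))) (first-half (l ℕ.* i))
    orbits-spanned (i , inj₂ eq) = subst Spanned (sym (trans eq (begin
      z E.^ᶠ 7 E.* Z E.^ᶠ i                             ≡⟨ cong (E._* Z E.^ᶠ i) z⁷ ⟩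
      (L σ₀ E.* Z E.^ᶠ (116 ℕ.* t)) E.* Z E.^ᶠ i        ≡⟨ R.*-assoc _ _ _ ⟩
      L σ₀ E.* (Z E.^ᶠ (116 ℕ.* t) E.* Z E.^ᶠ i)        ≡⟨ cong (L σ₀ E.*_) (Exp.^-homo-* Z (116 ℕ.* t) i) ⟨
      L σ₀ E.* Z E.^ᶠ (116 ℕ.* t ℕ.+ i)
        ≡⟨ cong (λ y → L σ₀ E.* y E.^ᶠ (116 ℕ.* t ℕ.+ i)) Z-ρ₀ ⟩
      L σ₀ E.* (L ρ₀ E.^ᶠ l) E.^ᶠ (116 ℕ.* t ℕ.+ i)     ≡⟨ cong (L σ₀ E.*_) (Exp.^-assocʳ (L ρ₀) l _) ⟩
      L σ₀ E.* L ρ₀ E.^ᶠ (l ℕ.* (116 ℕ.* t ℕ.+ i))      ∎))) (second-half (l ℕ.* (116 ℕ.* t ℕ.+ i)))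
      where open ≡-Reasoning

    ρ₀-power-orbit : ∀ i → L (pow ρ₀ i) ≡ Z E.^ᶠ ((1 ℕ.+ 5 ℕ.* t) ℕ.* i)
    ρ₀-power-orbit i = trans (L-pow ρ₀ i) (trans (cong (E._^ᶠ i) Lρ₀-z) (Exp.^-assocʳ Z (1 ℕ.+ 5 ℕ.* t) i))

    coset-orbit : ∀ i → L (coset i) ≡ z E.^ᶠ 7 E.* Z E.^ᶠ (t ℕ.+ (1 ℕ.+ 5 ℕ.* t) ℕ.* i)
    coset-orbit i = begin
      L (coset i)                                                    ≡⟨ L-⊗ σ₀ (pow ρ₀ i) ⟩
      L σ₀ E.* L (pow ρ₀ i)                                          ≡⟨ cong₂ E._*_ Lσ₀-z (ρ₀-power-orbit i) ⟩
      (z E.^ᶠ 7 E.* Z E.^ᶠ t) E.* Z E.^ᶠ ((1 ℕ.+ 5 ℕ.* t) ℕ.* i)     ≡⟨ R.*-assoc _ _ _ ⟩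
      z E.^ᶠ 7 E.* (Z E.^ᶠ t E.* Z E.^ᶠ ((1 ℕ.+ 5 ℕ.* t) ℕ.* i))
        ≡⟨ cong (z E.^ᶠ 7 E.*_) (Exp.^-homo-* Z t _) ⟨
      z E.^ᶠ 7 E.* Z E.^ᶠ (t ℕ.+ (1 ℕ.+ 5 ℕ.* t) ℕ.* i)              ∎
      where open ≡-Reasoning

    hill-in-orbits : ∀ {κ} → κ ∈ hill → HillOrbits E z (L κ)
    hill-in-orbits κ∈ =
      [ (λ (i , eq) → (1 ℕ.+ 5 ℕ.* t) ℕ.* i , inj₁ (trans (cong L eq) (ρ₀-power-orbit i)))
      , (λ (i , eq) → t ℕ.+ (1 ℕ.+ 5 ℕ.* t) ℕ.* i , inj₂ (trans (cong L eq) (coset-orbit i)))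
      ]′ (∈-hill κ∈)

-- Linear algebra over 𝔽₄

private
  variable
    n : ℕ

module _ {n : ℕ} where
  open LeftModule (F^ n) public using () renaming
    ( +ᴹ-assoc to ⊕-assoc; +ᴹ-comm to ⊕-comm; +ᴹ-identityˡ to ⊕-identityˡ; +ᴹ-identityʳ to ⊕-identityʳ
    ; *ₗ-zeroˡ to ⊛-zeroˡ; *ₗ-zeroʳ to ⊛-zeroʳ; *ₗ-distribˡ to ⊛-distribˡ; *ₗ-distribʳ to ⊛-distribʳ; *ₗ-assoc to ⊛-assoc)

⊕-self : (u : V n) → u ⊕ u ≡ 𝟘
⊕-self []      = refl
⊕-self (x ∷ u) = cong₂ _∷_ (+-self x) (⊕-self u)

⊕-cancel : (u v : V n) → (u ⊕ v) ⊕ v ≡ u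
⊕-cancel u v = trans (⊕-assoc u v v) (trans (cong (u ⊕_) (⊕-self v)) (⊕-identityʳ u))

⊕≡𝟘⇒≡ : {u v : V n} → u ⊕ v ≡ 𝟘 → u ≡ v
⊕≡𝟘⇒≡ {u = u} {v} e = trans (sym (⊕-cancel u v)) (trans (cong (_⊕ v) e) (⊕-identityˡ v))

⊕-interchange : (a b c d : V n) → (a ⊕ b) ⊕ (c ⊕ d) ≡ (a ⊕ c) ⊕ (b ⊕ d)
⊕-interchange {n} = Interchange.interchange
  where
  module Interchange = Algebra.Properties.CommutativeSemigroup
    (CommutativeMonoid.commutativeSemigroup (LeftModule.+ᴹ-commutativeMonoid (F^ n)))

𝟘-∙ : (u : V n) → 𝟘 ∙ u ≡ 𝟎
𝟘-∙ []      = refl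
𝟘-∙ (x ∷ u) = 𝟘-∙ u

∙-𝟘 : (u : V n) → u ∙ 𝟘 ≡ 𝟎
∙-𝟘 []      = refl
∙-𝟘 (x ∷ u) = cong₂ _+_ (F.zeroʳ x) (∙-𝟘 u)

∙-comm : (u v : V n) → u ∙ v ≡ v ∙ u
∙-comm []      []      = refl
∙-comm (x ∷ u) (y ∷ v) = cong₂ _+_ (F.*-comm x y) (∙-comm u v)

∙-⊛ʳ : ∀ c (u v : V n) → u ∙ (c ⊛ v) ≡ c * (u ∙ v)
∙-⊛ʳ c u v = trans (∙-comm u (c ⊛ v)) (trans (∙-⊛ˡ c v u) (cong (c *_) (∙-comm v u)))

∙-distribˡ : (u v w : V n) → u ∙ (v ⊕ w) ≡ u ∙ v + u ∙ w
∙-distribˡ u v w = trans (∙-comm u (v ⊕ w)) (trans (∙-distribʳ v w u) (cong₂ _+_ (∙-comm v u) (∙-comm w u)))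

inv-⊛ : ∀ c (v : V n) → c ≢ 𝟎 → inv c ⊛ (c ⊛ v) ≡ v
inv-⊛ c []      n = refl
inv-⊛ c (x ∷ v) n = cong₂ _∷_ (undo c x n) (inv-⊛ c v n)
  where
  undo : ∀ c x → c ≢ 𝟎 → inv c * (c * x) ≡ x
  undo 𝟎  x n = ⊥-elim (n refl)
  undo 𝟏  x n = refl
  undo ω  x n = check₁ {λ x → ω² * (ω * x)} {λ x → x} x
  undo ω² x n = check₁ {λ x → ω * (ω² * x)} {λ x → x} x

any-scalar? : {P : GF4 → Set} → (∀ c → Dec (P c)) → Dec (∃[ c ] P c)
any-scalar? {P} P? with P? 𝟎 | P? 𝟏 | P? ω | P? ω²
... | yes p | _     | _     | _     = yes (𝟎 , p)
... | no _  | yes p | _     | _     = yes (𝟏 , p)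
... | no _  | no _  | yes p | _     = yes (ω , p)
... | no _  | no _  | no _  | yes p = yes (ω² , p)
... | no p  | no q  | no r  | no s  = no λ
  { (𝟎 , x) → p x ; (𝟏 , x) → q x ; (ω , x) → r x ; (ω² , x) → s x }

any-vector? : {P : V n → Set} → (∀ v → Dec (P v)) → Dec (∃[ v ] P v)
any-vector? {zero}  P? = map′ (λ p → [] , p) (λ { ([] , p) → p }) (P? [])
any-vector? {suc n} P? = map′ (λ (c , v , p) → c ∷ v , p) (λ { (c ∷ v , p) → c , v , p })
  (any-scalar? λ c → any-vector? λ v → P? (c ∷ v))

unindex : ∀ n → Fin (4 ℕ.^ n) → V n
unindex zero    i = []
unindex (suc n) i = let c , j = remQuot {4} (4 ℕ.^ n) i in GF4-arithmetic.fromFin c ∷ unindex n j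

index-unindex : ∀ n i → index (unindex n i) ≡ i
index-unindex zero    Fin.zero = refl
index-unindex (suc n) i = trans
  (cong₂ combine (GF4-arithmetic.toFin-fromFin (proj₁ split)) (index-unindex n (proj₂ split)))
  (Fin.combine-remQuot {4} (4 ℕ.^ n) i)
  where
  split = remQuot {4} (4 ℕ.^ n) i

unindex-injective : ∀ n {i j} → unindex n i ≡ unindex n j → i ≡ j
unindex-injective n {i} {j} e = trans (sym (index-unindex n i)) (trans (cong index e) (index-unindex n j))

injective-endomap⇒onto : (f : V n → V n) → (∀ {u v} → f u ≡ f v → u ≡ v) → ∀ v → ∃[ u ] f u ≡ v
injective-endomap⇒onto {n} f inj v =
  let i , e = injective⇒onto (index ∘ f ∘ unindex n)
                (λ i j e → unindex-injective n (inj (index-injective _ _ e))) (index v)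
  in unindex n i , index-injective _ _ e

-- A linear parametrisation of the kernel of the functional a.
record Kernel {n : ℕ} (a : V (suc n)) : Set where
  field
    κ        : V n → V (suc n)
    κ-⊕      : ∀ c d → κ (c ⊕ d) ≡ κ c ⊕ κ d
    κ-⊛      : ∀ k c → κ (k ⊛ c) ≡ k ⊛ κ c
    κ-kernel : ∀ c → κ c ≡ 𝟘 → c ≡ 𝟘
    κ-⊥      : ∀ c → a ∙ κ c ≡ 𝟎
    κ-onto   : ∀ v → a ∙ v ≡ 𝟎 → ∃[ c ] κ c ≡ v

-- A nonzero functional takes the value 𝟏.
unit-functional : (a : V n) → a ≢ 𝟘 → ∃[ w ] a ∙ w ≡ 𝟏
unit-functional []      a≢0 = ⊥-elim (a≢0 refl)
unit-functional (x ∷ a) a≢0 with x ≟ 𝟎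
... | no  x≢0 = inv x ∷ 𝟘 , trans (cong (x * inv x +_) (∙-𝟘 a)) (trans (F.+-identityʳ _) (x*inv x x≢0))
  where
  x*inv : ∀ x → x ≢ 𝟎 → x * inv x ≡ 𝟏
  x*inv 𝟎  n = ⊥-elim (n refl)
  x*inv 𝟏  n = refl
  x*inv ω  n = refl
  x*inv ω² n = refl
... | yes refl = let w , e = unit-functional a (λ a≡0 → a≢0 (cong (𝟎 ∷_) a≡0)) in 𝟎 ∷ w , e

tail-injective : ∀ {x y} {u v : V n} → x ∷ u ≡ y ∷ v → u ≡ v
tail-injective refl = refl

-- If the functional is (x, a) with a = 0, then its kernel is 0 × 𝔽₄ⁿ.
-- Otherwise a ∙ w = 1 for some w, and the kernel consists of the vectors
-- (c, k + c x w) with k in the kernel of a.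
kernel : (a : V (suc n)) → a ≢ 𝟘 → Kernel a
kernel {n} (x ∷ a) xa≢0 with a ≟ⱽ 𝟘
kernel {n} (x ∷ .𝟘) xa≢0 | yes refl = record
  { κ        = 𝟎 ∷_
  ; κ-⊕      = λ _ _ → refl
  ; κ-⊛      = λ k c → cong (_∷ k ⊛ c) (sym (F.zeroʳ k))
  ; κ-kernel = λ c e → tail-injective e
  ; κ-⊥      = λ c → cong₂ _+_ (F.zeroʳ x) (𝟘-∙ c)
  ; κ-onto   = onto
  }
  where
  x≢0 : x ≢ 𝟎
  x≢0 refl = xa≢0 refl
  onto : ∀ v → (x ∷ 𝟘) ∙ v ≡ 𝟎 → ∃[ c ] 𝟎 ∷ c ≡ v
  onto (y ∷ v) e = v , cong (_∷ v) (sym (cancel x y x≢0 (trans (sym (F.+-identityʳ (x * y))) (trans (cong (x * y +_) (sym (𝟘-∙ v))) e))))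
    where
    cancel : ∀ x y → x ≢ 𝟎 → x * y ≡ 𝟎 → y ≡ 𝟎
    cancel 𝟎  y n e = ⊥-elim (n refl)
    cancel 𝟏  y n e = e
    cancel ω  𝟎 n e = refl
    cancel ω² 𝟎 n e = refl
kernel {zero}  (x ∷ []) xa≢0 | no a≢0 = ⊥-elim (a≢0 refl)
kernel {suc n} (x ∷ a)  xa≢0 | no a≢0 = record
  { κ        = k
  ; κ-⊕      = λ { (c ∷ cs) (d ∷ ds) → cong ((c + d) ∷_) (trans (cong₂ _⊕_ (κ-⊕ cs ds) (⊛-distribʳ xw c d))
                   (⊕-interchange (κ cs) (κ ds) (c ⊛ xw) (d ⊛ xw))) }
  ; κ-⊛      = λ { l (c ∷ cs) → cong (l * c ∷_) (trans (cong₂ _⊕_ (κ-⊛ l cs) (⊛-assoc l c xw)) (sym (⊛-distribˡ l (κ cs) (c ⊛ xw)))) }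
  ; κ-kernel = λ { (c ∷ cs) e → trivial c cs (cong Vec.head e) (tail-injective e) }
  ; κ-⊥      = λ { (c ∷ cs) → orth c cs }
  ; κ-onto   = onto
  }
  where
  open Kernel (kernel a a≢0)
  w = proj₁ (unit-functional a a≢0)
  xw = x ⊛ w
  a∙xw : a ∙ xw ≡ x
  a∙xw = trans (∙-⊛ʳ x a w) (trans (cong (x *_) (proj₂ (unit-functional a a≢0))) (F.*-identityʳ x))
  k : V (suc n) → V (suc (suc n))
  k (c ∷ cs) = c ∷ (κ cs ⊕ c ⊛ xw)
  trivial : ∀ c cs → c ≡ 𝟎 → κ cs ⊕ c ⊛ xw ≡ 𝟘 → c ∷ cs ≡ 𝟘
  trivial c cs refl e = cong (𝟎 ∷_) (κ-kernel cs (trans (sym (trans (cong (κ cs ⊕_) (⊛-zeroˡ xw)) (⊕-identityʳ (κ cs)))) e))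
  orth : ∀ c cs → x * c + a ∙ (κ cs ⊕ c ⊛ xw) ≡ 𝟎
  orth c cs = trans (cong (x * c +_) (trans (∙-distribˡ a (κ cs) (c ⊛ xw)) (cong₂ _+_ (κ-⊥ cs)
    (trans (∙-⊛ʳ c a xw) (trans (cong (c *_) a∙xw) (F.*-comm c x)))))) (+-self (x * c))
  onto : ∀ v → (x ∷ a) ∙ v ≡ 𝟎 → ∃[ c ] k c ≡ v
  onto (c ∷ v) e = c ∷ proj₁ found , cong (c ∷_) (trans (cong (_⊕ c ⊛ xw) (proj₂ found)) (⊕-cancel v (c ⊛ xw)))
    where
    found : ∃[ cs ] κ cs ≡ v ⊕ c ⊛ xw
    found = κ-onto (v ⊕ c ⊛ xw) (begin
      a ∙ (v ⊕ c ⊛ xw)          ≡⟨ ∙-distribˡ a v (c ⊛ xw) ⟩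
      a ∙ v + a ∙ (c ⊛ xw)
        ≡⟨ cong (a ∙ v +_) (trans (∙-⊛ʳ c a xw) (trans (cong (c *_) a∙xw) (F.*-comm c x))) ⟩
      a ∙ v + x * c             ≡⟨ F.+-comm (a ∙ v) (x * c) ⟩
      x * c + a ∙ v             ≡⟨ e ⟩
      𝟎                         ∎)
      where open ≡-Reasoning

-- The image of an injective ρ-semilinear map, as a subspace.
module SemilinearImage (ρ : Automorphism) {m : ℕ} where

  -- The images of the unit vectors.
  basisOf : ∀ n → (V n → V m) → Vec (V m) n
  basisOf zero    κ = []
  basisOf (suc n) κ = κ (𝟏 ∷ 𝟘) ∷ basisOf n (κ ∘ (𝟎 ∷_))

  lincomb-basisOf : ∀ n (κ : V n → V m) → (∀ c d → κ (c ⊕ d) ≡ κ c ⊕ κ d) →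
    (∀ k c → κ (k ⊛ c) ≡ to ρ k ⊛ κ c) → ∀ cs → lincomb (F^ m) (Vec.map (to ρ) cs) (basisOf n κ) ≡ κ cs
  lincomb-basisOf zero    κ add scale [] = sym (trans (scale 𝟎 []) (trans (cong (_⊛ κ []) (to-𝟎 ρ)) (⊛-zeroˡ (κ []))))
  lincomb-basisOf (suc n) κ add scale (c ∷ cs) = begin
    to ρ c ⊛ κ (𝟏 ∷ 𝟘) ⊕ lincomb (F^ m) (Vec.map (to ρ) cs) (basisOf n (κ ∘ (𝟎 ∷_)))
      ≡⟨ cong₂ _⊕_ (sym (scale c (𝟏 ∷ 𝟘))) (lincomb-basisOf n (κ ∘ (𝟎 ∷_)) (λ c d → add (𝟎 ∷ c) (𝟎 ∷ d))
           (λ k c → trans (cong (λ t → κ (t ∷ k ⊛ c)) (sym (F.zeroʳ k))) (scale k (𝟎 ∷ c))) cs) ⟩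
    κ (c ⊛ (𝟏 ∷ 𝟘)) ⊕ κ (𝟎 ∷ cs)
      ≡⟨ add (c ⊛ (𝟏 ∷ 𝟘)) (𝟎 ∷ cs) ⟨
    κ (c ⊛ (𝟏 ∷ 𝟘) ⊕ (𝟎 ∷ cs))
      ≡⟨ cong₂ (λ t u → κ (t ∷ u)) (trans (F.+-identityʳ _) (F.*-identityʳ c)) (trans (cong (_⊕ cs) (⊛-zeroʳ c)) (⊕-identityˡ cs)) ⟩
    κ (c ∷ cs) ∎
    where open ≡-Reasoning

  module _ {n : ℕ} (κ : V n → V m) (κ-⊕ : ∀ c d → κ (c ⊕ d) ≡ κ c ⊕ κ d)
    (κ-⊛ : ∀ k c → κ (k ⊛ c) ≡ to ρ k ⊛ κ c) (κ-kernel : ∀ c → κ c ≡ 𝟘 → c ≡ 𝟘) where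

    private
      map-to-from : ∀ {n} (cs : V n) → Vec.map (to ρ) (Vec.map (from ρ) cs) ≡ cs
      map-to-from []       = refl
      map-to-from (c ∷ cs) = cong₂ _∷_ (to-from ρ c) (map-to-from cs)

      map-to-𝟘 : ∀ n → Vec.map (to ρ) (𝟘 {n}) ≡ 𝟘
      map-to-𝟘 zero    = refl
      map-to-𝟘 (suc n) = cong₂ _∷_ (to-𝟎 ρ) (map-to-𝟘 n)

      combination : ∀ cs → lincomb (F^ m) cs (basisOf n κ) ≡ κ (Vec.map (from ρ) cs)
      combination cs = trans (cong (λ ds → lincomb (F^ m) ds (basisOf n κ)) (sym (map-to-from cs)))
        (lincomb-basisOf n κ κ-⊕ κ-⊛ (Vec.map (from ρ) cs))

    image : Subspace (F^ m) n
    image = record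
      { basis       = basisOf n κ
      ; independent = λ cs e → trans (sym (map-to-from cs)) (trans (cong (Vec.map (to ρ))
          (κ-kernel (Vec.map (from ρ) cs) (trans (sym (combination cs)) e))) (map-to-𝟘 n))
      }

    image⁻ : ∀ v → Subspace.Contains image v → ∃[ c ] κ c ≡ v
    image⁻ v (cs , e) = Vec.map (from ρ) cs , sym (trans e (combination cs))

    image⁺ : ∀ c v → κ c ≡ v → Subspace.Contains image v
    image⁺ c v e = Vec.map (to ρ) c , trans (sym e) (sym (lincomb-basisOf n κ κ-⊕ κ-⊛ c))

-- A ρ-semilinear change of coordinates Ψ turns the kernel of the functional a
-- into a hyperplane.
module SemilinearCoordinates (ρ : Automorphism) {n : ℕ} (Ψ Ψ⁻¹ : V (suc n) → V (suc n))
  (Ψ-⊕ : ∀ v w → Ψ (v ⊕ w) ≡ Ψ v ⊕ Ψ w) (Ψ-⊛ : ∀ c v → Ψ (c ⊛ v) ≡ to ρ c ⊛ Ψ v)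
  (Ψ-kernel : ∀ v → Ψ v ≡ 𝟘 → v ≡ 𝟘)
  (Ψ-Ψ⁻¹ : ∀ v → Ψ (Ψ⁻¹ v) ≡ v) (Ψ⁻¹-Ψ : ∀ v → Ψ⁻¹ (Ψ v) ≡ v)
  (a : V (suc n)) (a≢0 : a ≢ 𝟘) where

  open Kernel (kernel a a≢0)

  private
    module Image = SemilinearImage ρ {suc n}

    Θ : V n → V (suc n)
    Θ c = Ψ (κ c)

    Θ-⊕ : ∀ c d → Θ (c ⊕ d) ≡ Θ c ⊕ Θ d
    Θ-⊕ c d = trans (cong Ψ (κ-⊕ c d)) (Ψ-⊕ (κ c) (κ d))

    Θ-⊛ : ∀ k c → Θ (k ⊛ c) ≡ to ρ k ⊛ Θ c
    Θ-⊛ k c = trans (cong Ψ (κ-⊛ k c)) (Ψ-⊛ k (κ c))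

    Θ-kernel : ∀ c → Θ c ≡ 𝟘 → c ≡ 𝟘
    Θ-kernel c e = κ-kernel c (Ψ-kernel (κ c) e)

  hyperplane : Hyperplane n
  hyperplane = Image.image Θ Θ-⊕ Θ-⊛ Θ-kernel

  hyperplane⇒equation : ∀ v → Subspace.Contains hyperplane v → a ∙ Ψ⁻¹ v ≡ 𝟎
  hyperplane⇒equation v inside = trans (cong (λ w → a ∙ Ψ⁻¹ w) (sym (proj₂ preimage-of-v)))
    (trans (cong (a ∙_) (Ψ⁻¹-Ψ (κ (proj₁ preimage-of-v)))) (κ-⊥ (proj₁ preimage-of-v)))
    where
    preimage-of-v : ∃[ c ] Θ c ≡ v
    preimage-of-v = Image.image⁻ Θ Θ-⊕ Θ-⊛ Θ-kernel v inside

  equation⇒hyperplane : ∀ v → a ∙ Ψ⁻¹ v ≡ 𝟎 → Subspace.Contains hyperplane v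
  equation⇒hyperplane v e = Image.image⁺ Θ Θ-⊕ Θ-⊛ Θ-kernel (proj₁ solution) v
    (trans (cong Ψ (proj₂ solution)) (Ψ-Ψ⁻¹ v))
    where
    solution : ∃[ c ] κ c ≡ Ψ⁻¹ v
    solution = κ-onto (Ψ⁻¹ v) e

-- An enumeration of the zeros of test ∘ f.
zeros-enumerated : ∀ {A : Set} (test : A → GF4) {n} (f : Fin n → A) →
  Σ[ e ∈ (Fin (sumL (λ x → δ (test x) 𝟎) (tabulate f)) → Fin n) ]
    (∀ j → test (f (e j)) ≡ 𝟎) × (∀ i j → e i ≡ e j → i ≡ j) × (∀ i → test (f i) ≡ 𝟎 → ∃[ j ] e j ≡ i)
zeros-enumerated test {zero}  f = (λ ()) , (λ ()) , (λ ()) , (λ ())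
zeros-enumerated test {suc n} f with test (f zero) in eq | zeros-enumerated test (f ∘ suc)
... | 𝟎 | e , zero-at , inj , onto = e′ , zero-at′ , inj′ , onto′
  where
  e′ : Fin (suc (sumL (λ x → δ (test x) 𝟎) (tabulate (f ∘ suc)))) → Fin (suc n)
  e′ zero    = zero
  e′ (suc j) = suc (e j)
  zero-at′ : ∀ j → test (f (e′ j)) ≡ 𝟎
  zero-at′ zero    = eq
  zero-at′ (suc j) = zero-at j
  inj′ : ∀ i j → e′ i ≡ e′ j → i ≡ j
  inj′ zero    zero    _ = refl
  inj′ (suc i) (suc j) p = cong suc (inj i j (Fin.suc-injective p))
  onto′ : ∀ i → test (f i) ≡ 𝟎 → ∃[ j ] e′ j ≡ i
  onto′ zero    _ = zero , refl
  onto′ (suc i) p = let j , q = onto i p in suc j , cong suc q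
... | 𝟏 | e , zero-at , inj , onto = suc ∘ e , zero-at , (λ i j p → inj i j (Fin.suc-injective p)) ,
  λ { zero p → case trans (sym eq) p of λ () ; (suc i) p → let j , q = onto i p in j , cong suc q }
... | ω | e , zero-at , inj , onto = suc ∘ e , zero-at , (λ i j p → inj i j (Fin.suc-injective p)) ,
  λ { zero p → case trans (sym eq) p of λ () ; (suc i) p → let j , q = onto i p in j , cong suc q }
... | ω² | e , zero-at , inj , onto = suc ∘ e , zero-at , (λ i j p → inj i j (Fin.suc-injective p)) ,
  λ { zero p → case trans (sym eq) p of λ () ; (suc i) p → let j , q = onto i p in j , cong suc q }

module _ {A : Set} {P : A → Set} (P? : ∀ x → Dec (P x)) where

  sum-indicator-none : ∀ {xs} → All (¬_ ∘ P) xs → sumL (λ x → indicator (P? x)) xs ≡ 0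
  sum-indicator-none [] = refl
  sum-indicator-none {x ∷ xs} (¬p ∷ ¬ps) with P? x
  ... | yes p = ⊥-elim (¬p p)
  ... | no  _ = sum-indicator-none ¬ps

  sum-indicator-unique : ∀ {xs} → AllPairs (λ x y → ¬ (P x × P y)) xs → ∀ {x} → x ∈ xs → P x →
    sumL (λ x → indicator (P? x)) xs ≡ 1
  sum-indicator-unique {x ∷ xs} (apart ∷ rest) x∈ px with P? x
  ... | yes p = cong suc (sum-indicator-none (All.map (λ ¬both q → ¬both (p , q)) apart))
  sum-indicator-unique {x ∷ xs} (apart ∷ rest) (here refl) px | no ¬p = ⊥-elim (¬p px)
  sum-indicator-unique {x ∷ xs} (apart ∷ rest) (there x∈)  px | no ¬p = sum-indicator-unique rest x∈ px

-- Comparing the points at infinity with the Hill cap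

-- u lies in the span of v.
Multiple : ∀ {n} → V n → V n → Set
Multiple u v = ∃[ c ] u ≡ c ⊛ v

multiple? : ∀ {n} (u v : V n) → Dec (Multiple u v)
multiple? u v = any-scalar? λ c → u ≟ⱽ c ⊛ v

coefficient≢0 : ∀ {n} {u v : V n} {c} → u ≢ 𝟘 → u ≡ c ⊛ v → c ≢ 𝟎
coefficient≢0 {v = v} u≢0 e refl = u≢0 (trans e (⊛-zeroˡ v))

-- Two vectors with a common nonzero multiple are proportional.
multiple-transfer : ∀ {n} {w u v : V n} → w ≢ 𝟘 → Multiple w u → Multiple w v → Multiple u v
multiple-transfer {w = w} {u} {v} w≢0 (c , e) (d , e′) = inv c * d ,
  (begin
    u                   ≡⟨ inv-⊛ c u (coefficient≢0 w≢0 e) ⟨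
    inv c ⊛ (c ⊛ u)     ≡⟨ cong (inv c ⊛_) (trans (sym e) e′) ⟩
    inv c ⊛ (d ⊛ v)     ≡⟨ ⊛-assoc (inv c) d v ⟨
    (inv c * d) ⊛ v     ∎)
  where open ≡-Reasoning

multiple-sym : ∀ {n} {u v : V n} → u ≢ 𝟘 → Multiple u v → Multiple v u
multiple-sym {u = u} u≢0 m = multiple-transfer u≢0 m (𝟏 , sym (⊛-identity u))

witness : {A : Set} (d : Dec A) → does d ≡ true → A
witness (yes a) _ = a

opaque
  unfolding hill ρ₀ σ₀

  hill-apart : AllPairs (λ u v → ¬ Multiple u v) hill
  hill-apart = witness (allPairs? (λ u v → ¬? (multiple? u v)) hill) refl

  hill-nonzero : All (_≢ 𝟘) hill
  hill-nonzero = All.map (λ {v} → nonzero⇒≢0 v) (all-true nonzero hill refl)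

  hill-length : length hill ≡ 78
  hill-length = refl

-- qs represents the points of C, and ks those of its section at infinity, where
-- the first coordinate is zero.  Points at infinity of qs and vectors of ks are
-- matched by proportionality.
module DoubleCounting (ks : List (V 6)) (qs : List (V 7))
  (ks-apart  : AllPairs (λ u v → ¬ Multiple u v) ks)
  (qs≢0      : All (_≢ 𝟘) qs)
  (qs-apart  : AllPairs (λ u v → ¬ Multiple u v) qs)
  (ks≢0      : All (_≢ 𝟘) ks)
  (represent : ∀ {u} → 𝟎 ∷ u ∈ qs → ∃[ κ ] κ ∈ ks × Multiple (𝟎 ∷ u) (𝟎 ∷ κ))
  (represented : ∀ {κ} → κ ∈ ks → ∃[ w ] w ∈ qs × Multiple w (𝟎 ∷ κ)) where

  private
    -- The incidence matrix of the matching.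
    M : V 7 → V 6 → ℕ
    M w κ = indicator (multiple? w (𝟎 ∷ κ))

    drop : ∀ {u v : V 6} → Multiple (𝟎 ∷ u) (𝟎 ∷ v) → Multiple u v
    drop (c , e) = c , tail-injective e

    row : ∀ {w} → w ∈ qs → w ≢ 𝟘 → sumL (M w) ks ≡ δ (head w) 𝟎
    row {l ∷ u} w∈ w≢0 = by-cases (l ≟ 𝟎)
      where
      δ≢ : ∀ l → l ≢ 𝟎 → δ l 𝟎 ≡ 0
      δ≢ 𝟎  n = ⊥-elim (n refl)
      δ≢ 𝟏  n = refl
      δ≢ ω  n = refl
      δ≢ ω² n = refl
      by-cases : Dec (l ≡ 𝟎) → sumL (M (l ∷ u)) ks ≡ δ l 𝟎
      by-cases (yes refl) = let κ , κ∈ , m = represent w∈ in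
        sum-indicator-unique (λ κ → multiple? (𝟎 ∷ u) (𝟎 ∷ κ))
          (AllPairs.map (λ apart (m , m′) → apart (drop (multiple-transfer w≢0 m m′))) ks-apart) κ∈ m
      by-cases (no l≢0) = trans (sum-indicator-none (λ κ → multiple? (l ∷ u) (𝟎 ∷ κ)) {ks}
        (All.tabulate λ _ (c , e) → l≢0 (trans (cong head e) (F.zeroʳ c)))) (sym (δ≢ l l≢0))

    0∷≢0 : ∀ {κ : V 6} → κ ≢ 𝟘 → 𝟎 ∷ κ ≢ 𝟘
    0∷≢0 κ≢0 e = κ≢0 (tail-injective e)

    column : ∀ {κ} → κ ∈ ks → sumL (λ w → M w κ) qs ≡ 1
    column {κ} κ∈ = let w , w∈ , m = represented κ∈ in
      sum-indicator-unique (λ w → multiple? w (𝟎 ∷ κ)) (separate qs≢0 qs-apart) w∈ m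
      where
      separate : ∀ {ws} → All (_≢ 𝟘) ws → AllPairs (λ u v → ¬ Multiple u v) ws →
        AllPairs (λ u v → ¬ (Multiple u (𝟎 ∷ κ) × Multiple v (𝟎 ∷ κ))) ws
      separate [] [] = []
      separate (u≢0 ∷ ws≢0) (apart ∷ rest) =
        All.zipWith (λ (v≢0 , ¬m) (m , m′) → ¬m (multiple-transfer (0∷≢0 (All.lookup ks≢0 κ∈))
          (multiple-sym u≢0 m) (multiple-sym v≢0 m′))) (ws≢0 , apart) ∷ separate ws≢0 rest

  -- Sums over the points at infinity may be taken over ks.
  count-infinite : (f : V 7 → ℕ) (g : V 6 → ℕ) →
    (∀ {w κ} → w ≢ 𝟘 → Multiple w (𝟎 ∷ κ) → f w ≡ g κ) →
    sumL (λ w → δ (head w) 𝟎 ℕ.* f w) qs ≡ sumL g ks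
  count-infinite f g agree = begin
    sumL (λ w → δ (head w) 𝟎 ℕ.* f w) qs
      ≡⟨ sumL-congAll (λ w (w∈ , w≢0) → trans (ℕ.*-comm (δ (head w) 𝟎) (f w)) (cong (f w ℕ.*_) (sym (row w∈ w≢0)))) members ⟩
    sumL (λ w → f w ℕ.* sumL (M w) ks) qs
      ≡⟨ sumL-cong (λ w → sumL-* (f w) (M w) ks) qs ⟨
    sumL (λ w → sumL (λ κ → f w ℕ.* M w κ) ks) qs
      ≡⟨ sumL-congAll (λ w w≢0 → sumL-cong (λ κ → exchange w κ w≢0) ks) qs≢0 ⟩
    sumL (λ w → sumL (λ κ → g κ ℕ.* M w κ) ks) qs
      ≡⟨ sumL-swap (λ w κ → g κ ℕ.* M w κ) qs ks ⟩
    sumL (λ κ → sumL (λ w → g κ ℕ.* M w κ) qs) ks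
      ≡⟨ sumL-cong (λ κ → sumL-* (g κ) (λ w → M w κ) qs) ks ⟩
    sumL (λ κ → g κ ℕ.* sumL (λ w → M w κ) qs) ks
      ≡⟨ sumL-congAll (λ κ κ∈ → trans (cong (g κ ℕ.*_) (column κ∈)) (ℕ.*-identityʳ (g κ))) (All.tabulate λ κ∈ → κ∈) ⟩
    sumL g ks ∎
    where
    open ≡-Reasoning
    members : All (λ w → w ∈ qs × w ≢ 𝟘) qs
    members = All.tabulate λ w∈ → w∈ , All.lookup qs≢0 w∈
    exchange : ∀ w κ → w ≢ 𝟘 → f w ℕ.* M w κ ≡ g κ ℕ.* M w κ
    exchange w κ w≢0 with multiple? w (𝟎 ∷ κ)
    ... | yes m = cong (ℕ._* 1) (agree w≢0 m)
    ... | no  _ = trans (ℕ.*-zeroʳ (f w)) (sym (ℕ.*-zeroʳ (g κ)))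

-- The vectors not at infinity, scaled to first coordinate 𝟏, which is dropped.
affine : List (V 7) → List (V 6)
affine []             = []
affine ((𝟎  ∷ u) ∷ ws) = affine ws
affine ((𝟏  ∷ u) ∷ ws) = u ∷ affine ws
affine ((ω  ∷ u) ∷ ws) = ω² ⊛ u ∷ affine ws
affine ((ω² ∷ u) ∷ ws) = ω ⊛ u ∷ affine ws

length-affine : ∀ ws → sumL (λ w → δ (head w) 𝟎) ws ℕ.+ length (affine ws) ≡ length ws
length-affine []              = refl
length-affine ((𝟎  ∷ u) ∷ ws) = cong suc (length-affine ws)
length-affine ((𝟏  ∷ u) ∷ ws) = trans (ℕ.+-suc _ _) (cong suc (length-affine ws))
length-affine ((ω  ∷ u) ∷ ws) = trans (ℕ.+-suc _ _) (cong suc (length-affine ws))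
length-affine ((ω² ∷ u) ∷ ws) = trans (ℕ.+-suc _ _) (cong suc (length-affine ws))

-- The hyperplane with functional (b, a) meets infinity in the kernel of a, and
-- the affine part in  a ∙ x = b  (the signs do not matter in characteristic
-- two).
split-size : ∀ b (a : V 6) ws → sumL (λ w → δ ((b ∷ a) ∙ w) 𝟎) ws ≡
  sumL (λ w → δ (head w) 𝟎 ℕ.* δ (a ∙ tail w) 𝟎) ws ℕ.+ count (affine ws) a b
split-size b a []       = refl
split-size b a (w ∷ ws) = begin
  δ ((b ∷ a) ∙ w) 𝟎 ℕ.+ sumL (λ w → δ ((b ∷ a) ∙ w) 𝟎) ws
    ≡⟨ cong (δ ((b ∷ a) ∙ w) 𝟎 ℕ.+_) (split-size b a ws) ⟩
  δ ((b ∷ a) ∙ w) 𝟎 ℕ.+ (infinite ws ℕ.+ count (affine ws) a b)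
    ≡⟨ step w ⟩
  infinite (w ∷ ws) ℕ.+ count (affine (w ∷ ws)) a b ∎
  where
  open ≡-Reasoning
  infinite : List (V 7) → ℕ
  infinite = sumL (λ w → δ (head w) 𝟎 ℕ.* δ (a ∙ tail w) 𝟎)
  values : ∀ b y → (δ (b * 𝟏 + y) 𝟎 ≡ δ y b × δ (b * ω + y) 𝟎 ≡ δ (ω² * y) b) × δ (b * ω² + y) 𝟎 ≡ δ (ω * y) b
  values = toWitness {a? = all? λ b → all? λ y →
    (δ (b * 𝟏 + y) 𝟎 ℕ.≟ δ y b ×-dec δ (b * ω + y) 𝟎 ℕ.≟ δ (ω² * y) b) ×-dec δ (b * ω² + y) 𝟎 ℕ.≟ δ (ω * y) b} tt
  move : ∀ {d e} p q → d ≡ e → d ℕ.+ (p ℕ.+ q) ≡ p ℕ.+ (e ℕ.+ q)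
  move {d} p q refl = trans (sym (ℕ.+-assoc d p q)) (trans (cong (ℕ._+ q) (ℕ.+-comm d p)) (ℕ.+-assoc p d q))
  step : ∀ w → δ ((b ∷ a) ∙ w) 𝟎 ℕ.+ (infinite ws ℕ.+ count (affine ws) a b) ≡
    infinite (w ∷ ws) ℕ.+ count (affine (w ∷ ws)) a b
  step (𝟎  ∷ u) = trans (cong (λ t → δ t 𝟎 ℕ.+ (infinite ws ℕ.+ count (affine ws) a b)) (cong (_+ a ∙ u) (F.zeroʳ b)))
    (trans (sym (ℕ.+-assoc (δ (a ∙ u) 𝟎) _ _))
    (cong (λ t → (t ℕ.+ infinite ws) ℕ.+ count (affine ws) a b) (sym (ℕ.*-identityˡ (δ (a ∙ u) 𝟎)))))
  step (𝟏  ∷ u) = move (infinite ws) _ (proj₁ (proj₁ (values b (a ∙ u))))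
  step (ω  ∷ u) = move (infinite ws) _ (trans (proj₂ (proj₁ (values b (a ∙ u)))) (cong (λ t → δ t b) (sym (∙-⊛ʳ ω² a u))))
  step (ω² ∷ u) = move (infinite ws) _ (trans (proj₂ (values b (a ∙ u))) (cong (λ t → δ t b) (sym (∙-⊛ʳ ω a u))))

-- Projective coordinates with the given hyperplane at infinity

contains? : ∀ {m d} (W : Subspace (F^ m) d) v → Dec (Subspace.Contains W v)
contains? W v = any-vector? λ cs → v ≟ⱽ lincomb (F^ _) cs (Subspace.basis W)

-- A proper subspace is not everything, by counting.
outside : ∀ {d m} → d ℕ.< m → (W : Subspace (F^ m) d) → ∃[ v ] ¬ Subspace.Contains W v
outside {d} {m} d<m W = decide (any-vector? λ v → ¬? (contains? W v))
  where
  open Subspace W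
  decide : Dec (∃[ v ] ¬ Contains v) → ∃[ v ] ¬ Contains v
  decide (yes found) = found
  decide (no none)   = ⊥-elim (ℕ.<⇒≱ (ℕ.^-monoʳ-< 4 (ℕ.s≤s (ℕ.s≤s ℕ.z≤n)) d<m)
    (Fin.injective⇒≤ {f = code} (λ {i} {j} → code-injective i j)))
    where
    coefficients : ∀ v → Contains v
    coefficients v = decidable-stable (contains? W v) (λ ¬c → none (v , ¬c))
    code : Fin (4 ℕ.^ m) → Fin (4 ℕ.^ d)
    code i = index (proj₁ (coefficients (unindex m i)))
    code-injective : ∀ i j → code i ≡ code j → i ≡ j
    code-injective i j e = unindex-injective m (trans (proj₂ (coefficients (unindex m i)))
      (trans (cong (λ cs → lincomb (F^ m) cs basis) (index-injective (proj₁ (coefficients (unindex m i))) (proj₁ (coefficients (unindex m j))) e))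
        (sym (proj₂ (coefficients (unindex m j))))))

-- The equivalence φ and the coordinates L on the extension field give a
-- semilinear parametrisation ψ of Π, and a vector v₀ outside Π extends it to
-- coordinates Ψ of the whole space.
module Frame (E : Extension 𝔽₄ 6) (Π : Hyperplane 6)
  (φ : SemilinearIsomorphism (asVectorSpace Π) (extensionSpace E))
  (L : V 6 → Extension.Carrier E) (τ : Automorphism)
  (L-⊕ : ∀ u v → L (u ⊕ v) ≡ Extension._+_ E (L u) (L v))
  (L-⊛ : ∀ c u → L (c ⊛ u) ≡ Extension._*_ E (Extension.ι E (to τ c)) (L u))
  (L-injective : ∀ {u v} → L u ≡ L v → u ≡ v)
  where

  private module E = Extension E
  open Subspace Π using (Contains)
  open SemilinearIsomorphism φ
  module f = IsGroupIsomorphism f-isGroupIsomorphism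
  module σ = IsRingIsomorphism σ-isRingIsomorphism

  -- The automorphism of ψ, which is σ⁻¹ τ.
  ρ : Automorphism
  ρ = record
    { to      = λ c → proj₁ (σ.surjective (to τ c))
    ; from    = λ c → from τ (σ c)
    ; to-from = λ c → σ.injective (trans (σρ (from τ (σ c))) (to-from τ (σ c)))
    ; from-to = λ c → trans (cong (from τ) (σρ c)) (from-to τ c)
    ; to-+    = λ c d → σ.injective (trans (σρ (c + d)) (trans (to-+ τ c d) (trans (sym (cong₂ _+_ (σρ c) (σρ d))) (sym (σ.+-homo _ _)))))
    ; to-*    = λ c d → σ.injective (trans (σρ (c * d)) (trans (to-* τ c d) (trans (sym (cong₂ _*_ (σρ c) (σρ d))) (sym (σ.*-homo _ _)))))
    }
    where
    σρ : ∀ c → σ (proj₁ (σ.surjective (to τ c))) ≡ to τ c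
    σρ c = proj₂ (σ.surjective (to τ c)) refl

  σ-ρ : ∀ c → σ (to ρ c) ≡ to τ c
  σ-ρ c = proj₂ (σ.surjective (to τ c)) refl

  preimage : V 6 → Σ[ v ∈ V 7 ] Contains v
  preimage u = proj₁ (f.surjective (L u))

  f-preimage : ∀ u → f (preimage u) ≡ L u
  f-preimage u = proj₂ (f.surjective (L u)) refl

  ψ : V 6 → V 7
  ψ u = proj₁ (preimage u)

  ψ-contained : ∀ u → Contains (ψ u)
  ψ-contained u = proj₂ (preimage u)

  private
    module U = LeftModule (asVectorSpace Π)

  ψ-⊕ : ∀ u v → ψ (u ⊕ v) ≡ ψ u ⊕ ψ v
  ψ-⊕ u v = f.injective {preimage (u ⊕ v)} {preimage u U.+ᴹ preimage v} (begin
    f (preimage (u ⊕ v))                  ≡⟨ f-preimage (u ⊕ v) ⟩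
    L (u ⊕ v)                             ≡⟨ L-⊕ u v ⟩
    L u E.+ L v                           ≡⟨ cong₂ E._+_ (f-preimage u) (f-preimage v) ⟨
    f (preimage u) E.+ f (preimage v)     ≡⟨ f.∙-homo (preimage u) (preimage v) ⟨
    f (preimage u U.+ᴹ preimage v)        ∎)
    where open ≡-Reasoning

  ψ-⊛ : ∀ c u → ψ (c ⊛ u) ≡ to ρ c ⊛ ψ u
  ψ-⊛ c u = f.injective {preimage (c ⊛ u)} {to ρ c U.*ₗ preimage u} (begin
    f (preimage (c ⊛ u))                  ≡⟨ f-preimage (c ⊛ u) ⟩
    L (c ⊛ u)                             ≡⟨ L-⊛ c u ⟩
    E.ι (to τ c) E.* L u                  ≡⟨ cong₂ (λ s t → E.ι s E.* t) (σ-ρ c) (f-preimage u) ⟨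
    E.ι (σ (to ρ c)) E.* f (preimage u)   ≡⟨ f-semilinear (to ρ c) (preimage u) ⟨
    f (to ρ c U.*ₗ preimage u)            ∎)
    where open ≡-Reasoning

  ψ-injective : ∀ {u v} → ψ u ≡ ψ v → u ≡ v
  ψ-injective {u} {v} e = L-injective (trans (sym (f-preimage u)) (trans (f.⟦⟧-cong {preimage u} {preimage v} e) (f-preimage v)))

  opaque
    v₀ : V 7
    v₀ = proj₁ (outside (ℕ.n<1+n 6) Π)

    v₀-outside : ¬ Contains v₀
    v₀-outside = proj₂ (outside (ℕ.n<1+n 6) Π)

  Ψ : V 7 → V 7
  Ψ (l ∷ u) = ψ u ⊕ to ρ l ⊛ v₀

  ψ-𝟘 : ψ 𝟘 ≡ 𝟘
  ψ-𝟘 = trans (ψ-⊛ 𝟎 𝟘) (trans (cong (_⊛ ψ 𝟘) (to-𝟎 ρ)) (⊛-zeroˡ (ψ 𝟘)))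

  Ψ-ψ : ∀ u → Ψ (𝟎 ∷ u) ≡ ψ u
  Ψ-ψ u = trans (cong (λ c → ψ u ⊕ c ⊛ v₀) (to-𝟎 ρ)) (trans (cong (ψ u ⊕_) (⊛-zeroˡ v₀)) (⊕-identityʳ (ψ u)))

  Ψ-⊕ : ∀ v w → Ψ (v ⊕ w) ≡ Ψ v ⊕ Ψ w
  Ψ-⊕ (l ∷ u) (m ∷ w) = begin
    ψ (u ⊕ w) ⊕ to ρ (l + m) ⊛ v₀
      ≡⟨ cong₂ _⊕_ (ψ-⊕ u w) (trans (cong (_⊛ v₀) (to-+ ρ l m)) (⊛-distribʳ v₀ (to ρ l) (to ρ m))) ⟩
    (ψ u ⊕ ψ w) ⊕ (to ρ l ⊛ v₀ ⊕ to ρ m ⊛ v₀)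
      ≡⟨ ⊕-interchange (ψ u) (ψ w) (to ρ l ⊛ v₀) (to ρ m ⊛ v₀) ⟩
    (ψ u ⊕ to ρ l ⊛ v₀) ⊕ (ψ w ⊕ to ρ m ⊛ v₀)             ∎
    where open ≡-Reasoning

  Ψ-⊛ : ∀ c v → Ψ (c ⊛ v) ≡ to ρ c ⊛ Ψ v
  Ψ-⊛ c (l ∷ u) = begin
    ψ (c ⊛ u) ⊕ to ρ (c * l) ⊛ v₀
      ≡⟨ cong₂ _⊕_ (ψ-⊛ c u) (trans (cong (_⊛ v₀) (to-* ρ c l)) (⊛-assoc (to ρ c) (to ρ l) v₀)) ⟩
    to ρ c ⊛ ψ u ⊕ to ρ c ⊛ (to ρ l ⊛ v₀)                 ≡⟨ ⊛-distribˡ (to ρ c) (ψ u) (to ρ l ⊛ v₀) ⟨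
    to ρ c ⊛ (ψ u ⊕ to ρ l ⊛ v₀)                          ∎
    where open ≡-Reasoning

  to-ρ≢0 : ∀ {l} → l ≢ 𝟎 → to ρ l ≢ 𝟎
  to-ρ≢0 l≢0 e = l≢0 (Automorphism.to-injective ρ (trans e (sym (to-𝟎 ρ))))

  -- Π is given by the vanishing of the first coordinate.
  Ψ-inside : ∀ v → Contains (Ψ v) → head v ≡ 𝟎
  Ψ-inside (l ∷ u) inside = decide (l ≟ 𝟎)
    where
    decide : Dec (l ≡ 𝟎) → l ≡ 𝟎
    decide (yes l≡0) = l≡0
    decide (no  l≢0) = ⊥-elim (v₀-outside (subst Contains
      (trans (cong (λ t → inv (to ρ l) ⊛ t) (trans (⊕-comm (ψ u) _) (trans (cong (_⊕ ψ u) (⊕-comm (ψ u) (to ρ l ⊛ v₀))) (⊕-cancel (to ρ l ⊛ v₀) (ψ u)))))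
        (inv-⊛ (to ρ l) v₀ (to-ρ≢0 l≢0)))
      (Contains-* Π (inv (to ρ l)) {ψ u ⊕ Ψ (l ∷ u)} (Contains-+ Π (ψ-contained u) inside))))

  Ψ-kernel : ∀ v → Ψ v ≡ 𝟘 → v ≡ 𝟘
  Ψ-kernel (l ∷ u) e = with-head (Ψ-inside (l ∷ u) (subst Contains (sym e) (Contains-0 Π)))
    where
    with-head : l ≡ 𝟎 → l ∷ u ≡ 𝟘
    with-head refl = cong (𝟎 ∷_) (ψ-injective (trans (sym (Ψ-ψ u)) (trans e (sym ψ-𝟘))))

  Ψ-injective : ∀ {v w} → Ψ v ≡ Ψ w → v ≡ w
  Ψ-injective {v} {w} e = ⊕≡𝟘⇒≡ (Ψ-kernel (v ⊕ w) (trans (Ψ-⊕ v w) (trans (cong (_⊕ Ψ w) e) (⊕-self (Ψ w)))))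

  -- The inverse exists by counting; its definition is never unfolded.
  opaque
    Ψ⁻¹ : V 7 → V 7
    Ψ⁻¹ v = proj₁ (injective-endomap⇒onto Ψ Ψ-injective v)

    Ψ-Ψ⁻¹ : ∀ v → Ψ (Ψ⁻¹ v) ≡ v
    Ψ-Ψ⁻¹ v = proj₂ (injective-endomap⇒onto Ψ Ψ-injective v)

  Ψ⁻¹-Ψ : ∀ v → Ψ⁻¹ (Ψ v) ≡ v
  Ψ⁻¹-Ψ v = Ψ-injective (Ψ-Ψ⁻¹ (Ψ v))

  Ψ⁻¹-⊛ : ∀ c v → Ψ⁻¹ (c ⊛ v) ≡ from ρ c ⊛ Ψ⁻¹ v
  Ψ⁻¹-⊛ c v = Ψ-injective (trans (Ψ-Ψ⁻¹ (c ⊛ v)) (sym (trans (Ψ-⊛ (from ρ c) (Ψ⁻¹ v))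
    (cong₂ _⊛_ (to-from ρ c) (Ψ-Ψ⁻¹ v)))))

  Ψ⁻¹≢0 : ∀ {v} → v ≢ 𝟘 → Ψ⁻¹ v ≢ 𝟘
  Ψ⁻¹≢0 {v} v≢0 e = v≢0 (trans (sym (Ψ-Ψ⁻¹ v)) (trans (cong Ψ e) (trans (Ψ-ψ 𝟘) ψ-𝟘)))

  module Equation = SemilinearCoordinates ρ Ψ Ψ⁻¹ Ψ-⊕ Ψ-⊛ Ψ-kernel Ψ-Ψ⁻¹ Ψ⁻¹-Ψ

-- Intersection sizes in coordinates, and the theorem

open PointSet

-- The section by a hyperplane with equation test v = 0 has as many points as
-- the enumeration of C has zeros of test.
section-size : ∀ {n k} (C : PointSet (PG n)) (size : HasSize (PG n) C k) (W : Hyperplane n)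
  (test : V (suc n) → GF4) →
  (∀ v → Subspace.Contains W v → test v ≡ 𝟎) → (∀ v → test v ≡ 𝟎 → Subspace.Contains W v) →
  HasSize (PG n) (intersection W C) (sumL (λ p → δ (test (proj₁ p)) 𝟎) (tabulate (proj₁ size)))
section-size {n} {k} C (pt , pt∈ , pt-inj , pt-cover) W test inside⇒0 0⇒inside =
  (λ j → pt (e j)) ,
  (λ j → 0⇒inside (proj₁ (pt (e j))) (zero-at j) , pt∈ (e j)) ,
  (λ i j p → e-inj i j (pt-inj (e i) (e j) p)) ,
  covers
  where
  enumerated = zeros-enumerated (λ p → test (proj₁ p)) pt
  e = proj₁ enumerated
  zero-at = proj₁ (proj₂ enumerated)
  e-inj = proj₁ (proj₂ (proj₂ enumerated))
  e-onto = proj₂ (proj₂ (proj₂ enumerated))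
  covers : ∀ r → intersection W C ∋ r → ∃[ j ] _∼_ (PG n) (pt (e j)) r
  covers r@(v , v≢0) (inside , r∈) with pt-cover r r∈
  ... | i , c , v≡ with e-onto i (inside⇒0 (proj₁ (pt i)) (subst (Subspace.Contains W)
          (trans (cong (inv c ⊛_) v≡) (inv-⊛ c (proj₁ (pt i)) (coefficient≢0 {v = proj₁ (pt i)} v≢0 v≡)))
          (Contains-* W (inv c) {v} inside)))
  ... | j , refl = j , c , v≡

other-size : ∀ {h₁ h₂ s : ℕ} → s ≡ h₁ ⊎ s ≡ h₂ → ∃[ h ] (∀ {m} → m ≡ h₁ ⊎ m ≡ h₂ → m ≡ s ⊎ m ≡ h)
other-size {h₁} {h₂} (inj₁ refl) = h₂ , λ m → m
other-size {h₁} {h₂} (inj₂ refl) = h₁ , λ { (inj₁ e) → inj₂ e ; (inj₂ e) → inj₁ e }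

-- The number of points is a variable k with k ≡ 430, which keeps the lists of
-- points from being unfolded.
module Contradiction (E : Extension 𝔽₄ 6) (z : Extension.Carrier E)
  (isPrimitive : IsPrimitiveElement (Extension.K E) z)
  (C : PointSet (PG 6)) (k : ℕ) (k≡430 : k ≡ 430) (size : HasSize (PG 6) C k) (two-sizes : HasTwoIntersectionSizes C)
  (Π : Hyperplane 6) (equivalent : ProjectivelyEquivalent (restriction Π C) (HillCap E z))
  (adapted : HillCoordinates.Adapted E z isPrimitive) where

  open Char2 E using (module E; module ι; module R)
  open HillCoordinates E z isPrimitive using (module Coordinates)
  open Coordinates adapted
  φ = proj₁ equivalent
  open Frame E Π φ L τ L-⊕ L-⊛ L-injective
  open SemilinearIsomorphism φ using (f; onPoints)

  pt : Fin k → Point (PG 6)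
  pt = proj₁ size

  pt∈ : ∀ i → C ∋ pt i
  pt∈ = proj₁ (proj₂ size)

  pt-injective : ∀ i j → _∼_ (PG 6) (pt i) (pt j) → i ≡ j
  pt-injective = proj₁ (proj₂ (proj₂ size))

  pt-cover : ∀ r → C ∋ r → ∃[ i ] _∼_ (PG 6) (pt i) r
  pt-cover = proj₂ (proj₂ (proj₂ size))

  -- The coordinates of the points of C.
  q : Fin k → V 7
  q i = Ψ⁻¹ (proj₁ (pt i))

  qs : List (V 7)
  qs = tabulate q

  Ψ-q : ∀ i → Ψ (q i) ≡ proj₁ (pt i)
  Ψ-q i = Ψ-Ψ⁻¹ (proj₁ (pt i))

  ψ≢0 : ∀ {u} → u ≢ 𝟘 → ψ u ≢ 𝟘
  ψ≢0 u≢0 e = u≢0 (ψ-injective (trans e (sym ψ-𝟘)))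

  point : ∀ u → u ≢ 𝟘 → Point (asVectorSpace Π)
  point u u≢0 = preimage u , ψ≢0 u≢0

  -- The points at infinity of C are those of hill.
  hill-in-C : ∀ {κ} → κ ∈ hill → (κ≢0 : κ ≢ 𝟘) → C ∋ (ψ κ , ψ≢0 κ≢0)
  hill-in-C {κ} κ∈ κ≢0 = Equivalence.from (proj₂ equivalent (point κ κ≢0))
    (L κ , hill-in-orbits κ∈ , 𝟏 , trans (f-preimage κ) (sym (trans (cong (E._* L κ) ι.1#-homo) (R.*-identityˡ (L κ)))))

  C-in-hill : ∀ {u} (u≢0 : u ≢ 𝟘) → C ∋ (ψ u , ψ≢0 u≢0) → ∃[ κ ] κ ∈ hill × Multiple u κ
  C-in-hill {u} u≢0 ∈C = from-orbit (Equivalence.to (proj₂ equivalent (point u u≢0)) ∈C)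
    where
    from-orbit : HillCap E z ∋ onPoints (point u u≢0) → ∃[ κ ] κ ∈ hill × Multiple u κ
    from-orbit (x , orbit , d , fu≡) = spanned (orbits-spanned orbit)
      where
      spanned : Spanned x → ∃[ κ ] κ ∈ hill × Multiple u κ
      spanned (κ , κ∈ , c , x≡) = κ , κ∈ , from τ d * c , L-injective (begin
        L u                                            ≡⟨ f-preimage u ⟨
        f (preimage u)                                 ≡⟨ fu≡ ⟩
        E.ι d E.* x                                    ≡⟨ cong₂ E._*_ (cong E.ι (sym (to-from τ d))) x≡ ⟩
        E.ι (to τ (from τ d)) E.* (E.ι (to τ c) E.* L κ) ≡⟨ R.*-assoc _ _ _ ⟨
        (E.ι (to τ (from τ d)) E.* E.ι (to τ c)) E.* L κ
          ≡⟨ cong (E._* L κ) (ι.*-homo (to τ (from τ d)) (to τ c)) ⟨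
        E.ι (to τ (from τ d) * to τ c) E.* L κ         ≡⟨ cong (λ t → E.ι t E.* L κ) (to-* τ (from τ d) c) ⟨
        E.ι (to τ (from τ d * c)) E.* L κ              ≡⟨ L-⊛ (from τ d * c) κ ⟨
        L ((from τ d * c) ⊛ κ)                         ∎)
        where open ≡-Reasoning

  0∷-multiple : ∀ {u κ : V 6} → Multiple u κ → Multiple (𝟎 ∷ u) (𝟎 ∷ κ)
  0∷-multiple (c , e) = c , cong₂ _∷_ (sym (F.zeroʳ c)) e

  section-point : ∀ i u → q i ≡ 𝟎 ∷ u → ∃[ κ ] κ ∈ hill × Multiple u κ
  section-point i u q≡ = C-in-hill u≢0 (respects C {pt i} {ψ u , ψ≢0 u≢0}
    (𝟏 , trans ψu≡ (sym (⊛-identity (proj₁ (pt i))))) (pt∈ i))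
    where
    ψu≡ : ψ u ≡ proj₁ (pt i)
    ψu≡ = trans (sym (Ψ-ψ u)) (trans (cong Ψ (sym q≡)) (Ψ-q i))
    u≢0 : u ≢ 𝟘
    u≢0 e = proj₂ (pt i) (trans (sym ψu≡) (trans (cong ψ e) ψ-𝟘))

  represent : ∀ {u} → 𝟎 ∷ u ∈ qs → ∃[ κ ] κ ∈ hill × Multiple (𝟎 ∷ u) (𝟎 ∷ κ)
  represent {u} u∈ = proj₁ found , proj₁ (proj₂ found) , 0∷-multiple (proj₂ (proj₂ found))
    where
    index-of : ∃[ i ] 𝟎 ∷ u ≡ q i
    index-of = ∈-tabulate⁻ {f = q} u∈
    found : ∃[ κ ] κ ∈ hill × Multiple u κ
    found = section-point (proj₁ index-of) u (sym (proj₂ index-of))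

  hill-point : ∀ κ → κ ∈ hill → κ ≢ 𝟘 → ∃[ i ] Multiple (q i) (𝟎 ∷ κ)
  hill-point κ κ∈ κ≢0 = i , multiple-sym {u = 𝟎 ∷ κ} {q i} (λ e → κ≢0 (tail-injective e)) (from ρ c , scaled)
    where
    covered : ∃[ i ] _∼_ (PG 6) (pt i) (ψ κ , ψ≢0 κ≢0)
    covered = pt-cover (ψ κ , ψ≢0 κ≢0) (hill-in-C κ∈ κ≢0)
    i = proj₁ covered
    c = proj₁ (proj₂ covered)
    scaled : 𝟎 ∷ κ ≡ from ρ c ⊛ q i
    scaled = trans (sym (Ψ⁻¹-Ψ (𝟎 ∷ κ))) (trans (cong Ψ⁻¹ (trans (Ψ-ψ κ) (proj₂ (proj₂ covered)))) (Ψ⁻¹-⊛ c (proj₁ (pt i))))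

  represented : ∀ {κ} → κ ∈ hill → ∃[ w ] w ∈ qs × Multiple w (𝟎 ∷ κ)
  represented {κ} κ∈ = q (proj₁ found) , ∈-tabulate⁺ {f = q} (proj₁ found) , proj₂ found
    where
    found : ∃[ i ] Multiple (q i) (𝟎 ∷ κ)
    found = hill-point κ κ∈ (All.lookup hill-nonzero κ∈)

  qs≢0 : All (_≢ 𝟘) qs
  qs≢0 = All.tabulate⁺ (λ i → Ψ⁻¹≢0 (proj₂ (pt i)))

  qs-apart : AllPairs (λ u v → ¬ Multiple u v) qs
  qs-apart = AllPairs.tabulate⁺ (λ {i} {j} i≢j (c , e) → i≢j (sym (pt-injective j i
    (to ρ c , trans (sym (Ψ-q i)) (trans (cong Ψ e) (trans (Ψ-⊛ c (q j)) (cong (to ρ c ⊛_) (Ψ-q j))))))))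

  open DoubleCounting hill qs hill-apart qs≢0 qs-apart hill-nonzero represent represented

  size-of : V 7 → ℕ
  size-of a = sumL (λ w → δ (a ∙ w) 𝟎) qs

  h₁ = proj₁ two-sizes
  h₂ = proj₁ (proj₂ two-sizes)

  size-two-valued : ∀ a → a ≢ 𝟘 → size-of a ≡ h₁ ⊎ size-of a ≡ h₂
  size-two-valued a a≢0 = subst (λ m → m ≡ h₁ ⊎ m ≡ h₂) same
    (Equivalence.to (proj₂ (proj₂ (proj₂ two-sizes)) _)
      (Equation.hyperplane a a≢0 , section-size C size (Equation.hyperplane a a≢0) (λ v → a ∙ Ψ⁻¹ v)
        (Equation.hyperplane⇒equation a a≢0) (Equation.equation⇒hyperplane a a≢0)))
    where
    same : sumL (λ p → δ (a ∙ Ψ⁻¹ (proj₁ p)) 𝟎) (tabulate pt) ≡ size-of a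
    same = trans (sym (sumL-map (λ w → δ (a ∙ w) 𝟎) (λ p → Ψ⁻¹ (proj₁ p)) (tabulate pt)))
      (cong (sumL (λ w → δ (a ∙ w) 𝟎)) (List.map-tabulate pt (λ p → Ψ⁻¹ (proj₁ p))))

  -- The affine points of C.
  xs : List (V 6)
  xs = affine qs

  size-split : ∀ b a → size-of (b ∷ a) ≡ zeros hill a ℕ.+ count xs a b
  size-split b a = trans (split-size b a qs) (cong (ℕ._+ count xs a b)
    (count-infinite (λ w → δ (a ∙ tail w) 𝟎) (λ κ → δ (a ∙ κ) 𝟎) agree))
    where
    agree : ∀ {w κ} → w ≢ 𝟘 → Multiple w (𝟎 ∷ κ) → δ (a ∙ tail w) 𝟎 ≡ δ (a ∙ κ) 𝟎
    agree {w} {κ} w≢0 (c , refl) = trans (cong (λ t → δ t 𝟎) (∙-⊛ʳ c a κ))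
      (trans (cong (δ (c * (a ∙ κ))) (sym (F.zeroʳ c))) (δ-scale c (a ∙ κ) 𝟎 (coefficient≢0 {u = c ⊛ (𝟎 ∷ κ)} {𝟎 ∷ κ} w≢0 refl)))

  infinite-points : sumL (λ w → δ (head w) 𝟎) qs ≡ 78
  infinite-points = trans (sumL-cong (λ w → sym (ℕ.*-identityʳ (δ (head w) 𝟎))) qs)
    (trans (count-infinite (λ _ → 1) (λ _ → 1) (λ _ _ → refl)) (trans (sumL-1 hill) hill-length))

  -- The hyperplane Π itself, so that 78 is one of the two sizes.
  size-infinite : size-of (𝟏 ∷ 𝟘) ≡ 78
  size-infinite = trans (sumL-cong first qs) infinite-points
    where
    first : ∀ w → δ ((𝟏 ∷ 𝟘) ∙ w) 𝟎 ≡ δ (head w) 𝟎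
    first (l ∷ u) = cong (λ t → δ t 𝟎) (trans (cong (l +_) (𝟘-∙ u)) (F.+-identityʳ l))

  length-xs : length xs ≡ 352
  length-xs = difference infinite-points (trans (List.length-tabulate q) k≡430) (length-affine qs)
    where
    difference : ∀ {m n l} → m ≡ 78 → n ≡ 430 → m ℕ.+ l ≡ n → l ≡ 352
    difference {l = l} refl refl e = ℕ.+-cancelˡ-≡ 78 l 352 e

  impossible : ⊥
  impossible = no-configuration xs (proj₁ other) length-xs
    (λ a a≢0 b → subst (λ m → m ≡ 78 ⊎ m ≡ proj₁ other) (size-split b a)
      (proj₂ other (size-two-valued (b ∷ a) (λ e → a≢0 (tail-injective e)))))
    where
    other : ∃[ h ] (∀ {m} → m ≡ h₁ ⊎ m ≡ h₂ → m ≡ 78 ⊎ m ≡ h)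
    other = other-size (subst (λ m → m ≡ h₁ ⊎ m ≡ h₂) size-infinite (size-two-valued (𝟏 ∷ 𝟘) (λ ())))

theorem1p1 : (E : Extension 𝔽₄ 6) (z : Extension.Carrier E) →
    IsPrimitiveElement (Extension.K E) z →
    (C : PointSet (PG 6)) →
    IsCap (PG 6) 430 C →
    HasTwoIntersectionSizes C →
    ¬ (Σ[ Π ∈ Hyperplane 6 ] ProjectivelyEquivalent (restriction Π C) (HillCap E z))
theorem1p1 E z isPrimitive C (size , _) two-sizes (Π , equivalent) =
  Contradiction.impossible E z isPrimitive C 430 refl size two-sizes Π equivalent
    (HillCoordinates.adapted E z isPrimitive)
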